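{- For all integers $m\geq 0$ and $n\geq 1$, \[ N(\leq m,n)\geq M(\leq m,n)\geq N(\leq m-1,n). \]
   Context: For a partition $\lambda$, $\operatorname{rank}(\lambda)$ is its largest part minus its number of parts. $\operatorname{crank}(\lambda)$ is the largest part of $\lambda$ if $\lambda$ contains no part equal to $1$; otherwise it is the number of parts larger than the number of ones minus the number of ones. For $n\geq1$, $N(m,n)$ is the number of partitions of $n$ with rank $m$. For $n>1$, $M(m,n)$ is the number of partitions of $n$ with crank $m$. For $n=1$ one sets $M(0,1)=-1$, $M(1,1)=M(-1,1)=1$ and $M(m,1)=0$ for $m\notin\{ -1,0,1\}$. The cumulative functions are $N(\leq m,n)=\sum_{r\leq m}N(r,n)$ and $M(\leq m,n)=\sum_{r\leq m}M(r,n)$. -}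

module Defs where

open import Data.Integer as ℤ using (ℤ; +_; -[1+_]; 0ℤ; 1ℤ; -1ℤ; ∣_∣)
import Data.Integer.Properties as ℤₚ
open import Data.List using (List; []; _∷_; concatMap; filter; foldr; length; map; upTo)
open import Data.List.Membership.Propositional using (_∈_; find; lose)
open import Data.List.Membership.Propositional.Properties using (∈-concatMap⁺; ∈-concatMap⁻; ∈-map⁺; ∈-map⁻; ∈-upTo⁺; ∈-upTo⁻)
open import Data.List.Properties using (∷-injectiveˡ; ∷-injectiveʳ; filter-none; length-filter)
open import Data.List.Relation.Binary.Disjoint.Propositional using (Disjoint)
open import Data.List.Relation.Unary.All as All using (All; []; _∷_)
import Data.List.Relation.Unary.All.Properties as Allₚ
open import Data.List.Relation.Unary.AllPairs as AllPairs using ([]; _∷_)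
import Data.List.Relation.Unary.AllPairs.Properties as AllPairsₚ
open import Data.List.Relation.Unary.Any using (here)
open import Data.List.Relation.Unary.Linked using (Linked; []; [-]; _∷_)
open import Data.List.Relation.Unary.Unique.Propositional using (Unique)
import Data.List.Relation.Unary.Unique.Propositional.Properties as Uniqueₚ
open import Data.Nat using (ℕ; zero; suc; _+_; _∸_; _⊓_; _⊔_; _≤_; _<_; _≥_; z≤n; s≤s; s≤s⁻¹; _≟_; _<?_)
open import Data.Nat.ListAction using (sum)
open import Data.Nat.Properties
open import Data.Product using (_×_; _,_; proj₁; proj₂)
open import Relation.Binary.PropositionalEquality using (_≡_; _≢_; refl; sym; trans; cong; cong₂; subst)

record IsPartition (n : ℕ) (ps : List ℕ) : Set where
  field
    positive   : All (1 ≤_) ps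
    decreasing : Linked _≥_ ps
    total      : sum ps ≡ n

-- The partitions of n into parts ≤ k. The first argument only ensures
-- termination; any value ≥ n gives the full list.
partitionsBelow : ℕ → ℕ → ℕ → List (List ℕ)
partitionsBelow _          k zero    = [] ∷ []
partitionsBelow zero       k (suc n) = []
partitionsBelow (suc fuel) k (suc n) =
  concatMap (λ i → map (suc i ∷_) (partitionsBelow fuel (suc i) (n ∸ i))) (upTo (k ⊓ suc n))

-- Every partition of n, exactly once: see partitions-sound,
-- partitions-complete and partitions-unique.
partitions : ℕ → List (List ℕ)
partitions n = partitionsBelow n n n

largestPart : List ℕ → ℕ
largestPart = foldr _⊔_ 0

numberOfParts : List ℕ → ℕ
numberOfParts = length

ones : List ℕ → ℕ
ones ps = length (filter (_≟ 1) ps)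

partsLargerThan : ℕ → List ℕ → ℕ
partsLargerThan k ps = length (filter (k <?_) ps)

rank : List ℕ → ℤ
rank ps = + largestPart ps ℤ.- + numberOfParts ps

crank : List ℕ → ℤ
crank ps with ones ps
... | zero      = + largestPart ps
... | ω@(suc _) = + partsLargerThan ω ps ℤ.- + ω

N : ℤ → ℕ → ℤ
N m n = + length (filter (λ ps → rank ps ℤ.≟ m) (partitions n))

crankCount : ℤ → ℕ → ℤ
crankCount m n = + length (filter (λ ps → crank ps ℤ.≟ m) (partitions n))

M₁ : ℤ → ℤ
M₁ (+ 0)    = -1ℤ
M₁ (+ 1)    = 1ℤ
M₁ -[1+ 0 ] = 1ℤ
M₁ _        = 0ℤ

-- M m 1 is a convention and not the crank count; the value at n = 0 is
-- immaterial.
M : ℤ → ℕ → ℤ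
M m 1 = M₁ m
M m n = crankCount m n

-- f m + f (m - 1) + ... + f (m - (k - 1))
sumDown : (ℤ → ℤ) → ℤ → ℕ → ℤ
sumDown f m zero    = 0ℤ
sumDown f m (suc k) = sumDown f m k ℤ.+ f (m ℤ.- + k)

-- The sum of f r over all r ≤ m, for f vanishing below -n: the summation
-- range runs down from m to m - (∣ m ∣ + n) ≤ -n (see cumulative-full).
cumulative : (ℤ → ℤ) → ℕ → ℤ → ℤ
cumulative f n m = sumDown f m (suc (∣ m ∣ + n))

N≤ : ℤ → ℕ → ℤ
N≤ m n = cumulative (λ r → N r n) n m

M≤ : ℤ → ℕ → ℤ
M≤ m n = cumulative (λ r → M r n) n m

private
  BoundedBy : ℕ → List ℕ → Set
  BoundedBy k = All (_≤ k)

  linked-∷ : ∀ {i ps} → BoundedBy i ps → Linked _≥_ ps → Linked _≥_ (i ∷ ps)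
  linked-∷ []      []  = [-]
  linked-∷ (p ∷ _) lnk = p ∷ lnk

  below-sound : ∀ fuel k n {ps} → ps ∈ partitionsBelow fuel k n →
                IsPartition n ps × BoundedBy k ps
  below-sound zero       k zero (here refl) = record { positive = [] ; decreasing = [] ; total = refl } , []
  below-sound (suc fuel) k zero (here refl) = record { positive = [] ; decreasing = [] ; total = refl } , []
  below-sound (suc fuel) k (suc n) ps∈
    with i , i∈ , q ← find (∈-concatMap⁻ (λ i → map (suc i ∷_) (partitionsBelow fuel (suc i) (n ∸ i))) {xs = upTo (k ⊓ suc n)} ps∈)
    with qs , qs∈ , refl ← ∈-map⁻ (suc i ∷_) q
    with isP , bnd ← below-sound fuel (suc i) (n ∸ i) qs∈
    = record
        { positive   = s≤s z≤n ∷ positive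
        ; decreasing = linked-∷ bnd decreasing
        ; total      = cong suc (trans (cong (λ x → i + x) total) (m+[n∸m]≡n i≤n))
        }
    , i<k ∷ All.map (λ p → ≤-trans p i<k) bnd
    where
    open IsPartition isP
    i<k : suc i ≤ k
    i<k = ≤-trans (∈-upTo⁻ i∈) (m⊓n≤m k (suc n))
    i≤n : i ≤ n
    i≤n = s≤s⁻¹ (≤-trans (∈-upTo⁻ i∈) (m⊓n≤n k (suc n)))

  head-bounds : ∀ {i ps} → Linked _≥_ (i ∷ ps) → BoundedBy i ps
  head-bounds [-]       = []
  head-bounds (p ∷ lnk) = p ∷ All.map (λ q → ≤-trans q p) (head-bounds lnk)

  linked-tail : ∀ {i ps} → Linked _≥_ (i ∷ ps) → Linked _≥_ ps
  linked-tail [-]       = []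
  linked-tail (_ ∷ lnk) = lnk

  below-complete : ∀ fuel k n {ps} → n ≤ fuel → All (1 ≤_) ps → Linked _≥_ ps →
                   sum ps ≡ n → BoundedBy k ps → ps ∈ partitionsBelow fuel k n
  below-complete zero       k zero {[]} _ _ _ _ _ = here refl
  below-complete (suc fuel) k zero {[]} _ _ _ _ _ = here refl
  below-complete fuel k .(suc (i + sum ps)) {suc i ∷ ps} n≤ (_ ∷ pos) lnk refl (i<k ∷ bnd)
    with suc fuel′ ← fuel =
    ∈-concatMap⁺ (λ j → map (suc j ∷_) (partitionsBelow fuel′ (suc j) (i + sum ps ∸ j)))
      (lose (∈-upTo⁺ (⊓-glb i<k (s≤s (m≤m+n i (sum ps)))))
        (∈-map⁺ (suc i ∷_)
          (below-complete fuel′ (suc i) (i + sum ps ∸ i)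
            (≤-trans (m∸n≤m (i + sum ps) i) (s≤s⁻¹ n≤))
            pos (linked-tail lnk) (sym (m+n∸m≡n i (sum ps))) (head-bounds lnk))))

  below-unique : ∀ fuel k n → Unique (partitionsBelow fuel k n)
  below-unique zero       k zero    = [] ∷ []
  below-unique (suc fuel) k zero    = [] ∷ []
  below-unique zero       k (suc n) = []
  below-unique (suc fuel) k (suc n) = Uniqueₚ.concat⁺
    (Allₚ.map⁺ (All.universal (λ i → Uniqueₚ.map⁺ ∷-injectiveʳ (below-unique fuel (suc i) (n ∸ i))) _))
    (AllPairsₚ.map⁺ (AllPairs.map disjoint (Uniqueₚ.upTo⁺ (k ⊓ suc n))))
    where
    startingWith : ℕ → List (List ℕ)
    startingWith i = map (suc i ∷_) (partitionsBelow fuel (suc i) (n ∸ i))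
    disjoint : ∀ {i j} → i ≢ j → Disjoint (startingWith i) (startingWith j)
    disjoint {i} {j} i≢j (v∈i , v∈j)
      with _ , _ , refl ← ∈-map⁻ (suc i ∷_) v∈i
      with _ , _ , eq   ← ∈-map⁻ (suc j ∷_) v∈j
      = i≢j (suc-injective (∷-injectiveˡ eq))

  parts≤sum : ∀ {ps} → BoundedBy (sum ps) ps
  parts≤sum {[]}     = []
  parts≤sum {p ∷ ps} = m≤m+n p (sum ps) ∷ All.map (λ q → ≤-trans q (m≤n+m (sum ps) p)) parts≤sum

  length≤sum : ∀ {ps} → All (1 ≤_) ps → length ps ≤ sum ps
  length≤sum []        = z≤n
  length≤sum (p ∷ pos) = +-mono-≤ p (length≤sum pos)

partitions-sound : ∀ {n ps} → ps ∈ partitions n → IsPartition n ps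
partitions-sound {n} ps∈ = proj₁ (below-sound n n n ps∈)

partitions-complete : ∀ {n ps} → IsPartition n ps → ps ∈ partitions n
partitions-complete {n} isP =
  below-complete n n n ≤-refl positive decreasing total (subst (λ k → BoundedBy k _) total parts≤sum)
  where open IsPartition isP

partitions-unique : ∀ n → Unique (partitions n)
partitions-unique n = below-unique n n n

private
  difference-≥ : ∀ a {b n} → b ≤ n → ℤ.- + n ℤ.≤ + a ℤ.- + b
  difference-≥ a {b} {n} b≤n = subst (ℤ._≤ + a ℤ.- + b) (ℤₚ.+-identityˡ (ℤ.- + n))
    (ℤₚ.+-mono-≤ (ℤ.+≤+ (z≤n {a})) (ℤₚ.neg-mono-≤ (ℤ.+≤+ b≤n)))

  length≤ : ∀ {n ps} → IsPartition n ps → length ps ≤ n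
  length≤ isP = ≤-trans (length≤sum positive) (≤-reflexive total)
    where open IsPartition isP

rank-≥ : ∀ {n ps} → IsPartition n ps → ℤ.- + n ℤ.≤ rank ps
rank-≥ {ps = ps} isP = difference-≥ (largestPart ps) (length≤ isP)

crank-≥ : ∀ {n ps} → IsPartition n ps → ℤ.- + n ℤ.≤ crank ps
crank-≥ {n} {ps} isP with ones ps | length-filter (_≟ 1) ps
... | zero      | _   = ℤₚ.≤-trans (ℤₚ.neg-mono-≤ (ℤ.+≤+ (z≤n {n}))) (ℤ.+≤+ z≤n)
... | ω@(suc _) | ω≤ = difference-≥ (partsLargerThan ω ps) (≤-trans ω≤ (length≤ isP))

private
  count-zero : (stat : List ℕ → ℤ) → (∀ {n ps} → IsPartition n ps → ℤ.- + n ℤ.≤ stat ps) →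
               ∀ {r n} → r ℤ.< ℤ.- + n →
               + length (filter (λ ps → stat ps ℤ.≟ r) (partitions n)) ≡ 0ℤ
  count-zero stat stat-≥ {r} r<-n = cong (λ l → + length l) (filter-none (λ ps → stat ps ℤ.≟ r)
    (All.tabulate λ ps∈ eq → ℤₚ.<⇒≱ r<-n (subst (_ ℤ.≤_) eq (stat-≥ (partitions-sound ps∈)))))

N-zero : ∀ {r n} → r ℤ.< ℤ.- + n → N r n ≡ 0ℤ
N-zero = count-zero rank rank-≥

M-zero : ∀ {r n} → r ℤ.< ℤ.- + n → M r n ≡ 0ℤ
M-zero {r}             {0}               r<         = count-zero crank crank-≥ {r} {0} r<
M-zero { -[1+ 0 ]}     {1}               (ℤ.-<- ())
M-zero { -[1+ suc _ ]} {1}               _          = refl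
M-zero {r}             {n@(suc (suc _))} r<         = count-zero crank crank-≥ {r} {n} r<

private
  below-range : ∀ m n j → m ℤ.- + (j + suc (∣ m ∣ + n)) ℤ.< ℤ.- + n
  below-range m n j = ℤₚ.≤-<-trans
    (ℤₚ.+-monoˡ-≤ (ℤ.- + (j + suc (∣ m ∣ + n))) (m≤∣m∣ m))
    (subst (ℤ._< ℤ.- + n) (sym (ℤₚ.m-n≡m⊖n ∣ m ∣ (j + suc (∣ m ∣ + n))))
      (ℤₚ.<-≤-trans
        (ℤₚ.⊖-monoʳ->-< ∣ m ∣ (m≤n+m (suc (∣ m ∣ + n)) j))
        (ℤₚ.≤-reflexive (trans (cong (ℤ._⊖ (∣ m ∣ + n)) (sym (+-identityʳ ∣ m ∣)))
          (trans (ℤₚ.+-cancelˡ-⊖ ∣ m ∣ 0 n) (trans (sym (ℤₚ.m-n≡m⊖n 0 n)) (ℤₚ.+-identityˡ _)))))))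
    where
    m≤∣m∣ : ∀ m → m ℤ.≤ + ∣ m ∣
    m≤∣m∣ (+ _)     = ℤₚ.≤-refl
    m≤∣m∣ (-[1+ _ ]) = ℤ.-≤+

-- Extending the summation range further down does not change the sum.
cumulative-full : ∀ f n m → (∀ {r} → r ℤ.< ℤ.- + n → f r ≡ 0ℤ) →
                  ∀ j → sumDown f m (j + suc (∣ m ∣ + n)) ≡ cumulative f n m
cumulative-full f n m f-zero zero    = refl
cumulative-full f n m f-zero (suc j) = trans
  (cong₂ ℤ._+_ (cumulative-full f n m f-zero j) (f-zero (below-range m n j)))
  (ℤₚ.+-identityʳ _)

N≤-full : ∀ m n j → sumDown (λ r → N r n) m (j + suc (∣ m ∣ + n)) ≡ N≤ m n
N≤-full m n = cumulative-full (λ r → N r n) n m (λ {r} → N-zero {r} {n})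

M≤-full : ∀ m n j → sumDown (λ r → M r n) m (j + suc (∣ m ∣ + n)) ≡ M≤ m n
M≤-full m n = cumulative-full (λ r → M r n) n m (λ {r} → M-zero {r} {n})

{-# OPTIONS --safe #-}

-- Let A m and B c be the generating functions of the partitions with crank
-- greater than m (with the convention for n = 1) and with rank greater than
-- c - 2.  The two inequalities are B (m + 2) ≼ A m and A m ≼ B (m + 1),
-- coefficientwise.
--
-- Counting by the largest part gives B c as a sum of Gaussian binomials;
-- counting by the number of ones and summing by parts gives
--   A m = Σ q^((i + 1)(i + m + 1)) / ((q)_i (q)_{i + m + 1}).
-- Splitting each Gaussian binomial of B (m + 2) along its Durfee rectangle
-- makes A m - B (m + 2) a single sum over the side of the rectangle.  Its
-- terms are not positive, but after moving parts of them between adjacent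
-- sides each level becomes a power of q times a positive series: products of
-- Gaussian binomials are compared there by inserting or enlarging a part, and
-- the delicate case m = 0 is settled after multiplication by 1 - q².
--
-- Both q^(-m-1) A m + A (m + 1) and q^(-m-1) B (m + 1) + B (m + 4) are the
-- generating function of all partitions, so
--   B (m + 1) - A m = q^(m+1) (A (m + 1) - B (m + 4)),
-- and the second inequality follows from the first, as B is decreasing.
module Submission where

open import Defs
open import Data.Nat as ℕ using (ℕ; zero; suc; s≤s; z≤n)
open import Data.Integer as ℤ using (ℤ; +_; -[1+_]; 0ℤ; 1ℤ; -1ℤ; ∣_∣; +≤+; +<+)
open import Data.Product using (_×_; _,_)
import Data.Nat.Properties as ℕₚ
import Data.Nat.Solver as NatSolver
open import Data.Nat.ListAction using (sum)
import Data.Integer.Properties as ℤₚ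
open import Data.Integer.Solver using (module +-*-Solver)
open import Data.Bool using (Bool; true; false; _∧_)
open import Data.Bool.Properties using (∧-zeroʳ; ∧-identityʳ)
open import Data.List using (List; []; _∷_; _++_; map; concatMap; upTo; length; filter)
open import Data.List.Properties using (upTo-∷ʳ; concatMap-++; ++-identityʳ; concatMap-cong; filter-accept; filter-none; length-filter)
open import Data.List.Relation.Unary.All as All using (All; []; _∷_)
import Data.List.Relation.Unary.All.Properties as Allₚ
open import Data.Maybe using (Maybe; just; nothing)
open import Data.Sum using (inj₁; inj₂)
open import Algebra.Bundles using (CommutativeRing)
open import Algebra.Structures using (IsCommutativeRing)
import Algebra.Solver.Ring as RingSolver
open import Algebra.Solver.Ring.AlmostCommutativeRing using (fromCommutativeRing; _-Raw-AlmostCommutative⟶_)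
open import Algebra.Properties.AbelianGroup ℤₚ.+-0-abelianGroup using (∙-cancelˡ)
open import Function.Bundles using (mk⇔)
open import Level using (0ℓ)
open import Relation.Nullary using (yes; no; does)
open import Relation.Nullary.Decidable using (does-⇔; dec-true; dec-false)
open import Relation.Unary using (Decidable)
open import Relation.Binary.PropositionalEquality using (_≡_; refl; sym; trans; cong; cong₂; subst; subst₂; module ≡-Reasoning)

-- Both cumulative functions are the number of all partitions minus a count of larger values, which
-- is why the inequalities appear reversed for `A` and `B`. At n = 1 the coefficient of `A m`
-- follows the convention for M, not the crank of the single partition of 1, so one inequality
-- between series covers every n.
--
-- The Durfee rectangles in `B (m + 2)` are taken with sides i and i + m + 1, the shape that already
-- occurs in `A m`; this is what allows a subtraction side by side. What is left of a level depends
-- on m through the coefficients 1 - q^m and q (q - q^m) of two positive series. For m ≥ 2 one of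
-- them lends a common series to the other; for m = 1 the second disappears; for m = 0 the first
-- disappears and the second has coefficient q (q - 1), which the remaining terms must outweigh.
-- This is the obstacle behind the separate argument for m = 0.

module PowerSeries where

  -- Formal power series over the integers

  Series : Set
  Series = ℕ → ℤ

  infix 4 _≈_
  record _≈_ (f g : Series) : Set where
    constructor pointwise
    field coeff : ∀ n → f n ≡ g n
  open _≈_ public

  infixl 6 _+_ _-_
  infixl 7 _*_
  infix  8 -_

  opaque
    _+_ : Series → Series → Series
    (f + g) n = f n ℤ.+ g n

    -_ : Series → Series
    (- f) n = ℤ.- f n

    tail : Series → Series
    tail f n = f (suc n)

    -- The Cauchy product along f = f 0 + q `tail f`: the ring laws become inductions on the
    -- coefficient.
    _*_ : Series → Series → Series
    (f * g) zero    = f 0 ℤ.* g 0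
    (f * g) (suc n) = f 0 ℤ.* g (suc n) ℤ.+ (tail f * g) n

    constant : ℤ → Series
    constant c zero    = c
    constant c (suc _) = 0ℤ

  0# 1# : Series
  0# = constant 0ℤ
  1# = constant 1ℤ

  _-_ : Series → Series → Series
  f - g = f + - g

  ≈-refl : ∀ {f} → f ≈ f
  ≈-refl = pointwise λ _ → refl

  opaque
    unfolding constant

    constant-zero : ∀ c → constant c 0 ≡ c
    constant-zero c = refl

    constant-suc : ∀ c n → constant c (suc n) ≡ 0ℤ
    constant-suc c n = refl

  0#-coeff : ∀ n → 0# n ≡ 0ℤ
  0#-coeff zero    = constant-zero 0ℤ
  0#-coeff (suc n) = constant-suc 0ℤ n

  private
    opaque
      unfolding _+_ -_ _*_ constant tail

      *-cong′ : ∀ {f f′ g g′} → (∀ n → f n ≡ f′ n) → (∀ n → g n ≡ g′ n) → ∀ n → (f * g) n ≡ (f′ * g′) n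
      *-cong′ p r zero    = cong₂ ℤ._*_ (p 0) (r 0)
      *-cong′ p r (suc n) = cong₂ ℤ._+_ (cong₂ ℤ._*_ (p 0) (r (suc n))) (*-cong′ (λ k → p (suc k)) r n)

      zeroˡ′ : ∀ f g → (∀ n → f n ≡ 0ℤ) → ∀ n → (f * g) n ≡ 0ℤ
      zeroˡ′ f g f≡0 zero    = cong (ℤ._* g 0) (f≡0 0)
      zeroˡ′ f g f≡0 (suc n) =
        cong₂ ℤ._+_ (cong (ℤ._* g (suc n)) (f≡0 0)) (zeroˡ′ (tail f) g (λ k → f≡0 (suc k)) n)

      constant-*′ : ∀ c g n → (constant c * g) n ≡ c ℤ.* g n
      constant-*′ c g zero    = refl
      constant-*′ c g (suc n) =
        trans (cong (ℤ._+_ (c ℤ.* g (suc n))) (zeroˡ′ (tail (constant c)) g (λ _ → refl) n)) (ℤₚ.+-identityʳ _)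

      open +-*-Solver using (solve; _:=_; _:+_; _:*_)

      distribʳ′ : ∀ h f g n → ((f + g) * h) n ≡ (f * h) n ℤ.+ (g * h) n
      distribʳ′ h f g zero    = ℤₚ.*-distribʳ-+ (h 0) (f 0) (g 0)
      distribʳ′ h f g (suc n) = trans
        (cong (ℤ._+_ ((f 0 ℤ.+ g 0) ℤ.* h (suc n))) (distribʳ′ h (tail f) (tail g) n))
        (solve 5 (λ a b c d e → (a :+ b) :* c :+ (d :+ e) := (a :* c :+ d) :+ (b :* c :+ e)) refl
          (f 0) (g 0) (h (suc n)) ((tail f * h) n) ((tail g * h) n))

      *-sucʳ : ∀ f g n → (f * g) (suc n) ≡ (f * tail g) n ℤ.+ f (suc n) ℤ.* g 0
      *-sucʳ f g zero    = refl
      *-sucʳ f g (suc n) = trans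
        (cong (ℤ._+_ (f 0 ℤ.* g (suc (suc n)))) (*-sucʳ (tail f) g n))
        (sym (ℤₚ.+-assoc (f 0 ℤ.* g (suc (suc n))) ((tail f * tail g) n) (f (suc (suc n)) ℤ.* g 0)))

      *-comm′ : ∀ f g n → (f * g) n ≡ (g * f) n
      *-comm′ f g zero    = ℤₚ.*-comm (f 0) (g 0)
      *-comm′ f g (suc n) = begin
        f 0 ℤ.* g (suc n) ℤ.+ (tail f * g) n  ≡⟨ cong₂ ℤ._+_ (ℤₚ.*-comm (f 0) (g (suc n))) (*-comm′ (tail f) g n) ⟩
        g (suc n) ℤ.* f 0 ℤ.+ (g * tail f) n  ≡⟨ ℤₚ.+-comm (g (suc n) ℤ.* f 0) ((g * tail f) n) ⟩
        (g * tail f) n ℤ.+ g (suc n) ℤ.* f 0  ≡⟨ *-sucʳ g f n ⟨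
        (g * f) (suc n)                       ∎
        where open ≡-Reasoning

      scale : ℤ → Series → Series
      scale c f n = c ℤ.* f n

      scale-* : ∀ c f g n → (scale c f * g) n ≡ c ℤ.* (f * g) n
      scale-* c f g zero    = ℤₚ.*-assoc c (f 0) (g 0)
      scale-* c f g (suc n) = trans
        (cong (ℤ._+_ (c ℤ.* f 0 ℤ.* g (suc n))) (scale-* c (tail f) g n))
        (solve 4 (λ a b d e → a :* b :* d :+ a :* e := a :* (b :* d :+ e)) refl
          c (f 0) (g (suc n)) ((tail f * g) n))

      *-assoc′ : ∀ f g h n → ((f * g) * h) n ≡ (f * (g * h)) n
      *-assoc′ f g h zero    = ℤₚ.*-assoc (f 0) (g 0) (h 0)
      *-assoc′ f g h (suc n) = begin
        f 0 ℤ.* g 0 ℤ.* h (suc n) ℤ.+ (tail (f * g) * h) n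
          ≡⟨ cong (ℤ._+_ (f 0 ℤ.* g 0 ℤ.* h (suc n))) (trans
               (distribʳ′ h (scale (f 0) (tail g)) (tail f * g) n)
               (cong₂ ℤ._+_ (scale-* (f 0) (tail g) h n) (*-assoc′ (tail f) g h n))) ⟩
        f 0 ℤ.* g 0 ℤ.* h (suc n) ℤ.+ (f 0 ℤ.* (tail g * h) n ℤ.+ (tail f * (g * h)) n)
          ≡⟨ solve 5 (λ a b c d e → a :* b :* c :+ (a :* d :+ e) := a :* (b :* c :+ d) :+ e) refl
               (f 0) (g 0) (h (suc n)) ((tail g * h) n) ((tail f * (g * h)) n) ⟩
        f 0 ℤ.* (g * h) (suc n) ℤ.+ (tail f * (g * h)) n ∎
        where open ≡-Reasoning

      1#-*′ : ∀ f n → (1# * f) n ≡ f n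
      1#-*′ f n = trans (constant-*′ 1ℤ f n) (ℤₚ.*-identityˡ (f n))

      distribˡ′ : ∀ f g h n → (f * (g + h)) n ≡ (f * g) n ℤ.+ (f * h) n
      distribˡ′ f g h n = trans (*-comm′ f (g + h) n) (trans (distribʳ′ f g h n)
        (cong₂ ℤ._+_ (*-comm′ g f n) (*-comm′ h f n)))

      isCommutativeRing : IsCommutativeRing _≈_ _+_ _*_ -_ 0# 1#
      isCommutativeRing = record
        { isRing = record
          { +-isAbelianGroup = record
            { isGroup = record
              { isMonoid = record
                { isSemigroup = record
                  { isMagma = record
                    { isEquivalence = record
                      { refl  = ≈-refl
                      ; sym   = λ p → pointwise λ n → sym (coeff p n)
                      ; trans = λ p r → pointwise λ n → trans (coeff p n) (coeff r n)
                      }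
                    ; ∙-cong = λ p r → pointwise λ n → cong₂ ℤ._+_ (coeff p n) (coeff r n)
                    }
                  ; assoc = λ f g h → pointwise λ n → ℤₚ.+-assoc (f n) (g n) (h n)
                  }
                ; identity = (λ f → pointwise λ n → trans (cong (ℤ._+ f n) (0#-coeff n)) (ℤₚ.+-identityˡ (f n)))
                           , (λ f → pointwise λ n → trans (cong (ℤ._+_ (f n)) (0#-coeff n)) (ℤₚ.+-identityʳ (f n)))
                }
              ; inverse = (λ f → pointwise λ n → trans (ℤₚ.+-inverseˡ (f n)) (sym (0#-coeff n)))
                        , (λ f → pointwise λ n → trans (ℤₚ.+-inverseʳ (f n)) (sym (0#-coeff n)))
              ; ⁻¹-cong = λ p → pointwise λ n → cong ℤ.-_ (coeff p n)
              }
            ; comm = λ f g → pointwise λ n → ℤₚ.+-comm (f n) (g n)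
            }
          ; *-cong     = λ p r → pointwise (*-cong′ (coeff p) (coeff r))
          ; *-assoc    = λ f g h → pointwise (*-assoc′ f g h)
          ; *-identity = (λ f → pointwise (1#-*′ f))
                       , (λ f → pointwise λ n → trans (*-comm′ f 1# n) (1#-*′ f n))
          ; distrib    = (λ f g h → pointwise (distribˡ′ f g h)) , (λ h f g → pointwise (distribʳ′ h f g))
          }
        ; *-comm = λ f g → pointwise (*-comm′ f g)
        }

  seriesRing : CommutativeRing 0ℓ 0ℓ
  seriesRing = record { isCommutativeRing = isCommutativeRing }

  open CommutativeRing seriesRing public
    using (+-cong; *-cong; -‿cong; +-assoc; +-comm; *-assoc; *-comm; distribˡ; distribʳ;
           +-identityˡ; +-identityʳ; *-identityˡ; *-identityʳ; zeroˡ; zeroʳ; -‿inverseʳ)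
    renaming (sym to ≈-sym; trans to ≈-trans; reflexive to ≈-reflexive)

  private
    opaque
      unfolding _+_ -_ _*_ constant tail

      constant-+ : ∀ a b → constant (a ℤ.+ b) ≈ constant a + constant b
      constant-+ a b = pointwise λ { zero → refl ; (suc n) → refl }

      constant-* : ∀ a b → constant (a ℤ.* b) ≈ constant a * constant b
      constant-* a b = pointwise λ n → trans (split n) (sym (constant-*′ a (constant b) n))
        where
        split : ∀ n → constant (a ℤ.* b) n ≡ a ℤ.* constant b n
        split zero    = refl
        split (suc n) = sym (ℤₚ.*-zeroʳ a)

      constant-neg : ∀ a → constant (ℤ.- a) ≈ - constant a
      constant-neg a = pointwise λ { zero → refl ; (suc n) → refl }

    constants : ℤ.+-*-rawRing -Raw-AlmostCommutative⟶ fromCommutativeRing seriesRing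
    constants = record
      { ⟦_⟧    = constant
      ; +-homo = constant-+
      ; *-homo = constant-*
      ; -‿homo = constant-neg
      ; 0-homo = ≈-refl
      ; 1-homo = ≈-refl
      }

    coefficient≟ : ∀ a b → Maybe (constant a ≈ constant b)
    coefficient≟ a b with a ℤ.≟ b
    ... | yes refl = just ≈-refl
    ... | no _     = nothing

  module Solver = RingSolver ℤ.+-*-rawRing (fromCommutativeRing seriesRing) constants coefficient≟

  opaque
    q : Series
    q zero    = 0ℤ
    q (suc n) = 1# n

  infixr 8 q^_
  q^_ : ℕ → Series
  q^ zero  = 1#
  q^ suc k = q * q^ k

  opaque
    unfolding _+_ -_ _*_ constant tail q

    q*-zero : ∀ f → (q * f) 0 ≡ 0ℤ
    q*-zero f = refl

    q*-suc : ∀ f n → (q * f) (suc n) ≡ f n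
    q*-suc f n = trans (ℤₚ.+-identityˡ _) (1#-*′ f n)

    +-coeff : ∀ f g n → (f + g) n ≡ f n ℤ.+ g n
    +-coeff f g n = refl

    neg-coeff : ∀ f n → (- f) n ≡ ℤ.- f n
    neg-coeff f n = refl

  sub-coeff : ∀ f g n → (f - g) n ≡ f n ℤ.- g n
  sub-coeff f g n = trans (+-coeff f (- g) n) (cong (ℤ._+_ (f n)) (neg-coeff g n))

  q^-+ : ∀ k l → q^ (k ℕ.+ l) ≈ q^ k * q^ l
  q^-+ zero    l = ≈-sym (*-identityˡ (q^ l))
  q^-+ (suc k) l = ≈-trans (*-cong ≈-refl (q^-+ k l)) (≈-sym (*-assoc q (q^ k) (q^ l)))

  q^-cong : ∀ {k l} → k ≡ l → q^ k ≈ q^ l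
  q^-cong refl = ≈-refl

  q^*-below : ∀ k f {n} → n ℕ.< k → (q^ k * f) n ≡ 0ℤ
  q^*-below (suc k) f {zero}  _           = trans (coeff (*-assoc q (q^ k) f) 0) (q*-zero (q^ k * f))
  q^*-below (suc k) f {suc n} (ℕ.s≤s n<k) = trans (coeff (*-assoc q (q^ k) f) (suc n))
    (trans (q*-suc (q^ k * f) n) (q^*-below k f n<k))

  q^*-above : ∀ k f n → (q^ k * f) (k ℕ.+ n) ≡ f n
  q^*-above zero    f n = coeff (*-identityˡ f) n
  q^*-above (suc k) f n = trans (coeff (*-assoc q (q^ k) f) (suc (k ℕ.+ n)))
    (trans (q*-suc (q^ k * f) (k ℕ.+ n)) (q^*-above k f n))

  infix 4 _≈[_]_
  -- Congruence modulo `q^ N`. It replaces limits: infinite series are compared with finite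
  -- truncations one coefficient at a time.
  _≈[_]_ : Series → ℕ → Series → Set
  f ≈[ N ] g = ∀ {n} → n ℕ.< N → f n ≡ g n

  opaque
    unfolding _+_ -_ _*_ constant tail

    ≈[]-*ʳ : ∀ {f g N} h → f ≈[ N ] g → h * f ≈[ N ] h * g
    ≈[]-*ʳ h f≈g {zero}  0<N = cong (h 0 ℤ.*_) (f≈g 0<N)
    ≈[]-*ʳ h f≈g {suc n} n<N = cong₂ ℤ._+_ (cong (h 0 ℤ.*_) (f≈g n<N))
      (≈[]-*ʳ (tail h) (λ p → f≈g p) (ℕₚ.<-trans (ℕₚ.n<1+n n) n<N))

  ≈[]-* : ∀ {f f′ g g′ N} → f ≈[ N ] f′ → g ≈[ N ] g′ → f * g ≈[ N ] f′ * g′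
  ≈[]-* {f} {f′} {g} {g′} p r {n} n<N = trans (≈[]-*ʳ f r n<N)
    (trans (coeff (*-comm f g′) n) (trans (≈[]-*ʳ g′ p n<N) (coeff (*-comm g′ f′) n)))

  ≈[]-q^* : ∀ k {f g N} → f ≈[ N ] g → q^ k * f ≈[ k ℕ.+ N ] q^ k * g
  ≈[]-q^* zero    {f} {g} p {n} n<N = trans (coeff (*-identityˡ f) n) (trans (p n<N) (sym (coeff (*-identityˡ g) n)))
  ≈[]-q^* (suc k) {f} {g} p {zero}  _   = trans (coeff (*-assoc q (q^ k) f) 0) (trans (q*-zero _)
    (sym (trans (coeff (*-assoc q (q^ k) g) 0) (q*-zero _))))
  ≈[]-q^* (suc k) {f} {g} p {suc n} (ℕ.s≤s n<N) = trans (coeff (*-assoc q (q^ k) f) (suc n)) (trans (q*-suc _ n)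
    (trans (≈[]-q^* k p n<N) (sym (trans (coeff (*-assoc q (q^ k) g) (suc n)) (q*-suc _ n)))))

  -- Nonnegative series and infinite sums

  record Nonneg (f : Series) : Set where
    constructor nonneg
    field coeff≥0 : ∀ n → 0ℤ ℤ.≤ f n
  open Nonneg public

  nn-resp : ∀ {f g} → f ≈ g → Nonneg g → Nonneg f
  nn-resp f≈g g≥0 = nonneg λ n → subst (0ℤ ℤ.≤_) (sym (coeff f≈g n)) (coeff≥0 g≥0 n)

  opaque
    unfolding _+_ -_ _*_ constant tail q

    nn-0# : Nonneg 0#
    nn-0# = nonneg λ { zero → ℤₚ.≤-refl ; (suc _) → ℤₚ.≤-refl }

    nn-1# : Nonneg 1#
    nn-1# = nonneg λ { zero → +≤+ ℕ.z≤n ; (suc _) → ℤₚ.≤-refl }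

    nn-+ : ∀ {f g} → Nonneg f → Nonneg g → Nonneg (f + g)
    nn-+ p r = nonneg λ n → ℤₚ.+-mono-≤ (coeff≥0 p n) (coeff≥0 r n)

    ℤ-*-nonneg : ∀ {a b} → 0ℤ ℤ.≤ a → 0ℤ ℤ.≤ b → 0ℤ ℤ.≤ a ℤ.* b
    ℤ-*-nonneg {+ a} {+ b} _ _ = subst (0ℤ ℤ.≤_) (ℤₚ.pos-* a b) (+≤+ ℕ.z≤n)

    nn-* : ∀ {f g} → Nonneg f → Nonneg g → Nonneg (f * g)
    nn-* p r = nonneg (go (coeff≥0 p) (coeff≥0 r))
      where
      go : ∀ {f g} → (∀ n → 0ℤ ℤ.≤ f n) → (∀ n → 0ℤ ℤ.≤ g n) → ∀ n → 0ℤ ℤ.≤ (f * g) n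
      go p r zero    = ℤ-*-nonneg (p 0) (r 0)
      go p r (suc n) = ℤₚ.+-mono-≤ (ℤ-*-nonneg (p 0) (r (suc n))) (go (λ k → p (suc k)) r n)

    nn-q : Nonneg q
    nn-q = nonneg λ { zero → ℤₚ.≤-refl ; (suc n) → coeff≥0 nn-1# n }

  nn-q^ : ∀ k → Nonneg (q^ k)
  nn-q^ zero    = nn-1#
  nn-q^ (suc k) = nn-* nn-q (nn-q^ k)

  private
    divide : ∀ k f n → f n ≡ ((1# - q^ suc k) * f) n ℤ.+ (q^ suc k * f) n
    divide k f n = trans (coeff (Solver.solve 2 (λ x f → f Solver.:= (Solver.con 1ℤ Solver.:- x) Solver.:* f Solver.:+ x Solver.:* f)
      ≈-refl (q^ suc k) f) n) (+-coeff _ _ n)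

  -- Strong induction on the coefficient: f n = ((1 - q^(k+1)) f) n + f (n - k - 1).
  nn-divide : ∀ k {f} → Nonneg ((1# - q^ suc k) * f) → Nonneg f
  nn-divide k {f} p = nonneg λ n → go n n ℕₚ.≤-refl
    where
    go : ∀ bound n → n ℕ.≤ bound → 0ℤ ℤ.≤ f n
    step : ∀ bound n → n ℕ.≤ bound → 0ℤ ℤ.≤ (q^ suc k * f) n
    go bound n n≤b = subst (0ℤ ℤ.≤_) (sym (divide k f n)) (ℤₚ.+-mono-≤ (coeff≥0 p n) (step bound n n≤b))
    step bound n n≤b with suc k ℕ.≤? n
    ... | no  k≰n = ℤₚ.≤-reflexive (sym (q^*-below (suc k) f (ℕₚ.≰⇒> k≰n)))
    step (suc bound) n n≤b | yes k≤n with ℕₚ.m+[n∸m]≡n k≤n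
    ... | eq = subst (0ℤ ℤ.≤_) (trans (sym (q^*-above (suc k) f (n ℕ.∸ suc k))) (cong (q^ suc k * f) eq))
      (go bound (n ℕ.∸ suc k) (ℕₚ.≤-trans (ℕₚ.∸-monoˡ-≤ (suc k) n≤b) (ℕₚ.m∸n≤m bound k)))
    step zero zero n≤b | yes ()
    step zero (suc n) () | yes k≤n

  -- Antisymmetry: the multiples of f - g and g - f vanish, so `nn-divide` applies to both.
  cancel : ∀ k {f g} → (1# - q^ suc k) * f ≈ (1# - q^ suc k) * g → f ≈ g
  cancel k {f} {g} eq = pointwise λ n → ℤₚ.≤-antisym (le f g eq n) (le g f (≈-sym eq) n)
    where
    le : ∀ f g → (1# - q^ suc k) * f ≈ (1# - q^ suc k) * g → ∀ n → f n ℤ.≤ g n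
    le f g eq n = ℤₚ.0≤i-j⇒j≤i (subst (0ℤ ℤ.≤_) (sub-coeff g f n) (coeff≥0 (nn-divide k {g - f} (nn-resp (≈-trans
      (Solver.solve 3 (λ x f g → x Solver.:* (g Solver.:- f) Solver.:= x Solver.:* g Solver.:- x Solver.:* f) ≈-refl (1# - q^ suc k) f g)
      (≈-trans (+-cong ≈-refl (-‿cong eq)) (-‿inverseʳ _))) nn-0#)) n))

  opaque
    unfolding _+_ -_ _*_ constant tail q

    -- ∑ s is s 0 + q s 1 + q² s 2 + ⋯
    ∑ : (ℕ → Series) → Series
    ∑ s zero    = s 0 0
    ∑ s (suc n) = s 0 (suc n) ℤ.+ ∑ (λ i → s (suc i)) n

    ∑-unfold : ∀ s → ∑ s ≈ s 0 + q * ∑ (λ i → s (suc i))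
    ∑-unfold s = pointwise λ
      { zero    → sym (ℤₚ.+-identityʳ _)
      ; (suc n) → cong (ℤ._+_ (s 0 (suc n))) (sym (q*-suc _ n))
      }

    ∑-cong : ∀ {s t} → (∀ i → s i ≈ t i) → ∑ s ≈ ∑ t
    ∑-cong s≈t = pointwise (go s≈t)
      where
      go : ∀ {s t} → (∀ i → s i ≈ t i) → ∀ n → ∑ s n ≡ ∑ t n
      go p zero    = coeff (p 0) 0
      go p (suc n) = cong₂ ℤ._+_ (coeff (p 0) (suc n)) (go (λ i → p (suc i)) n)

    ∑-+ : ∀ s t → ∑ (λ i → s i + t i) ≈ ∑ s + ∑ t
    ∑-+ s t = pointwise (go s t)
      where
      go : ∀ s t n → ∑ (λ i → s i + t i) n ≡ ∑ s n ℤ.+ ∑ t n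
      go s t zero    = refl
      go s t (suc n) = trans (cong (ℤ._+_ (s 0 (suc n) ℤ.+ t 0 (suc n))) (go (λ i → s (suc i)) (λ i → t (suc i)) n))
        (+-*-Solver.solve 4 (λ a b c d → (a +-*-Solver.:+ b) +-*-Solver.:+ (c +-*-Solver.:+ d)
            +-*-Solver.:= (a +-*-Solver.:+ c) +-*-Solver.:+ (b +-*-Solver.:+ d)) refl
          (s 0 (suc n)) (t 0 (suc n)) _ _)

    ∑-* : ∀ c s → ∑ (λ i → c * s i) ≈ c * ∑ s
    ∑-* c s = pointwise λ n → go s n
      where
      rearrange : ∀ s → c * ∑ s ≈ c * s 0 + q * (c * ∑ (λ i → s (suc i)))
      rearrange s = ≈-trans (*-cong ≈-refl (∑-unfold s))
        (Solver.solve 4 (λ c x q y → c Solver.:* (x Solver.:+ q Solver.:* y) Solver.:= c Solver.:* x Solver.:+ q Solver.:* (c Solver.:* y))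
          ≈-refl c (s 0) q (∑ (λ i → s (suc i))))
      go : ∀ s n → ∑ (λ i → c * s i) n ≡ (c * ∑ s) n
      go s zero    = sym (trans (coeff (rearrange s) 0) (ℤₚ.+-identityʳ _))
      go s (suc n) = trans (cong (ℤ._+_ ((c * s 0) (suc n))) (go (λ i → s (suc i)) n))
        (sym (trans (coeff (rearrange s) (suc n)) (cong (ℤ._+_ ((c * s 0) (suc n))) (q*-suc _ n))))

    ∑-nn : ∀ {s} → (∀ i → Nonneg (s i)) → Nonneg (∑ s)
    ∑-nn s≥0 = nonneg (go s≥0)
      where
      go : ∀ {s} → (∀ i → Nonneg (s i)) → ∀ n → 0ℤ ℤ.≤ ∑ s n
      go p zero    = coeff≥0 (p 0) 0
      go p (suc n) = ℤₚ.+-mono-≤ (coeff≥0 (p 0) (suc n)) (go (λ i → p (suc i)) n)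

    -- No condition on the limit of f is necessary: the remainder after n terms is divisible by
    -- `q^ n`.
    ∑-telescope : ∀ (f s : ℕ → Series) → (∀ i → s i ≈ f i - q * f (suc i)) → ∑ s ≈ f 0
    ∑-telescope f s p = pointwise (go f s p)
      where
      go : ∀ (f s : ℕ → Series) → (∀ i → s i ≈ f i - q * f (suc i)) → ∀ n → ∑ s n ≡ f 0 n
      go f s p zero    = trans (coeff (p 0) 0) (ℤₚ.+-identityʳ _)
      go f s p (suc n) = trans
        (cong₂ ℤ._+_ (trans (coeff (p 0) (suc n)) (cong (λ z → f 0 (suc n) ℤ.+ ℤ.- z) (q*-suc (f 1) n)))
          (go (λ i → f (suc i)) (λ i → s (suc i)) (λ i → p (suc i)) n))
        (+-*-Solver.solve 2 (λ a b → (a +-*-Solver.:- b) +-*-Solver.:+ b +-*-Solver.:= a) refl (f 0 (suc n)) (f 1 n))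

-- Gaussian binomials and injections between boxed partitions

module GaussianBinomials where
  open PowerSeries
  open Solver using (solve; _:=_; _:+_; _:*_; _:-_; :-_; con)

  -- The q-binomial coefficient [k + l choose l], which counts the partitions
  -- into at most l parts, all of them at most k.
  G : ℕ → ℕ → Series
  G zero    l       = 1#
  G (suc k) zero    = 1#
  G (suc k) (suc l) = G k (suc l) + q^ suc k * G (suc k) l

  G-zeroʳ : ∀ k → G k 0 ≈ 1#
  G-zeroʳ zero    = ≈-refl
  G-zeroʳ (suc k) = ≈-refl

  nn-G : ∀ k l → Nonneg (G k l)
  nn-G zero    l       = nn-1#
  nn-G (suc k) zero    = nn-1#
  nn-G (suc k) (suc l) = nn-+ (nn-G k (suc l)) (nn-* (nn-q^ (suc k)) (nn-G (suc k) l))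

  -- The other Pascal rule: either there are exactly l + 1 parts and a column of that height is
  -- removed, or there are at most l.
  G-suc : ∀ k l → G (suc k) (suc l) ≈ q^ suc l * G k (suc l) + G (suc k) l
  G-suc zero zero =
    solve 1 (λ q → con 1ℤ :+ (q :* con 1ℤ) :* con 1ℤ := (q :* con 1ℤ) :* con 1ℤ :+ con 1ℤ) ≈-refl q
  G-suc zero (suc l) = ≈-trans (+-cong ≈-refl (*-cong ≈-refl (G-suc zero l)))
    (solve 3 (λ q x g → con 1ℤ :+ (q :* con 1ℤ) :* ((q :* x) :* con 1ℤ :+ g)
        := (q :* (q :* x)) :* con 1ℤ :+ (con 1ℤ :+ (q :* con 1ℤ) :* g))
      ≈-refl q (q^ l) (G 1 l))
  G-suc (suc k) zero = ≈-trans (+-cong (G-suc k zero) ≈-refl)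
    (≈-trans (+-cong (+-cong ≈-refl (G-zeroʳ (suc k))) ≈-refl)
    (solve 3 (λ q x g → (q :* con 1ℤ) :* g :+ con 1ℤ :+ (q :* (q :* x)) :* con 1ℤ
        := (q :* con 1ℤ) :* (g :+ (q :* x) :* con 1ℤ) :+ con 1ℤ)
      ≈-refl q (q^ k) (G k 1)))
  G-suc (suc k) (suc l) =
    ≈-trans (+-cong (G-suc k (suc l)) (*-cong ≈-refl (G-suc (suc k) l)))
    (solve 6 (λ q x y a b c →
        (q :* (q :* y)) :* a :+ b :+ (q :* (q :* x)) :* ((q :* y) :* b :+ c)
        := (q :* (q :* y)) :* (a :+ (q :* x) :* b) :+ (b :+ (q :* (q :* x)) :* c))
      ≈-refl q (q^ k) (q^ l) (G k (suc (suc l))) (G (suc k) (suc l)) (G (suc (suc k)) l))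

  -- The two Pascal rules for `G (suc k) (suc l)`, equated.
  G-ratio : ∀ k l → (1# - q^ suc l) * G k (suc l) ≈ (1# - q^ suc k) * G (suc k) l
  G-ratio k l = ≈-trans
    (solve 3 (λ a x g → (con 1ℤ :- x) :* g := (g :+ a) :- (x :* g :+ a)) ≈-refl (q^ suc k * G (suc k) l) (q^ suc l) (G k (suc l)))
    (≈-trans (+-cong ≈-refl (-‿cong (≈-trans
       (solve 3 (λ x g h → x :+ g :* h := (x :+ h) :+ (g :* h :- h)) ≈-refl (q^ suc l * G k (suc l)) (q^ suc k) (G (suc k) l))
       (+-cong (≈-sym (G-suc k l)) ≈-refl))))
    (solve 3 (λ a x g → a :- (a :+ (x :* g :- g)) := (con 1ℤ :- x) :* g) ≈-refl (G (suc k) (suc l)) (q^ suc k) (G (suc k) l)))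

  -- Conjugation of partitions, which exchanges the two Pascal rules.
  G-comm : ∀ k l → G k l ≈ G l k
  G-comm zero    l       = ≈-sym (G-zeroʳ l)
  G-comm (suc k) zero    = ≈-refl
  G-comm (suc k) (suc l) = ≈-trans (G-suc k l) (≈-trans
    (+-cong (*-cong ≈-refl (G-comm k (suc l))) (G-comm (suc k) l)) (+-comm _ _))

  infix 4 _≼_
  _≼_ : Series → Series → Set
  f ≼ g = Nonneg (g - f)

  ≼-trans : ∀ {f g h} → f ≼ g → g ≼ h → f ≼ h
  ≼-trans {f} {g} {h} p r = nn-resp (solve 3 (λ f g h → h :- f := (g :- f) :+ (h :- g)) ≈-refl f g h) (nn-+ p r)

  ≼-reflexive : ∀ {f g} → f ≈ g → f ≼ g
  ≼-reflexive {f} {g} p = nn-resp (≈-trans (+-cong ≈-refl (-‿cong p)) (-‿inverseʳ g)) nn-0#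

  ≼-refl : ∀ {f} → f ≼ f
  ≼-refl = ≼-reflexive ≈-refl

  ≼-resp : ∀ {f f′ g g′} → f ≈ f′ → g ≈ g′ → f′ ≼ g′ → f ≼ g
  ≼-resp p r = nn-resp (+-cong r (-‿cong p))

  ≼-+ : ∀ {f f′ g g′} → f ≼ f′ → g ≼ g′ → f + g ≼ f′ + g′
  ≼-+ {f} {f′} {g} {g′} p r =
    nn-resp (solve 4 (λ a b c d → (b :+ d) :- (a :+ c) := (b :- a) :+ (d :- c)) ≈-refl f f′ g g′) (nn-+ p r)

  ≼-*ˡ : ∀ {h f g} → Nonneg h → f ≼ g → h * f ≼ h * g
  ≼-*ˡ {h} {f} {g} h≥0 p = nn-resp (solve 3 (λ h f g → h :* g :- h :* f := h :* (g :- f)) ≈-refl h f g) (nn-* h≥0 p)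

  ≼-* : ∀ {f f′ g g′} → Nonneg f′ → Nonneg g → f ≼ f′ → g ≼ g′ → f * g ≼ f′ * g′
  ≼-* {f} {f′} {g} {g′} f′≥0 g≥0 p r =
    nn-resp (solve 4 (λ a b c d → b :* d :- a :* c := c :* (b :- a) :+ b :* (d :- c)) ≈-refl f f′ g g′)
      (nn-+ (nn-* g≥0 p) (nn-* f′≥0 r))

  ∑-neg : ∀ s → ∑ (λ i → - s i) ≈ - ∑ s
  ∑-neg s = ≈-trans (∑-cong λ i → solve 1 (λ f → :- f := con -1ℤ :* f) ≈-refl (s i))
    (≈-trans (∑-* (constant -1ℤ) s) (solve 1 (λ f → con -1ℤ :* f := :- f) ≈-refl (∑ s)))

  ∑-sub : ∀ s t → ∑ (λ i → s i - t i) ≈ ∑ s - ∑ t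
  ∑-sub s t = ≈-trans (∑-+ s (λ i → - t i)) (+-cong ≈-refl (∑-neg t))

  ≼-∑ : ∀ {s t} → (∀ i → s i ≼ t i) → ∑ s ≼ ∑ t
  ≼-∑ {s} {t} p = nn-resp (≈-sym (∑-sub t s)) (∑-nn p)

  -- Inserting a part of size p.
  G-insert : ∀ p k l → p ℕ.≤ k → q^ p * G k l ≼ G k (suc l)
  G-insert p zero l ℕ.z≤n = ≼-reflexive (*-identityˡ 1#)
  G-insert p (suc k) l p≤1+k with ℕₚ.m≤n⇒m<n∨m≡n p≤1+k
  ... | inj₂ refl = nn-resp
    (solve 2 (λ a b → a :+ b :- b := a) ≈-refl (G k (suc l)) (q^ suc k * G (suc k) l)) (nn-G k (suc l))
  G-insert p (suc k) zero p≤1+k | inj₁ (ℕ.s≤s p≤k) = ≼-trans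
    (≼-resp (*-cong ≈-refl (≈-sym (G-zeroʳ k))) ≈-refl (G-insert p k zero p≤k))
    (nn-resp (solve 2 (λ a b → a :+ b :- a := b) ≈-refl (G k 1) (q^ suc k * 1#)) (nn-* (nn-q^ (suc k)) nn-1#))
  G-insert p (suc k) (suc l) p≤1+k | inj₁ (ℕ.s≤s p≤k) = ≼-resp
    (solve 4 (λ p a x b → p :* (a :+ x :* b) := p :* a :+ x :* (p :* b)) ≈-refl (q^ p) (G k (suc l)) (q^ suc k) (G (suc k) l))
    ≈-refl
    (≼-+ (G-insert p k (suc l) p≤k) (≼-*ˡ (nn-q^ (suc k)) (G-insert p (suc k) l p≤1+k)))

  G-monoʳ : ∀ k l → G k l ≼ G k (suc l)
  G-monoʳ k l = ≼-resp (≈-sym (*-identityˡ (G k l))) ≈-refl (G-insert 0 k l ℕ.z≤n)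

  G-monoˡ : ∀ k l → G k l ≼ G (suc k) l
  G-monoˡ k l = ≼-resp (G-comm k l) (G-comm (suc k) l) (G-monoʳ l k)

  -- Increasing the largest of l + 1 parts.
  G-raise : ∀ k l → q * G k (suc l) ≼ G (suc k) (suc l)
  G-raise zero    l = nn-resp (solve 2 (λ q g → con 1ℤ :+ (q :* con 1ℤ) :* g :- q :* con 1ℤ := con 1ℤ :+ q :* (g :- con 1ℤ)) ≈-refl q (G 1 l))
    (nn-+ nn-1# (nn-* nn-q (G-monoˡ 0 l)))
  G-raise (suc k) zero = ≼-resp
    (solve 3 (λ q g x → q :* (g :+ (q :* x) :* con 1ℤ) := q :* g :+ (q :* (q :* x)) :* con 1ℤ) ≈-refl q (G k 1) (q^ k))
    ≈-refl (≼-+ (G-raise k zero) ≼-refl)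
  G-raise (suc k) (suc l) = ≼-resp
    (solve 4 (λ q a x b → q :* (a :+ (q :* x) :* b) := q :* a :+ (q :* (q :* x)) :* b) ≈-refl q (G k (suc (suc l))) (q^ k) (G (suc k) (suc l)))
    ≈-refl (≼-+ (G-raise k (suc l)) (≼-*ˡ (nn-q^ (suc (suc k))) (G-monoˡ (suc k) (suc l))))

  -- The same map with a smaller target: a largest part that grows to k + 1 is the only one of this
  -- size, and the other l parts are at most k.
  G-raise′ : ∀ k l → q * G k (suc l) ≼ G k (suc l) + q^ suc k * G k l
  G-raise′ zero l = nn-resp (solve 1 (λ q → con 1ℤ :+ (q :* con 1ℤ) :* con 1ℤ :- q :* con 1ℤ := con 1ℤ) ≈-refl q) nn-1#
  G-raise′ (suc k) l = ≼-resp
    (solve 4 (λ q a x b → q :* (a :+ (q :* x) :* b) := q :* a :+ (q :* (q :* x)) :* b) ≈-refl q (G k (suc l)) (q^ k) (G (suc k) l))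
    ≈-refl (≼-+ (G-raise k l) ≼-refl)

  -- Adding a column of height l to partitions with l + 1 parts.
  G-column : ∀ k l → q^ l * G k (suc l) ≼ G (suc k) (suc l)
  G-column k zero = ≼-resp (*-identityˡ _) ≈-refl (G-monoˡ k 1)
  G-column zero (suc l) = ≼-trans
    (≼-resp (solve 2 (λ q x → (q :* x) :* con 1ℤ := (q :* con 1ℤ) :* (x :* con 1ℤ)) ≈-refl q (q^ l)) ≈-refl
      (≼-*ˡ (nn-* nn-q nn-1#) (G-column zero l)))
    (nn-resp (solve 2 (λ q g → con 1ℤ :+ q :* g :- q :* g := con 1ℤ) ≈-refl (q * 1#) (G 1 (suc l))) nn-1#)
  G-column (suc k) (suc l) = ≼-resp
    (solve 5 (λ q y a x b → (q :* y) :* (a :+ (q :* x) :* b) := (q :* y) :* a :+ (q :* (q :* x)) :* (y :* b)) ≈-refl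
      q (q^ l) (G k (suc (suc l))) (q^ k) (G (suc k) (suc l)))
    ≈-refl (≼-+ (G-column k (suc l)) (≼-*ˡ (nn-q^ (suc (suc k))) (G-column (suc k) l)))

  -- Decreasing the smallest of l + 1 parts, or deleting it when it is zero.
  G-lower : ∀ k l → G k (suc l) ≼ q * G k (suc l) + G k l
  G-lower zero    l = nn-resp (solve 1 (λ q → q :* con 1ℤ :+ con 1ℤ :- con 1ℤ := q) ≈-refl q) nn-q
  G-lower (suc k) l = nn-resp (≈-trans
      (+-cong ≈-refl (-‿cong (G-suc k l)))
      (solve 5 (λ q y a b g → q :* g :+ b :- ((q :* y) :* a :+ b) := q :* (g :- y :* a)) ≈-refl
        q (q^ l) (G k (suc l)) (G (suc k) l) (G (suc k) (suc l))))
    (nn-* nn-q (G-column k l))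

-- Sums of products of Gaussian binomials, and the levels expressed by them

module LevelTerms where
  open PowerSeries
  open GaussianBinomials
  open Solver using (solve; _:=_; _:+_; _:*_; _:-_; con)

  -- ∑[ p ] s is the sum of q ^ ((p + 1) l) s l over l.
  ∑[_] : ℕ → (ℕ → Series) → Series
  ∑[ zero  ] s = ∑ s
  ∑[ suc p ] s = ∑[ p ] (λ l → q^ l * s l)

  ∑[]-cong : ∀ p {s t} → (∀ l → s l ≈ t l) → ∑[ p ] s ≈ ∑[ p ] t
  ∑[]-cong zero    s≈t = ∑-cong s≈t
  ∑[]-cong (suc p) s≈t = ∑[]-cong p λ l → *-cong ≈-refl (s≈t l)

  ∑[]-nn : ∀ p {s} → (∀ l → Nonneg (s l)) → Nonneg (∑[ p ] s)
  ∑[]-nn zero    s≥0 = ∑-nn s≥0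
  ∑[]-nn (suc p) s≥0 = ∑[]-nn p λ l → nn-* (nn-q^ l) (s≥0 l)

  ∑[]-+ : ∀ p s t → ∑[ p ] (λ l → s l + t l) ≈ ∑[ p ] s + ∑[ p ] t
  ∑[]-+ zero    s t = ∑-+ s t
  ∑[]-+ (suc p) s t = ≈-trans (∑[]-cong p λ l → distribˡ (q^ l) (s l) (t l)) (∑[]-+ p _ _)

  ∑[]-* : ∀ p c s → ∑[ p ] (λ l → c * s l) ≈ c * ∑[ p ] s
  ∑[]-* zero    c s = ∑-* c s
  ∑[]-* (suc p) c s = ≈-trans
    (∑[]-cong p λ l → solve 3 (λ x c s → x :* (c :* s) := c :* (x :* s)) ≈-refl (q^ l) c (s l)) (∑[]-* p c _)

  ∑[]-linear : ∀ p c d s t → ∑[ p ] (λ l → c * s l + d * t l) ≈ c * ∑[ p ] s + d * ∑[ p ] t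
  ∑[]-linear p c d s t = ≈-trans (∑[]-+ p _ _) (+-cong (∑[]-* p c s) (∑[]-* p d t))

  ∑[]-unfold : ∀ p s → ∑[ p ] s ≈ s 0 + q^ suc p * ∑[ p ] (λ l → s (suc l))
  ∑[]-unfold zero    s = ≈-trans (∑-unfold s) (+-cong ≈-refl (*-cong (≈-sym (*-identityʳ q)) ≈-refl))
  ∑[]-unfold (suc p) s = ≈-trans (∑[]-unfold p _) (≈-trans
    (+-cong (*-identityˡ (s 0)) (*-cong ≈-refl (≈-trans (∑[]-cong p λ l → *-assoc q (q^ l) (s (suc l))) (∑[]-* p q _))))
    (+-cong ≈-refl (solve 3 (λ x q y → x :* (q :* y) := (q :* x) :* y) ≈-refl (q^ suc p) q _)))

  ∑[]-sub : ∀ p s t → ∑[ p ] (λ l → s l - t l) ≈ ∑[ p ] s - ∑[ p ] t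
  ∑[]-sub p s t = ≈-trans
    (∑[]-cong p λ l → solve 2 (λ s t → s :- t := con 1ℤ :* s :+ con -1ℤ :* t) ≈-refl (s l) (t l))
    (≈-trans (∑[]-linear p 1# (constant -1ℤ) s t)
      (solve 2 (λ s t → con 1ℤ :* s :+ con -1ℤ :* t := s :- t) ≈-refl (∑[ p ] s) (∑[ p ] t)))

  ≼-∑[] : ∀ p {s t} → (∀ l → s l ≼ t l) → ∑[ p ] s ≼ ∑[ p ] t
  ≼-∑[] p {s} {t} s≼t = nn-resp (≈-sym (∑[]-sub p t s)) (∑[]-nn p s≼t)

  -- For injections that raise the summation index by one: `q^ suc p` is the weight of that step.
  ∑[]-shift : ∀ p {s t} → Nonneg (t 0) → (∀ l → q^ suc p * s l ≼ q^ suc p * t (suc l)) → q^ suc p * ∑[ p ] s ≼ ∑[ p ] t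
  ∑[]-shift p {s} {t} t₀≥0 s≼t = ≼-resp ≈-refl (∑[]-unfold p t)
    (nn-resp (solve 3 (λ t x s → t :+ x :- s := t :+ (x :- s)) ≈-refl (t 0) (q^ suc p * ∑[ p ] (λ l → t (suc l))) (q^ suc p * ∑[ p ] s))
      (nn-+ t₀≥0 (≼-resp (≈-sym (∑[]-* p _ s)) (≈-sym (∑[]-* p _ _)) (≼-∑[] p s≼t))))

  G-step : ∀ a l → G a l ≈ (1# - q^ suc a) * G (suc a) l + q^ suc a * (q^ l * G a l)
  G-step a zero = ≈-trans (G-zeroʳ a) (≈-trans
    (solve 1 (λ x → con 1ℤ := (con 1ℤ :- x) :* con 1ℤ :+ x :* (con 1ℤ :* con 1ℤ)) ≈-refl (q^ suc a))
    (+-cong ≈-refl (*-cong ≈-refl (*-cong ≈-refl (≈-sym (G-zeroʳ a))))))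
  G-step a (suc l) = ≈-trans
    (solve 4 (λ x y g h → g := (g :+ x :* h) :- x :* (y :* g :+ h) :+ x :* (y :* g)) ≈-refl
      (q^ suc a) (q^ suc l) (G a (suc l)) (G (suc a) l))
    (≈-trans (+-cong (+-cong ≈-refl (-‿cong (*-cong ≈-refl (≈-sym (G-suc a l))))) ≈-refl)
      (+-cong (solve 2 (λ x g → g :- x :* g := (con 1ℤ :- x) :* g) ≈-refl (q^ suc a) (G (suc a) (suc l))) ≈-refl))

  ∑-G-step : ∀ p (s : ℕ → Series) a → ∑[ p ] (λ l → s l * G a l)
    ≈ (1# - q^ suc a) * ∑[ p ] (λ l → s l * G (suc a) l) + q^ suc a * ∑[ suc p ] (λ l → s l * G a l)
  ∑-G-step p s a = ≈-trans
    (∑[]-cong p λ l → ≈-trans (*-cong ≈-refl (G-step a l))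
      (solve 5 (λ s x g y h → s :* ((con 1ℤ :- x) :* g :+ x :* (y :* h)) := (con 1ℤ :- x) :* (s :* g) :+ x :* (y :* (s :* h)))
        ≈-refl (s l) (q^ suc a) (G (suc a) l) (q^ l) (G a l)))
    (∑[]-linear p _ _ _ _)

  -- All levels reduce to four sums over pairs of boxed partitions. `W` and `U` have weight q^(2 l);
  -- in `H` and `K` the additional q^l is a full column split off by `G-suc`.
  W : ℕ → ℕ → Series
  W a b = ∑[ 1 ] (λ l → G b (suc l) * G a l)

  U H K : ℕ → ℕ → Series
  U a b = ∑[ 1 ] (λ l → G b l * G (suc a) l)
  H a b = ∑[ 2 ] (λ l → G b l * G a l)
  K a b = ∑[ 2 ] (λ l → G b (suc l) * G a l)

  H-comm : ∀ a b → H a b ≈ H b a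
  H-comm a b = ∑[]-cong 2 λ l → *-comm (G b l) (G a l)

  -- `G-suc` on the second factor: a full column turns the weight into that of `H`; without it the
  -- index moves by one, which costs q².
  U-split : ∀ a b → U a b ≈ H a b + q^ 2 * W (suc a) b
  U-split a b = ≈-trans (∑[]-cong 1 split) (≈-trans (∑[]-+ 1 _ _)
    (+-cong ≈-refl (≈-trans (∑[]-unfold 1 rest) (+-identityˡ _))))
    where
    rest : ℕ → Series
    rest zero    = 0#
    rest (suc l) = G b (suc l) * G (suc a) l
    split : ∀ l → G b l * G (suc a) l ≈ q^ l * (G b l * G a l) + rest l
    split zero    = ≈-trans (*-cong ≈-refl (≈-sym (G-zeroʳ a)))
      (solve 2 (λ x y → x :* y := con 1ℤ :* (x :* y) :+ con 0ℤ) ≈-refl (G b 0) (G a 0))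
    split (suc l) = ≈-trans (*-cong ≈-refl (G-suc a l))
      (solve 4 (λ s x g h → s :* (x :* g :+ h) := x :* (s :* g) :+ s :* h) ≈-refl
        (G b (suc l)) (q^ suc l) (G a (suc l)) (G (suc a) l))

  W-pred : ∀ a b → W a b ≈ ∑[ 1 ] (λ l → G (suc b) (suc l) * G a l) - q^ suc b * ∑[ 1 ] (λ l → G (suc b) l * G a l)
  W-pred a b = ≈-trans
    (∑[]-cong 1 λ l → solve 4 (λ g x h k → g :* k := (g :+ x :* h) :* k :- x :* (h :* k)) ≈-refl
      (G b (suc l)) (q^ suc b) (G (suc b) l) (G a l))
    (≈-trans (∑[]-sub 1 _ _) (+-cong ≈-refl (-‿cong (∑[]-* 1 _ _))))

  -- Both indices are raised so that all terms of a level can be compared at the same indices; the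
  -- price consists of sums of the heavier weight, `K` and `H`.
  W-descend : ∀ a b → W a b ≈ (1# - q^ suc a) * (1# - q^ suc (suc (suc b))) * W (suc a) (suc b)
    + q^ suc a * K a (suc b) - q^ suc b * H a (suc b)
  W-descend a b = ≈-trans (W-pred a b) (≈-trans
    (+-cong (∑-G-step 1 _ a) (-‿cong (*-cong ≈-refl (≈-trans (∑-G-step 1 _ a) (+-cong (*-cong ≈-refl (U-split a (suc b))) ≈-refl)))))
    (solve 6 (λ q x y w k h →
        (con 1ℤ :- x) :* w :+ x :* k :- y :* ((con 1ℤ :- x) :* (h :+ (q :* (q :* con 1ℤ)) :* w) :+ x :* h)
        := (con 1ℤ :- x) :* (con 1ℤ :- q :* (q :* y)) :* w :+ x :* k :- y :* h) ≈-refl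
      q (q^ suc a) (q^ suc b) (W (suc a) (suc b)) (K a (suc b)) (H a (suc b))))

  W-descendʳ : ∀ a b → W (suc b) a ≈ (1# - q^ suc (suc (suc a))) * W (suc b) (suc a) - q^ suc a * H (suc a) b
  W-descendʳ a b = ≈-trans (W-pred (suc b) a) (≈-trans
    (+-cong ≈-refl (-‿cong (*-cong ≈-refl (≈-trans (U-split b (suc a)) (+-cong (H-comm b (suc a)) ≈-refl)))))
    (solve 4 (λ q x w h → w :- x :* (h :+ (q :* (q :* con 1ℤ)) :* w) := (con 1ℤ :- q :* (q :* x)) :* w :- x :* h) ≈-refl
      q (q^ suc a) (W (suc b) (suc a)) (H (suc a) b)))

  -- Termwise, with `G-ratio` used twice: the factor 1 - q^(l+1) passes from one Gaussian binomial
  -- to the other.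
  W-swap : ∀ a b → (1# - q^ suc b) * W (suc b) a ≈ (1# - q^ suc a) * W (suc a) b
  W-swap a b = ≈-trans (≈-sym (∑[]-* 1 _ _)) (≈-trans (∑[]-cong 1 term) (∑[]-* 1 _ _))
    where
    term : ∀ l → (1# - q^ suc b) * (G a (suc l) * G (suc b) l) ≈ (1# - q^ suc a) * (G b (suc l) * G (suc a) l)
    term l = ≈-trans (solve 3 (λ y g h → y :* (g :* h) := g :* (y :* h)) ≈-refl _ (G a (suc l)) (G (suc b) l))
      (≈-trans (*-cong ≈-refl (≈-sym (G-ratio b l)))
      (≈-trans (solve 3 (λ g y h → g :* (y :* h) := h :* (y :* g)) ≈-refl (G a (suc l)) (1# - q^ suc l) (G b (suc l)))
      (≈-trans (*-cong ≈-refl (G-ratio a l))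
      (solve 3 (λ g y h → g :* (y :* h) := y :* (g :* h)) ≈-refl (G b (suc l)) (1# - q^ suc a) (G (suc a) l)))))

  -- For b = a + m, this is the level of the Durfee rectangles with a + 1 rows in A m - B (m + 2), up to a power of q.
  level : ℕ → ℕ → Series
  level a b = q^ suc (suc (suc a)) * (1# - q^ suc (suc (suc (suc b)))) * W (suc (suc a)) (suc b) + W (suc a) b - W (suc (suc b)) a

  -- The level with q^(a+1) divided out, for b = a + m. Only the coefficients involving q^m can
  -- produce negative terms.
  reduced : ℕ → ℕ → ℕ → Series
  reduced a b m = q * K (suc a) (suc b) + (1# - q^ m) * U (suc a) (suc b)
    + q * (q - q^ m) * W (suc (suc b)) (suc a) + q^ suc (suc (suc (suc b))) * (1# - q^ 2) * W (suc (suc a)) (suc b)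

  -- After both descents everything has the factor q^(a+1) except (1 - q^(a+2)) `W (a+2) (b+1)` - (1
  -- - q^(b+2)) `W (b+2) (a+1)`, and this is zero by `W-swap`.
  level-reduced : ∀ a m → level a (a ℕ.+ m) ≈ q^ suc a * reduced a (a ℕ.+ m) m
  level-reduced a m = ≈-trans
    (+-cong (+-cong ≈-refl (W-descend (suc a) b)) (-‿cong (W-descendʳ a (suc b))))
    (≈-trans (+-cong (+-cong (*-cong (*-cong ≈-refl (+-cong ≈-refl (-‿cong (*-cong ≈-refl (*-cong ≈-refl (*-cong ≈-refl qb)))))) ≈-refl)
        (+-cong (+-cong (*-cong (*-cong ≈-refl (+-cong ≈-refl (-‿cong (*-cong ≈-refl (*-cong ≈-refl qb))))) ≈-refl) ≈-refl) (-‿cong (*-cong qb ≈-refl)))) ≈-refl)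
    (≈-trans (solve 7 (λ q x m w e k h →
        (q :* (q :* x)) :* (con 1ℤ :- q :* (q :* (q :* (x :* m)))) :* w
          :+ ((con 1ℤ :- q :* x) :* (con 1ℤ :- q :* (q :* (x :* m))) :* w :+ (q :* x) :* k :- (x :* m) :* h)
          :- ((con 1ℤ :- q :* (q :* x)) :* e :- x :* h)
        := x :* (q :* k :+ (con 1ℤ :- m) :* (h :+ (q :* (q :* con 1ℤ)) :* w) :+ q :* (q :- m) :* e
             :+ (q :* (q :* (q :* (x :* m)))) :* (con 1ℤ :- q :* (q :* con 1ℤ)) :* w)
           :+ ((con 1ℤ :- q :* x) :* w :- (con 1ℤ :- q :* (x :* m)) :* e))
      ≈-refl q (q^ suc a) (q^ m) (W (suc (suc a)) (suc b)) (W (suc (suc b)) (suc a)) (K (suc a) (suc b)) (H (suc a) (suc b)))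
    (≈-trans (+-cong ≈-refl (≈-trans (+-cong ≈-refl (-‿cong (≈-trans
        (*-cong (+-cong ≈-refl (-‿cong (*-cong ≈-refl (≈-sym qb)))) ≈-refl) (W-swap (suc a) (suc b))))) (-‿inverseʳ _)))
    (≈-trans (+-identityʳ _)
    (*-cong ≈-refl (+-cong (+-cong (+-cong ≈-refl (*-cong ≈-refl (≈-sym (U-split (suc a) (suc b))))) ≈-refl)
      (*-cong (*-cong (*-cong ≈-refl (*-cong ≈-refl (*-cong ≈-refl (≈-sym qb)))) ≈-refl) ≈-refl)))))))
    where
    b : ℕ
    b = a ℕ.+ m
    qb : q^ suc b ≈ q^ suc a * q^ m
    qb = q^-+ (suc a) m

-- Positivity of the levels

module Positivity where
  open PowerSeries
  open GaussianBinomials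
  open LevelTerms
  open Solver using (solve; _:=_; _:+_; _:*_; _:-_; con)

  nn-H : ∀ a b → Nonneg (H a b)
  nn-H a b = ∑[]-nn 2 λ l → nn-* (nn-G b l) (nn-G a l)

  nn-K : ∀ a b → Nonneg (K a b)
  nn-K a b = ∑[]-nn 2 λ l → nn-* (nn-G b (suc l)) (nn-G a l)

  U≼W : ∀ a b → U a b ≼ W (suc a) b
  U≼W a b = ≼-∑[] 1 λ l → ≼-* (nn-G b (suc l)) (nn-G (suc a) l) (G-monoʳ b l) ≼-refl

  H≼K : ∀ a b → H a b ≼ K a b
  H≼K a b = ≼-∑[] 2 λ l → ≼-* (nn-G b (suc l)) (nn-G a l) (G-monoʳ b l) ≼-refl

  -- The q² is that of `U-split`: the product equals (`W` - `U`) + `H`.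
  nn-[1-q²]W : ∀ a b → Nonneg ((1# - q^ 2) * W (suc a) b)
  nn-[1-q²]W a b = nn-resp (≈-trans
      (solve 3 (λ x w h → (con 1ℤ :- x) :* w := (w :- (h :+ x :* w)) :+ h) ≈-refl (q^ 2) (W (suc a) b) (H a b))
      (+-cong (+-cong ≈-refl (-‿cong (≈-sym (U-split a b)))) ≈-refl))
    (nn-+ (U≼W a b) (nn-H a b))

  -- By `G-suc` the bracket is the sum of q^(2 l) `G b l * G (suc a) (suc l)`. Then q² pays for
  -- raising the index, and q^p is a part inserted into the first factor.
  U-insert : ∀ p a b → p ℕ.≤ b → q^ suc (suc p) * (U a b + q * K b a) ≼ U a b
  U-insert p a b p≤b = ≼-resp
    (≈-trans (solve 4 (λ q x u k → (q :* (q :* x)) :* (u :+ q :* k) := (q :* (q :* con 1ℤ)) :* (x :* (q :* k :+ u))) ≈-refl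
        q (q^ p) (U a b) (K b a))
      (*-cong ≈-refl (≈-sym (≈-trans (∑[]-* 1 (q^ p) _) (*-cong ≈-refl expand)))))
    ≈-refl
    (∑[]-shift 1 {λ l → q^ p * (G b l * G (suc a) (suc l))} (nn-* (nn-G b 0) (nn-G (suc a) 0)) λ l → ≼-*ˡ (nn-q^ 2)
      (≼-resp (≈-sym (*-assoc (q^ p) _ _)) ≈-refl
        (≼-* (nn-G b (suc l)) (nn-G (suc a) (suc l)) (G-insert p b l p≤b) ≼-refl)))
    where
    expand : ∑[ 1 ] (λ l → G b l * G (suc a) (suc l)) ≈ q * K b a + U a b
    expand = ≈-trans (∑[]-cong 1 λ l → ≈-trans (*-cong ≈-refl (G-suc a l))
        (solve 5 (λ q y s g h → s :* ((q :* y) :* g :+ h) := q :* (y :* (g :* s)) :+ con 1ℤ :* (s :* h)) ≈-refl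
          q (q^ l) (G b l) (G a (suc l)) (G (suc a) l)))
      (≈-trans (∑[]-linear 1 q 1# _ _) (+-cong ≈-refl (*-identityˡ _)))

  -- `K` collects the pairs with a full column in the second factor. In the rest of `W` this factor
  -- has one part fewer, which leaves room for a part p.
  W-insert : ∀ p a b → p ℕ.≤ suc b → q^ p * W (suc b) a ≼ W (suc b) a + q^ p * K b a
  W-insert p a b p≤1+b = nn-resp
    (≈-trans (+-cong ≈-refl (-‿cong (*-cong ≈-refl split)))
      (solve 4 (λ w x k r → w :+ x :* k :- x :* (k :+ r) := w :- x :* r) ≈-refl (W (suc b) a) (q^ p) (K b a) (∑[ 1 ] rest)))
    (≼-resp (≈-sym (∑[]-* 1 (q^ p) rest)) ≈-refl (≼-∑[] 1 term))
    where
    rest : ℕ → Series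
    rest zero    = 0#
    rest (suc l) = G a (suc (suc l)) * G (suc b) l
    split : W (suc b) a ≈ K b a + ∑[ 1 ] rest
    split = ≈-trans (∑[]-cong 1 λ
        { zero    → ≈-trans (*-cong ≈-refl (≈-sym (G-zeroʳ b)))
            (solve 2 (λ x y → x :* y := con 1ℤ :* (x :* y) :+ con 0ℤ) ≈-refl (G a 1) (G b 0))
        ; (suc l) → ≈-trans (*-cong ≈-refl (G-suc b l))
            (solve 4 (λ s x g h → s :* (x :* g :+ h) := x :* (s :* g) :+ s :* h) ≈-refl
              (G a (suc (suc l))) (q^ suc l) (G b (suc l)) (G (suc b) l))
        }) (∑[]-+ 1 _ _)
    term : ∀ l → q^ p * rest l ≼ G a (suc l) * G (suc b) l
    term zero    = nn-resp (solve 2 (λ x g → g :- x :* con 0ℤ := g) ≈-refl (q^ p) (G a 1 * G (suc b) 0))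
      (nn-* (nn-G a 1) (nn-G (suc b) 0))
    term (suc l) = ≼-resp (solve 3 (λ x g h → x :* (g :* h) := g :* (x :* h)) ≈-refl (q^ p) (G a (suc (suc l))) (G (suc b) l)) ≈-refl
      (≼-*ˡ (nn-G a (suc (suc l))) (G-insert p (suc b) l p≤1+b))

  -- The series q^(m+3) `K (suc b) (suc a)` is subtracted once and added once: `U-insert` can afford
  -- it and `W-insert` asks for it.
  nn-reduced-≥2 : ∀ a b m → m ℕ.≤ b → Nonneg (reduced a b (suc (suc m)))
  nn-reduced-≥2 a b m m≤b = nn-resp
    (solve 7 (λ q x k u e k′ z →
        q :* k :+ (con 1ℤ :- q :* (q :* x)) :* u :+ q :* (q :- q :* (q :* x)) :* e :+ z
        := q :* k :+ (u :- (q :* (q :* x)) :* (u :+ q :* k′)) :+ (q :* q) :* (e :+ (q :* x) :* k′ :- (q :* x) :* e) :+ z)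
      ≈-refl q (q^ m) (K (suc a) (suc b)) (U (suc a) (suc b)) (W (suc (suc b)) (suc a)) (K (suc b) (suc a)) _)
    (nn-+ (nn-+ (nn-+ (nn-* nn-q (nn-K (suc a) (suc b)))
        (U-insert m (suc a) (suc b) (ℕₚ.m≤n⇒m≤1+n m≤b)))
        (nn-* (nn-* nn-q nn-q) (W-insert (suc m) (suc a) (suc b) (ℕ.s≤s (ℕₚ.m≤n⇒m≤1+n m≤b)))))
      (nn-resp (*-assoc _ _ _) (nn-* (nn-q^ (suc (suc (suc (suc b))))) (nn-[1-q²]W (suc a) (suc b)))))

  -- Here q - q^m is zero, and -q `U` is -q `H` - q³ `W` by `U-split`: the first summand is covered
  -- by q `K`, the second by `U` through inserting a part 1.
  nn-reduced-1 : ∀ a b → Nonneg (reduced a b 1)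
  nn-reduced-1 a b = nn-resp (≈-trans (+-cong (+-cong (+-cong ≈-refl (*-cong ≈-refl (U-split (suc a) (suc b)))) ≈-refl) ≈-refl)
    (≈-trans
    (solve 6 (λ q k h w e z →
        q :* k :+ (con 1ℤ :- q :* con 1ℤ) :* (h :+ (q :* (q :* con 1ℤ)) :* w) :+ q :* (q :- q :* con 1ℤ) :* e :+ z
        := q :* (k :- h) :+ ((h :+ (q :* (q :* con 1ℤ)) :* w) :- (q :* (q :* con 1ℤ)) :* (q :* w)) :+ z)
      ≈-refl q (K (suc a) (suc b)) (H (suc a) (suc b)) (W (suc (suc a)) (suc b)) (W (suc (suc b)) (suc a)) _)
    (+-cong (+-cong ≈-refl (+-cong (≈-sym (U-split (suc a) (suc b))) ≈-refl)) ≈-refl)))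
    (nn-+ (nn-+ (nn-* nn-q (H≼K (suc a) (suc b))) insert)
      (nn-resp (*-assoc _ _ _) (nn-* (nn-q^ (suc (suc (suc (suc b))))) (nn-[1-q²]W (suc a) (suc b)))))
    where
    insert : q^ 2 * (q * W (suc (suc a)) (suc b)) ≼ U (suc a) (suc b)
    insert = ≼-resp (*-cong ≈-refl (≈-sym (∑[]-* 1 q _))) ≈-refl
      (∑[]-shift 1 {λ l → q * (G (suc b) (suc l) * G (suc (suc a)) l)} (nn-* nn-1# nn-1#) λ l → ≼-*ˡ (nn-q^ 2)
        (≼-resp (solve 3 (λ q g h → q :* (g :* h) := g :* ((q :* con 1ℤ) :* h)) ≈-refl q (G (suc b) (suc l)) (G (suc (suc a)) l)) ≈-refl
          (≼-*ˡ (nn-G (suc b) (suc l)) (G-insert 1 (suc (suc a)) l (ℕ.s≤s ℕ.z≤n)))))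

  -- The case m = 0

  module Diagonal (a : ℕ) where

    V k h v g w v₁ x : Series
    V  = W (suc (suc a)) (suc a)
    k  = K (suc a) (suc a)
    h  = H (suc a) (suc a)
    v  = ∑[ 2 ] (λ l → G a (suc l) * G (suc (suc a)) l)
    g  = ∑[ 3 ] (λ l → G a (suc l) * G (suc a) l)
    w  = ∑[ 3 ] (λ l → G a l * G (suc a) l)
    v₁ = (1# - q) * v + q * g
    x  = q^ suc (suc a)

    drop : ∀ p (s : ℕ → Series) → ∑[ p ] (λ l → G (suc a) (suc l) * s l)
         ≈ q * ∑[ suc p ] (λ l → G a (suc l) * s l) + ∑[ p ] (λ l → G (suc a) l * s l)
    drop p s = ≈-trans (∑[]-cong p λ l → ≈-trans (*-cong (G-suc a l) ≈-refl)
        (solve 5 (λ q y e f s → ((q :* y) :* e :+ f) :* s := q :* (y :* (e :* s)) :+ con 1ℤ :* (f :* s)) ≈-refl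
          q (q^ l) (G a (suc l)) (G (suc a) l) (s l)))
      (≈-trans (∑[]-linear p q 1# _ _) (+-cong ≈-refl (*-identityˡ _)))

    -- Applying `drop` to the first factor and then `U-split` reproduces q² `V`; this is where the
    -- multiplier 1 - q² of the whole case comes from.
    V-split : (1# - q^ 2) * V ≈ q * v + h
    V-split = ≈-trans
      (≈-trans (solve 2 (λ y V → (con 1ℤ :- y) :* V := V :- y :* V) ≈-refl (q^ 2) V)
        (+-cong (≈-trans (drop 1 (G (suc (suc a)))) (+-cong ≈-refl (U-split (suc a) (suc a)))) ≈-refl))
      (solve 4 (λ v h y V → v :+ (h :+ y :* V) :- y :* V := v :+ h) ≈-refl (q * v) h (q^ 2) V)

    k-split : k ≈ q * g + h
    k-split = drop 2 (G (suc a))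

    v-k : (1# - x) * v ≈ (1# - q^ suc a) * k
    v-k = ≈-trans (≈-sym (∑[]-* 2 _ _)) (≈-trans (∑[]-cong 2 term) (∑[]-* 2 _ _))
      where
      term : ∀ l → (1# - x) * (G a (suc l) * G (suc (suc a)) l) ≈ (1# - q^ suc a) * (G (suc a) (suc l) * G (suc a) l)
      term l = ≈-trans (solve 3 (λ y e f → y :* (e :* f) := e :* (y :* f)) ≈-refl (1# - x) (G a (suc l)) (G (suc (suc a)) l))
        (≈-trans (*-cong ≈-refl (≈-sym (G-ratio (suc a) l)))
        (≈-trans (solve 3 (λ e y f → e :* (y :* f) := f :* (y :* e)) ≈-refl (G a (suc l)) (1# - q^ suc l) (G (suc a) (suc l)))
        (≈-trans (*-cong ≈-refl (G-ratio a l))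
        (solve 3 (λ e y f → e :* (y :* f) := y :* (e :* f)) ≈-refl (G (suc a) (suc l)) (1# - q^ suc a) (G (suc a) l)))))

    w-split : w ≈ h - q^ 3 * k
    w-split = ≈-trans (solve 2 (λ w r → w := (w :+ r) :- r) ≈-refl w (∑[ 2 ] rest))
      (+-cong (≈-sym (≈-trans (∑[]-cong 2 split) (∑[]-+ 2 _ _)))
        (-‿cong (≈-trans (∑[]-unfold 2 rest) (≈-trans (+-identityˡ _) (*-cong ≈-refl (∑[]-cong 2 λ l → *-comm _ _))))))
      where
      rest : ℕ → Series
      rest zero    = 0#
      rest (suc l) = G (suc a) l * G (suc a) (suc l)
      split : ∀ l → G (suc a) l * G (suc a) l ≈ q^ l * (G a l * G (suc a) l) + rest l
      split zero    = ≈-trans (solve 0 (con 1ℤ :* con 1ℤ := con 1ℤ :* (con 1ℤ :* con 1ℤ) :+ con 0ℤ) ≈-refl)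
        (+-cong (*-cong ≈-refl (*-cong (≈-sym (G-zeroʳ a)) ≈-refl)) ≈-refl)
      split (suc l) = ≈-trans (*-cong (G-suc a l) ≈-refl)
        (solve 4 (λ y e f s → (y :* e :+ f) :* s := y :* (e :* s) :+ f :* s) ≈-refl
          (q^ suc l) (G a (suc l)) (G (suc a) l) (G (suc a) (suc l)))

    -- Term by term this is `G-raise′`, multiplied by q and `G (suc a) l`.
    raise : Nonneg (q * (1# - q) * g + x * w)
    raise = nn-resp (≈-trans
        (solve 4 (λ q y g w → q :* (con 1ℤ :- q) :* g :+ (q :* y) :* w := q :* ((con 1ℤ :- q) :* g :+ y :* w)) ≈-refl q (q^ suc a) g w)
        (*-cong ≈-refl (≈-sym (∑[]-linear 3 (1# - q) (q^ suc a) _ _))))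
      (nn-* nn-q (∑[]-nn 3 λ l → nn-resp
        (solve 5 (λ q y e f s → (con 1ℤ :- q) :* (e :* s) :+ y :* (f :* s) := (e :+ y :* f :- q :* e) :* s) ≈-refl
          q (q^ suc a) (G a (suc l)) (G a l) (G (suc a) l))
        (nn-* (G-raise′ a l) (nn-G (suc a) l))))

    -- The partitions into at most l parts between 2 and a + 2.
    c : ℕ → Series
    c zero    = 1#
    c (suc l) = G (suc (suc a)) (suc l) - q * G (suc (suc a)) l

    nn-c : ∀ l → Nonneg (c l)
    nn-c zero    = nn-1#
    nn-c (suc l) = ≼-resp (*-cong (≈-sym (*-identityʳ q)) ≈-refl) ≈-refl (G-insert 1 (suc (suc a)) l (ℕ.s≤s ℕ.z≤n))

    c-suc : ∀ l → c (suc l) ≈ c l + q^ suc l * (G (suc a) (suc l) - G (suc a) l)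
    c-suc zero    = ≈-trans (+-cong (G-suc (suc a) 0) ≈-refl)
      (solve 2 (λ q e → (q :* con 1ℤ) :* e :+ con 1ℤ :- q :* con 1ℤ := con 1ℤ :+ (q :* con 1ℤ) :* (e :- con 1ℤ)) ≈-refl q (G (suc a) 1))
    c-suc (suc l) = ≈-trans (+-cong (G-suc (suc a) (suc l)) (-‿cong (*-cong ≈-refl (G-suc (suc a) l))))
      (solve 6 (λ q y e f d t → (q :* (q :* y)) :* e :+ f :- q :* ((q :* y) :* d :+ t)
          := (f :- q :* t) :+ (q :* (q :* y)) :* (e :- d)) ≈-refl
        q (q^ l) (G (suc a) (suc (suc l))) (G (suc (suc a)) (suc l)) (G (suc a) (suc l)) (G (suc (suc a)) l))

    -- Removing the parts 1 by the factor 1 - q subtracts too much from partitions into at most l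
    -- parts: those with exactly l parts have no room for one more. The summand q `g` restores them.
    v₁-c : v₁ ≈ ∑[ 2 ] (λ l → G a (suc l) * c l)
    v₁-c = ≈-trans (≈-sym (∑[]-linear 2 (1# - q) q _ _)) (∑[]-cong 2 term)
      where
      term : ∀ l → (1# - q) * (G a (suc l) * G (suc (suc a)) l) + q * (q^ l * (G a (suc l) * G (suc a) l)) ≈ G a (suc l) * c l
      term zero    = solve 2 (λ q e → (con 1ℤ :- q) :* (e :* con 1ℤ) :+ q :* (con 1ℤ :* (e :* con 1ℤ)) := e :* con 1ℤ) ≈-refl q (G a 1)
      term (suc l) = ≈-trans (+-cong (*-cong ≈-refl (*-cong ≈-refl (G-suc (suc a) l))) ≈-refl)
        (≈-trans (solve 5 (λ q y e f d → (con 1ℤ :- q) :* (e :* (y :* f :+ d)) :+ q :* (y :* (e :* f)) := e :* ((y :* f :+ d) :- q :* d)) ≈-refl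
          q (q^ suc l) (G a (suc (suc l))) (G (suc a) (suc l)) (G (suc (suc a)) l))
        (*-cong ≈-refl (+-cong (≈-sym (G-suc (suc a) l)) ≈-refl)))

    -- The increment of `c` given by `c-suc` is covered by `g`. The previous value of `c` is covered
    -- through `G-lower`: either a part is lowered, giving q `v₁`, or the index moves by one, giving
    -- q³ `v₁`.
    v₁-bound : v₁ ≼ g + (q + q^ 3) * v₁
    v₁-bound = ≼-resp v₁-c (≈-trans (+-cong ≈-refl (*-cong ≈-refl v₁-c))
        (≈-trans (solve 4 (λ g q z s → g :+ (q :+ z) :* s := g :+ q :* s :+ z :* s) ≈-refl g q (q^ 3) _)
        (≈-trans (+-cong (+-cong ≈-refl (≈-sym (∑[]-* 2 q _))) (≈-sym (≈-trans (∑[]-unfold 2 late) (+-identityˡ _))))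
        (≈-sym (≈-trans (∑[]-+ 2 _ late) (+-cong (∑[]-+ 2 _ _) ≈-refl))))))
      (≼-∑[] 2 term)
      where
      late : ℕ → Series
      late zero    = 0#
      late (suc l) = G a (suc l) * c l
      term : ∀ l → G a (suc l) * c l ≼ q^ l * (G a (suc l) * G (suc a) l) + q * (G a (suc l) * c l) + late l
      term zero    = nn-resp (solve 2 (λ q e → con 1ℤ :* (e :* con 1ℤ) :+ q :* (e :* con 1ℤ) :+ con 0ℤ :- e :* con 1ℤ := q :* e) ≈-refl q (G a 1))
        (nn-* nn-q (nn-G a 1))
      term (suc l) = nn-resp (≈-trans
          (+-cong (+-cong (+-cong ≈-refl (*-cong ≈-refl (*-cong ≈-refl (c-suc l)))) ≈-refl) (-‿cong (*-cong ≈-refl (c-suc l))))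
          (solve 7 (λ q y e d f f′ c →
              y :* (e :* f) :+ q :* (e :* (c :+ y :* (f :- f′))) :+ d :* c :- e :* (c :+ y :* (f :- f′))
              := e :* (y :* f′) :+ (q :* e) :* (y :* (f :- f′)) :+ (q :* e :+ d :- e) :* c) ≈-refl
            q (q^ suc l) (G a (suc (suc l))) (G a (suc l)) (G (suc a) (suc l)) (G (suc a) l) (c l)))
        (nn-+ (nn-+ (nn-* (nn-G a (suc (suc l))) (nn-* (nn-q^ (suc l)) (nn-G (suc a) l)))
          (nn-* (nn-* nn-q (nn-G a (suc (suc l)))) (nn-* (nn-q^ (suc l)) (G-monoʳ (suc a) l))))
          (nn-* (G-lower a (suc l)) (nn-c l)))

    nn-v₁ : Nonneg v₁
    nn-v₁ = nn-resp v₁-c (∑[]-nn 2 λ l → nn-* (nn-G a (suc l)) (nn-c l))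

    T R : Series
    T = k - (1# - q) * V + q * x * ((1# - q^ 2) * V)
    R = g + (q + q^ 3) * v₁ - v₁

    -- In (1 - q²) `T` the series `h` cancels, and besides the series of `raise` there remains q x
    -- ((1 - q²) `g` - (1 - q - q²) `v₁`). The coefficient 1 - q - q³ in `R` begins the expansion of
    -- (1 - q - q²) / (1 - q²). Since (1 - q²)(1 - q - q³) = 1 - q - q² + q⁵, only q⁶ x `v₁` is left
    -- over.
    T-identity : (1# - q^ 2) * (T - q * x * R) ≈ (q * (1# - q) * g + x * w) + q^ 6 * x * v₁
    T-identity = ≈-trans
      (solve 6 (λ q x k V s t →
          s :* (k :- (con 1ℤ :- q) :* V :+ q :* x :* (s :* V) :- t)
          := s :* k :- (con 1ℤ :- q) :* (s :* V) :+ q :* x :* (s :* (s :* V)) :- s :* t) ≈-refl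
        q x k V (1# - q^ 2) (q * x * R))
      (≈-trans (+-cong (+-cong (+-cong (*-cong ≈-refl k-split) (-‿cong (*-cong ≈-refl V-split))) (*-cong ≈-refl (*-cong ≈-refl V-split))) ≈-refl)
      (≈-trans
      (solve 5 (λ q y v g h →
          let s = con 1ℤ :- q :* (q :* con 1ℤ)
              x = q :* y
              v₁ = (con 1ℤ :- q) :* v :+ q :* g
              k = q :* g :+ h
          in
          s :* k :- (con 1ℤ :- q) :* (q :* v :+ h) :+ q :* x :* (s :* (q :* v :+ h))
            :- s :* (q :* x :* (g :+ (q :+ q :* (q :* (q :* con 1ℤ))) :* v₁ :- v₁))
          := ((q :* (con 1ℤ :- q) :* g :+ x :* (h :- q :* (q :* (q :* con 1ℤ)) :* k))
              :+ q :* (q :* (q :* (q :* (q :* (q :* con 1ℤ))))) :* x :* v₁)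
             :+ (con 1ℤ :- q) :* q :* ((con 1ℤ :- y) :* k :- (con 1ℤ :- x) :* v))
        ≈-refl q (q^ suc a) v g h)
      (≈-trans (+-cong (+-cong (+-cong ≈-refl (*-cong ≈-refl (≈-trans (+-cong ≈-refl (-‿cong (*-cong ≈-refl (≈-sym k-split)))) (≈-sym w-split)))) ≈-refl)
         (*-cong ≈-refl (≈-trans (+-cong (≈-trans (*-cong ≈-refl (≈-sym k-split)) (≈-sym v-k)) ≈-refl) (-‿inverseʳ _))))
      (≈-trans (+-cong ≈-refl (zeroʳ _)) (+-identityʳ _)))))

    nn-T : Nonneg T
    nn-T = nn-resp (solve 2 (λ T r → T := (T :- r) :+ r) ≈-refl T (q * x * R))
      (nn-+ (nn-divide 1 (nn-resp T-identity (nn-+ raise (nn-* (nn-* (nn-q^ 6) (nn-q^ (suc (suc a)))) nn-v₁))))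
        (nn-* (nn-* nn-q (nn-q^ (suc (suc a)))) v₁-bound))

  nn-reduced-0 : ∀ a → Nonneg (reduced a a 0)
  nn-reduced-0 a = nn-resp
    (solve 6 (λ q x k u w s →
        q :* k :+ (con 1ℤ :- con 1ℤ) :* u :+ q :* (q :- con 1ℤ) :* w :+ (q :* (q :* x)) :* s :* w
        := q :* (k :- (con 1ℤ :- q) :* w :+ q :* x :* (s :* w))) ≈-refl
      q x k (U (suc a) (suc a)) V (1# - q^ 2))
    (nn-* nn-q nn-T)
    where open Diagonal a

  nn-reduced : ∀ a m → Nonneg (reduced a (a ℕ.+ m) m)
  nn-reduced a zero          = subst (λ b → Nonneg (reduced a b 0)) (sym (ℕₚ.+-identityʳ a)) (nn-reduced-0 a)
  nn-reduced a (suc zero)    = nn-reduced-1 a (a ℕ.+ 1)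
  nn-reduced a (suc (suc m)) = nn-reduced-≥2 a (a ℕ.+ suc (suc m)) m
    (ℕₚ.≤-trans (ℕₚ.m≤n⇒m≤1+n (ℕₚ.n≤1+n m)) (ℕₚ.m≤n+m (suc (suc m)) a))

  nn-level : ∀ a m → Nonneg (level a (a ℕ.+ m))
  nn-level a m = nn-resp (level-reduced a m) (nn-* (nn-q^ (suc a)) (nn-reduced a m))

-- The difference of the crank and rank series, by the side of the Durfee rectangle

module Decomposition where
  open PowerSeries
  open GaussianBinomials
  open LevelTerms
  open Positivity
  open Solver using (solve; _:=_; _:+_; _:*_; _:-_; con)

  -- 1 / ((1 - q) ⋯ (1 - q ^ k))
  Q : ℕ → Series
  Q zero    = 1#
  Q (suc k) = ∑ (G k)

  private
    delay : (ℕ → Series) → ℕ → Series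
    delay s zero    = 0#
    delay s (suc l) = s l

    ∑-delay : ∀ s → ∑ (delay s) ≈ q * ∑ s
    ∑-delay s = ≈-trans (∑-unfold (delay s)) (+-identityˡ _)

    G-delay : ∀ k l → G (suc k) l ≈ G k l + q^ suc k * delay (G (suc k)) l
    G-delay k zero    = ≈-trans (solve 1 (λ x → con 1ℤ := con 1ℤ :+ x :* con 0ℤ) ≈-refl (q^ suc k)) (+-cong (≈-sym (G-zeroʳ k)) ≈-refl)
    G-delay k (suc l) = ≈-refl

    ∑-G-delay : ∀ k (s : ℕ → Series) → ∑ (λ l → s l * G (suc k) l) ≈ ∑ (λ l → s l * G k l) + q^ suc (suc k) * ∑ (λ l → s (suc l) * G (suc k) l)
    ∑-G-delay k s = ≈-trans (∑-cong term) (≈-trans (∑-+ _ _) (+-cong ≈-refl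
        (≈-trans (∑-* (q^ suc k) _) (≈-trans (*-cong ≈-refl (∑-delay _))
          (solve 3 (λ x q y → x :* (q :* y) := (q :* x) :* y) ≈-refl (q^ suc k) q _)))))
      where
      term : ∀ l → s l * G (suc k) l ≈ s l * G k l + q^ suc k * delay (λ l → s (suc l) * G (suc k) l) l
      term zero    = ≈-trans (*-cong ≈-refl (≈-sym (G-zeroʳ k)))
        (solve 2 (λ y x → y := y :+ x :* con 0ℤ) ≈-refl (s 0 * G k 0) (q^ suc k))
      term (suc l) = solve 4 (λ s g x h → s :* (g :+ x :* h) := s :* g :+ x :* (s :* h)) ≈-refl (s (suc l)) (G k (suc l)) (q^ suc k) (G (suc k) l)

    ∑-G-suc : ∀ k (s : ℕ → Series) → ∑ (λ l → G (suc k) (suc l) * s l) ≈ q * ∑ (λ l → q^ l * (G k (suc l) * s l)) + ∑ (λ l → G (suc k) l * s l)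
    ∑-G-suc k s = ≈-trans (∑-cong λ l → ≈-trans (*-cong (G-suc k l) ≈-refl)
        (solve 5 (λ q y e f s → ((q :* y) :* e :+ f) :* s := q :* (y :* (e :* s)) :+ f :* s) ≈-refl
          q (q^ l) (G k (suc l)) (G (suc k) l) (s l)))
      (≈-trans (∑-+ _ _) (+-cong (∑-* q _) ≈-refl))

  Q-step : ∀ k → (1# - q^ suc k) * Q (suc k) ≈ Q k
  Q-step zero = ≈-trans
    (≈-trans (solve 2 (λ x s → (con 1ℤ :- x) :* s := s :- x :* s) ≈-refl (q^ 1) (∑ (G 0))) (+-cong (∑-unfold (G 0)) ≈-refl))
    (solve 2 (λ q s → con 1ℤ :+ q :* s :- (q :* con 1ℤ) :* s := con 1ℤ) ≈-refl q (∑ (G 0)))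
  Q-step (suc k) = ≈-trans
    (≈-trans (solve 2 (λ x s → (con 1ℤ :- x) :* s := s :- x :* s) ≈-refl (q^ suc (suc k)) (∑ (G (suc k))))
      (+-cong (≈-trans (∑-cong (G-delay k)) (≈-trans (∑-+ _ _) (+-cong ≈-refl (≈-trans (∑-* _ _) (*-cong ≈-refl (∑-delay _)))))) ≈-refl))
    (solve 4 (λ q x s t → t :+ x :* (q :* s) :- (q :* x) :* s := t) ≈-refl q (q^ suc k) (∑ (G (suc k))) (∑ (G k)))

  -- The partitions into more than L parts, in Q (k + 1), contribute q ^ (L + 1) times this series.
  overflow : ℕ → ℕ → Series
  overflow k L = ∑ (λ l → G k (L ℕ.+ l))

  overflow-step : ∀ k L → overflow k L ≈ G k L + q * overflow k (suc L)
  overflow-step k L = ≈-trans (∑-unfold _) (+-cong (≈-reflexive (cong (G k) (ℕₚ.+-identityʳ L)))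
    (*-cong ≈-refl (∑-cong λ l → ≈-reflexive (cong (G k) (ℕₚ.+-suc L l)))))

  Q-overflow : ∀ k L → Q (suc k) ≈ G (suc k) L + q^ suc L * overflow k (suc L)
  Q-overflow k zero    = ≈-trans (overflow-step k 0) (+-cong (G-zeroʳ k) (*-cong (≈-sym (*-identityʳ q)) ≈-refl))
  Q-overflow k (suc L) = ≈-trans (Q-overflow k L)
    (≈-trans (+-cong ≈-refl (*-cong ≈-refl (overflow-step k (suc L))))
    (≈-trans (solve 5 (λ q x g h o → g :+ x :* (h :+ q :* o) := (x :* h :+ g) :+ (q :* x) :* o) ≈-refl
        q (q^ suc L) (G (suc k) L) (G k (suc L)) (overflow k (suc (suc L))))
      (+-cong (≈-sym (G-suc k L)) ≈-refl)))

  -- Splitting pairs of partitions by comparing their numbers of parts.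
  Q-product : ∀ a b → Q (suc a) * Q (suc b) ≈ ∑ (λ l → G (suc a) l * G b l) + q * ∑ (λ l → G a (suc l) * G (suc b) l)
  Q-product a b = ≈-trans (≈-sym (∑-telescope f u step))
    (≈-trans (∑-cong λ { zero → solve 1 (λ x → x := x :+ con 0ℤ) ≈-refl _ ; (suc l) → ≈-refl })
    (≈-trans (∑-+ _ _) (+-cong ≈-refl (∑-delay _))))
    where
    -- With q^L divided out, `f L` counts the pairs in which some partition has at least L parts,
    -- and `u L` those in which the larger number of parts is L.
    u f : ℕ → Series
    u zero    = G (suc a) 0 * G b 0
    u (suc L) = G (suc a) (suc L) * G b (suc L) + G a (suc L) * G (suc b) L
    f zero    = Q (suc a) * Q (suc b)
    f (suc L) = overflow a (suc L) * Q (suc b) + G (suc a) L * overflow b (suc L)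
    step : ∀ L → u L ≈ f L - q * f (suc L)
    step zero    = ≈-sym (≈-trans (+-cong (*-cong (Q-overflow a 0) ≈-refl) ≈-refl)
      (≈-trans (solve 4 (λ q o s p → (con 1ℤ :+ (q :* con 1ℤ) :* o) :* s :- q :* (o :* s :+ con 1ℤ :* p) := s :- (q :* con 1ℤ) :* p) ≈-refl
          q (overflow a 1) (Q (suc b)) (overflow b 1))
      (≈-trans (+-cong (Q-overflow b 0) ≈-refl)
      (≈-trans (solve 1 (λ p → con 1ℤ :+ p :- p := con 1ℤ :* con 1ℤ) ≈-refl (q^ 1 * overflow b 1))
        (*-cong ≈-refl (≈-sym (G-zeroʳ b)))))))
    step (suc L) = ≈-sym (≈-trans
      (+-cong (+-cong (*-cong (overflow-step a (suc L)) (Q-overflow b L)) (*-cong ≈-refl (overflow-step b (suc L))))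
        (-‿cong (*-cong ≈-refl (+-cong (*-cong ≈-refl (≈-trans (Q-overflow b L) (+-cong ≈-refl (*-cong ≈-refl (overflow-step b (suc L))))))
          (*-cong (G-suc a L) ≈-refl)))))
      (≈-trans
      (≈-trans (+-cong (+-cong (*-cong ≈-refl (+-cong ≈-refl (*-cong ≈-refl (overflow-step b (suc L))))) ≈-refl) ≈-refl)
      (solve 8 (λ q x ga oa gb hb ob ha →
          (ga :+ q :* oa) :* (hb :+ x :* (gb :+ q :* ob)) :+ ha :* (gb :+ q :* ob)
            :- q :* (oa :* (hb :+ x :* (gb :+ q :* ob)) :+ (x :* ga :+ ha) :* ob)
          := (x :* ga :+ ha) :* gb :+ ga :* hb) ≈-refl
        q (q^ suc L) (G a (suc L)) (overflow a (suc (suc L))) (G b (suc L)) (G (suc b) L) (overflow b (suc (suc L))) (G (suc a) L)))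
      (+-cong (*-cong (≈-sym (G-suc a L)) ≈-refl) ≈-refl)))

  -- This is (i + 1)(i + m + 1) - i; the missing q^i is supplied by `∑`.
  e : ℕ → ℕ → ℕ
  e m i = i ℕ.* (i ℕ.+ m) ℕ.+ suc (i ℕ.+ m)

  rankTerm : ℕ → ℕ → Series
  rankTerm m i = ∑ (λ l → G i (suc l) * G (suc (i ℕ.+ m)) l)

  -- A m counts the partitions with crank greater than m.  In D m the part of the
  -- rank series B (m + 2) with a Durfee rectangle with i rows is subtracted from the i-th term.
  A D : ℕ → Series
  A m = ∑ (λ i → q^ e m i * (Q i * Q (suc (i ℕ.+ m))))
  D m = ∑ (λ i → q^ e m i * (Q i * Q (suc (i ℕ.+ m)) - q * rankTerm m i))

  private
    F : ℕ → ℕ → Series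
    F m i = ∑ (λ l → G i l * G (suc (i ℕ.+ m)) l)

    ∑-comm* : ∀ (s t : ℕ → Series) → ∑ (λ l → s l * t l) ≈ ∑ (λ l → t l * s l)
    ∑-comm* s t = ∑-cong λ l → *-comm (s l) (t l)

    base : ∀ m → Q 0 * Q (suc m) - q * rankTerm m 0 ≈ (1# - q) * Q (suc m) - q^ suc (suc (suc m)) * F m 0
    base m = ≈-trans
      (+-cong ≈-refl (-‿cong (*-cong ≈-refl (≈-trans (∑-G-delay m (λ _ → 1#)) (+-cong (∑-cong λ l → *-identityˡ (G m l)) ≈-refl)))))
      (solve 4 (λ q s x t → con 1ℤ :* s :- q :* (s :+ x :* t) := (con 1ℤ :- q) :* s :- (q :* x) :* t) ≈-refl
        q (Q (suc m)) (q^ suc (suc m)) (F m 0))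

    core : ℕ → ℕ → Series
    core m a = q^ suc (suc (suc a)) * W (suc a) (a ℕ.+ m)
      - q^ suc a * q^ suc (a ℕ.+ m) * q^ 4 * W (suc (suc (a ℕ.+ m))) a

    -- `Q-product` and the rank term share a sum, which cancels. The two Pascal rules turn the rest
    -- into a copy of `F` at each of two adjacent sides and the terms of `core`.
    step : ∀ m a → Q (suc a) * Q (suc (suc a ℕ.+ m)) - q * rankTerm m (suc a)
      ≈ F m a + core m a - q^ suc a * q^ suc (a ℕ.+ m) * q^ 3 * F m (suc a)
    step m a = ≈-trans (+-cong (Q-product a b) (-‿cong (*-cong ≈-refl φ-split)))
      (≈-trans (solve 5 (λ q y x z F → y :+ q :* z :- q :* (z :+ x :* F) := y :- (q :* x) :* F) ≈-refl
        q Y (q^ suc a) (∑ (λ l → G a (suc l) * G (suc b) l)) (F m (suc a)))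
      (≈-trans (solve 3 (λ y x F → y :- x :* F := (y :- x :* y) :+ x :* (y :- F)) ≈-refl Y (q^ suc (suc a)) (F m (suc a)))
      (≈-trans (+-cong (+-cong Y-split ≈-refl) (*-cong ≈-refl (+-cong ≈-refl (-‿cong F-split))))
      (solve 8 (λ q x z f w y w′ F′ →
          (f :+ (q :* x) :* (q :* w :+ y) :- (q :* x) :* y) :+ (q :* x) :* (y :- (y :+ (q :* (q :* z)) :* (q :* w′ :+ F′)))
          := f :+ ((q :* (q :* x)) :* w :- x :* z :* (q :* (q :* (q :* (q :* con 1ℤ)))) :* w′) :- x :* z :* (q :* (q :* (q :* con 1ℤ))) :* F′) ≈-refl
        q (q^ suc a) (q^ suc b′) (F m a) (W (suc a) b′) Y (W (suc b) a) (F m (suc a))))))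
      where
      b′ b : ℕ
      b′ = a ℕ.+ m
      b  = suc b′
      Y : Series
      Y = ∑ (λ l → G (suc a) l * G b l)
      φ-split : rankTerm m (suc a) ≈ ∑ (λ l → G a (suc l) * G (suc b) l) + q^ suc a * F m (suc a)
      φ-split = ≈-trans (∑-cong λ l → solve 4 (λ g x h s → (g :+ x :* h) :* s := g :* s :+ x :* (h :* s)) ≈-refl
          (G a (suc l)) (q^ suc a) (G (suc a) l) (G (suc b) l))
        (≈-trans (∑-+ _ _) (+-cong ≈-refl (∑-* _ _)))
      Y-split : Y ≈ F m a + q^ suc (suc a) * (q * W (suc a) b′ + Y)
      Y-split = ≈-trans (∑-comm* (G (suc a)) (G b)) (≈-trans (∑-G-delay a (G b))
        (+-cong (∑-comm* (G b) (G a)) (*-cong ≈-refl (≈-trans (∑-G-suc b′ (G (suc a))) (+-cong ≈-refl (∑-comm* (G b) (G (suc a))))))))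
      F-split : F m (suc a) ≈ Y + q^ suc (suc b) * (q * W (suc b) a + F m (suc a))
      F-split = ≈-trans (∑-G-delay b (G (suc a))) (+-cong ≈-refl (*-cong ≈-refl (∑-G-suc a (G (suc b)))))

    e-suc : ∀ m i → q^ e m i * (q^ i * q^ (i ℕ.+ m) * q^ 3) ≈ q * q^ e m (suc i)
    e-suc m i = ≈-sym (≈-trans (q^-cong eq) (≈-trans (q^-+ (e m i) _)
      (*-cong ≈-refl (≈-trans (q^-+ (i ℕ.+ (i ℕ.+ m)) 3) (*-cong (q^-+ i (i ℕ.+ m)) ≈-refl)))))
      where
      open NatSolver.+-*-Solver using () renaming (solve to solveℕ; _:=_ to _:≡_; _:+_ to _⊕_; _:*_ to _⊗_; con to conℕ)
      eq : suc (e m (suc i)) ≡ e m i ℕ.+ (i ℕ.+ (i ℕ.+ m) ℕ.+ 3)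
      eq = solveℕ 2 (λ i m → conℕ 1 ⊕ ((conℕ 1 ⊕ i) ⊗ (conℕ 1 ⊕ i ⊕ m) ⊕ (conℕ 2 ⊕ i ⊕ m))
          :≡ (i ⊗ (i ⊕ m) ⊕ (conℕ 1 ⊕ (i ⊕ m))) ⊕ (i ⊕ (i ⊕ m) ⊕ conℕ 3)) refl i m

    cores : ℕ → ℕ → Series
    cores m zero    = q^ e m 0 * ((1# - q) * Q (suc m))
    cores m (suc a) = q^ e m (suc a) * core m a

    -- The series `F` telescope: by `e-suc` the negative copy at one side is the positive copy at
    -- the next.
    D-cores : ∀ m → D m ≈ ∑ (cores m)
    D-cores m = ≈-trans (∑-cong split) (≈-trans (∑-+ (cores m) _)
        (≈-trans (+-cong ≈-refl (∑-telescope f _ λ _ → ≈-refl)) (+-identityʳ _)))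
      where
      f : ℕ → Series
      f zero    = 0#
      f (suc i) = q^ e m (suc i) * F m i
      split : ∀ i → q^ e m i * (Q i * Q (suc (i ℕ.+ m)) - q * rankTerm m i) ≈ cores m i + (f i - q * f (suc i))
      split zero    = ≈-trans (*-cong ≈-refl (base m))
        (≈-trans (solve 5 (λ x s q z t → x :* (s :- (q :* (q :* (q :* z))) :* t)
            := x :* s :+ (con 0ℤ :- (x :* (con 1ℤ :* z :* (q :* (q :* (q :* con 1ℤ))))) :* t)) ≈-refl
          (q^ e m 0) ((1# - q) * Q (suc m)) q (q^ m) (F m 0))
        (+-cong ≈-refl (+-cong ≈-refl (-‿cong (≈-trans (*-cong (e-suc m 0) ≈-refl) (*-assoc _ _ _))))))
      split (suc a) = ≈-trans (*-cong ≈-refl (step m a))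
        (≈-trans (solve 5 (λ x f c y t → x :* (f :+ c :- y :* t) := x :* c :+ (x :* f :- (x :* y) :* t)) ≈-refl
          (q^ e m (suc a)) (F m a) (core m a) (q^ suc a * q^ suc (a ℕ.+ m) * q^ 3) (F m (suc a)))
        (+-cong ≈-refl (+-cong ≈-refl (-‿cong (≈-trans (*-cong (e-suc m (suc a)) ≈-refl) (*-assoc _ _ _))))))

    -- The main positive part of core, shifted so that it meets the negative part of the previous level.
    lead : ℕ → ℕ → Series
    lead m a = q^ e m (suc a) * (q^ suc (suc (suc a)) * W (suc a) (a ℕ.+ m))

    -- The part of `lead` that is released. The rest, with the factor q^(a+m+3), carries q^(2a+m+6),
    -- exactly the power of the negative term of `core m a`, and stays to meet it.
    leads : ℕ → ℕ → Series
    leads m a = (1# - q^ suc (suc (suc (a ℕ.+ m)))) * lead m a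

    -- Side a + 1 receives what side a + 2 releases and gives up its own released part.
    levels : ∀ m a → q * leads m (suc a) + (q^ e m (suc a) * core m a - leads m a)
      ≈ q^ e m (suc a) * (q^ suc a * q^ suc (a ℕ.+ m) * q^ 4) * level a (a ℕ.+ m)
    levels m a = ≈-trans
      (+-cong (≈-trans (solve 4 (λ q s x y → q :* (s :* (x :* y)) := (q :* x) :* (s :* y)) ≈-refl
          q (1# - q^ suc (suc (suc (suc a ℕ.+ m)))) (q^ e m (suc (suc a))) _)
        (*-cong (≈-sym (e-suc m (suc a))) ≈-refl)) ≈-refl)
      (solve 7 (λ q E x z w₁ w₂ w₃ →
          (E :* (x :* z :* (q :* (q :* (q :* con 1ℤ))))) :* ((con 1ℤ :- q :* (q :* (q :* z))) :* ((q :* (q :* (q :* x))) :* w₁))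
            :+ (E :* ((q :* (q :* x)) :* w₂ :- x :* z :* (q :* (q :* (q :* (q :* con 1ℤ)))) :* w₃)
                :- (con 1ℤ :- q :* (q :* z)) :* (E :* ((q :* (q :* x)) :* w₂)))
          := E :* (x :* z :* (q :* (q :* (q :* (q :* con 1ℤ)))))
             :* ((q :* (q :* x)) :* (con 1ℤ :- q :* (q :* (q :* z))) :* w₁ :+ w₂ :- w₃)) ≈-refl
        q (q^ e m (suc a)) (q^ suc a) (q^ suc (a ℕ.+ m)) (W (suc (suc a)) (suc a ℕ.+ m)) (W (suc a) (a ℕ.+ m)) (W (suc (suc (a ℕ.+ m))) a))

    D-levels : ∀ m → D m ≈ cores m 0 + q * (leads m 0 + ∑ (λ a → q^ e m (suc a) * (q^ suc a * q^ suc (a ℕ.+ m) * q^ 4) * level a (a ℕ.+ m)))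
    D-levels m = ≈-trans (D-cores m) (≈-trans (∑-unfold (cores m)) (+-cong ≈-refl (*-cong ≈-refl
      (≈-trans (∑-cong λ a → solve 2 (λ c l → c := l :+ (c :- l)) ≈-refl (cores m (suc a)) (leads m a))
      (≈-trans (∑-+ (leads m) _)
      (≈-trans (+-cong (∑-unfold (leads m)) ≈-refl)
      (≈-trans (+-assoc _ _ _) (+-cong ≈-refl
      (≈-trans (+-cong (≈-sym (∑-* q _)) ≈-refl) (≈-trans (≈-sym (∑-+ _ _)) (∑-cong (levels m))))))))))))

  nn-D : ∀ m → Nonneg (D m)
  nn-D m = nn-resp (D-levels m) (nn-+
    (nn-* (nn-q^ (e m 0)) (nn-resp (solve 2 (λ q s → (con 1ℤ :- q) :* s := s :- (q :* con 1ℤ) :* s) ≈-refl q (Q (suc m)))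
      (∑[]-shift 0 {G m} (nn-G m 0) λ l → ≼-*ˡ (nn-q^ 1) (G-monoʳ m l))))
    (nn-* nn-q (nn-+ lead₀ (∑-nn λ a → nn-* (nn-* (nn-q^ (e m (suc a))) (nn-* (nn-* (nn-q^ (suc a)) (nn-q^ (suc (a ℕ.+ m)))) (nn-q^ 4))) (nn-level a m)))))
    where
    -- The exponent m + 3 is spent on one step of the index, a part m in the first factor and a part
    -- 1 in the second.
    W-insert₁ : q^ 2 * (q^ m * q * W 1 m) ≼ W 1 m
    W-insert₁ = ≼-resp (*-cong ≈-refl (≈-sym (∑[]-* 1 (q^ m * q) _))) ≈-refl
      (∑[]-shift 1 {λ l → q^ m * q * (G m (suc l) * G 1 l)} (nn-* (nn-G m 1) (nn-G 1 0)) λ l → ≼-*ˡ (nn-q^ 2)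
        (≼-resp (solve 4 (λ x q g h → x :* q :* (g :* h) := (x :* g) :* ((q :* con 1ℤ) :* h)) ≈-refl (q^ m) q (G m (suc l)) (G 1 l)) ≈-refl
          (≼-* (nn-G m (suc (suc l))) (nn-* (nn-q^ 1) (nn-G 1 l)) (G-insert m m (suc l) ℕₚ.≤-refl) (G-insert 1 1 l ℕₚ.≤-refl))))
    lead₀ : Nonneg (leads m 0)
    lead₀ = nn-resp (solve 4 (λ q z E w →
          (con 1ℤ :- q :* (q :* (q :* z))) :* (E :* ((q :* (q :* (q :* con 1ℤ))) :* w))
          := (E :* (q :* (q :* (q :* con 1ℤ)))) :* (w :- (q :* (q :* con 1ℤ)) :* (z :* q :* w))) ≈-refl
        q (q^ m) (q^ e m 1) (W 1 m))
      (nn-* (nn-* (nn-q^ (e m 1)) (nn-q^ 3)) W-insert₁)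

-- Durfee rectangles, and the two inequalities between the series

module Comparison where
  open PowerSeries
  open GaussianBinomials
  open Decomposition
  open Solver using (solve; _:=_; _:+_; _:*_; _:-_; con)
  open NatSolver.+-*-Solver using () renaming (solve to solveℕ; _:=_ to _:≡_; _:+_ to _⊕_; _:*_ to _⊗_; con to conℕ)

  -- The Gaussian binomials again, now vanishing for k > n, so that Vandermonde's sum needs no range
  -- conditions. Where the subtraction n ∸ k truncates, its power multiplies zero.
  binomial : ℕ → ℕ → Series
  binomial n       zero    = 1#
  binomial zero    (suc k) = 0#
  binomial (suc n) (suc k) = binomial n (suc k) + q^ (n ℕ.∸ k) * binomial n k

  binomial-zero : ∀ n k → n ℕ.< k → binomial n k ≈ 0#
  binomial-zero zero    (suc k) _           = ≈-refl
  binomial-zero (suc n) (suc k) (ℕ.s≤s n<k) = ≈-trans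
    (+-cong (binomial-zero n (suc k) (ℕₚ.m≤n⇒m≤1+n n<k)) (*-cong ≈-refl (binomial-zero n k n<k)))
    (solve 1 (λ x → con 0ℤ :+ x :* con 0ℤ := con 0ℤ) ≈-refl (q^ (n ℕ.∸ k)))

  binomial-G : ∀ k l → binomial (k ℕ.+ l) l ≈ G k l
  binomial-G zero    zero    = ≈-refl
  binomial-G zero    (suc l) = ≈-trans
    (+-cong (binomial-zero l (suc l) ℕₚ.≤-refl) (*-cong (q^-cong (ℕₚ.n∸n≡0 l)) (binomial-G zero l)))
    (solve 0 (con 0ℤ :+ con 1ℤ :* con 1ℤ := con 1ℤ) ≈-refl)
  binomial-G (suc k) zero    = ≈-refl
  binomial-G (suc k) (suc l) = +-cong (binomial-G k (suc l))
    (*-cong (q^-cong (trans (cong (ℕ._∸ l) (ℕₚ.+-suc k l)) (ℕₚ.m+n∸n≡m (suc k) l)))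
      (≈-trans (≈-reflexive (cong (λ n → binomial n l) (ℕₚ.+-suc k l))) (binomial-G (suc k) l)))

  antidiagonal : (ℕ → ℕ → Series) → ℕ → Series
  antidiagonal f zero    = f 0 0
  antidiagonal f (suc n) = f 0 (suc n) + antidiagonal (λ i l → f (suc i) l) n

  antidiagonal-cong : ∀ n {f g} → (∀ i l → i ℕ.+ l ≡ n → f i l ≈ g i l) → antidiagonal f n ≈ antidiagonal g n
  antidiagonal-cong zero    p = p 0 0 refl
  antidiagonal-cong (suc n) p = +-cong (p 0 (suc n) refl) (antidiagonal-cong n λ i l eq → p (suc i) l (cong suc eq))

  antidiagonal-zero : ∀ n {f} → (∀ i l → f i l ≈ 0#) → antidiagonal f n ≈ 0#
  antidiagonal-zero zero    p = p 0 0
  antidiagonal-zero (suc n) p = ≈-trans (+-cong (p 0 (suc n)) (antidiagonal-zero n λ i → p (suc i))) (+-identityˡ 0#)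

  antidiagonal-+ : ∀ n f g → antidiagonal (λ i l → f i l + g i l) n ≈ antidiagonal f n + antidiagonal g n
  antidiagonal-+ zero    f g = ≈-refl
  antidiagonal-+ (suc n) f g = ≈-trans (+-cong ≈-refl (antidiagonal-+ n (λ i → f (suc i)) (λ i → g (suc i))))
    (solve 4 (λ a b c d → (a :+ b) :+ (c :+ d) := (a :+ c) :+ (b :+ d)) ≈-refl (f 0 (suc n)) (g 0 (suc n)) _ _)

  antidiagonal-* : ∀ n c f → antidiagonal (λ i l → c * f i l) n ≈ c * antidiagonal f n
  antidiagonal-* zero    c f = ≈-refl
  antidiagonal-* (suc n) c f = ≈-trans (+-cong ≈-refl (antidiagonal-* n c (λ i → f (suc i)))) (≈-sym (distribˡ c _ _))

  ∑-antidiagonal : ∀ f → ∑ (antidiagonal f) ≈ ∑ (λ i → ∑ (f i))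
  ∑-antidiagonal f = pointwise λ n → go n n ℕₚ.≤-refl f
    where
    row : ∀ f → ∑ (antidiagonal f) ≈ ∑ (f 0) + q * ∑ (antidiagonal (λ i → f (suc i)))
    row f = ≈-trans (∑-unfold _) (≈-trans (+-cong ≈-refl (*-cong ≈-refl (∑-+ _ _)))
      (≈-trans (solve 4 (λ a q b c → a :+ q :* (b :+ c) := (a :+ q :* b) :+ q :* c) ≈-refl (f 0 0) q _ _)
        (+-cong (≈-sym (∑-unfold (f 0))) ≈-refl)))
    go : ∀ bound n → n ℕ.≤ bound → ∀ f → ∑ (antidiagonal f) n ≡ ∑ (λ i → ∑ (f i)) n
    go bound n n≤b f = trans (coeff (row f) n) (trans (+-coeff _ _ n) (trans (cong (ℤ._+_ (∑ (f 0) n)) (shift bound n n≤b))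
        (sym (trans (coeff (∑-unfold _) n) (+-coeff _ _ n)))))
      where
      shift : ∀ bound n → n ℕ.≤ bound → (q * ∑ (antidiagonal (λ i → f (suc i)))) n ≡ (q * ∑ (λ i → ∑ (f (suc i)))) n
      shift bound       zero    _           = trans (q*-zero _) (sym (q*-zero _))
      shift (suc bound) (suc n) (ℕ.s≤s n≤b) = trans (q*-suc _ n) (trans (go bound n n≤b (λ i → f (suc i))) (sym (q*-suc _ n)))

  -- The q-Vandermonde identity; its usual exponent i (b - l) is i (i + c) because b = n + c. The
  -- induction on a keeps b fixed, so lowering n raises c.
  vandermonde : ∀ a n c b → b ≡ n ℕ.+ c →
    binomial (a ℕ.+ b) n ≈ antidiagonal (λ i l → q^ (i ℕ.* (i ℕ.+ c)) * (binomial a i * binomial b l)) n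
  vandermonde zero zero c b eq = solve 0 (con 1ℤ := con 1ℤ :* (con 1ℤ :* con 1ℤ)) ≈-refl
  vandermonde zero (suc n) c b eq = ≈-sym (≈-trans
    (+-cong (solve 1 (λ x → con 1ℤ :* (con 1ℤ :* x) := x) ≈-refl (binomial b (suc n)))
      (antidiagonal-zero n λ i l → solve 2 (λ x y → x :* (con 0ℤ :* y) := con 0ℤ) ≈-refl _ (binomial b l)))
    (+-identityʳ _))
  vandermonde (suc a) zero c b eq = solve 0 (con 1ℤ := con 1ℤ :* (con 1ℤ :* con 1ℤ)) ≈-refl
  vandermonde (suc a) (suc n) c b eq = ≈-trans
    (+-cong (vandermonde a (suc n) c b eq)
      (*-cong (q^-cong exponent) (vandermonde a n (suc c) b (trans eq (sym (ℕₚ.+-suc n c))))))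
    (≈-trans (+-assoc _ _ _) (+-cong ≈-refl
    (≈-trans (+-cong ≈-refl (≈-sym (antidiagonal-* n _ _)))
    (≈-trans (≈-sym (antidiagonal-+ n _ _)) (antidiagonal-cong n λ i l _ → merge i l)))))
    where
    exponent : a ℕ.+ b ℕ.∸ n ≡ a ℕ.+ suc c
    exponent = trans (cong (λ b → a ℕ.+ b ℕ.∸ n) (trans eq (trans (sym (ℕₚ.+-suc n c)) (ℕₚ.+-comm n (suc c)))))
      (trans (cong (ℕ._∸ n) (sym (ℕₚ.+-assoc a (suc c) n))) (ℕₚ.m+n∸n≡m (a ℕ.+ suc c) n))
    same : ∀ i → q^ (a ℕ.+ suc c) * q^ (i ℕ.* (i ℕ.+ suc c)) * binomial a i
      ≈ q^ (suc i ℕ.* (suc i ℕ.+ c)) * (q^ (a ℕ.∸ i) * binomial a i)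
    same i with i ℕ.≤? a
    ... | yes i≤a = ≈-trans (*-cong (≈-trans (≈-sym (q^-+ (a ℕ.+ suc c) _)) (≈-trans (q^-cong powers) (q^-+ (suc i ℕ.* (suc i ℕ.+ c)) (a ℕ.∸ i)))) ≈-refl) (*-assoc _ _ _)
      where
      powers : a ℕ.+ suc c ℕ.+ i ℕ.* (i ℕ.+ suc c) ≡ suc i ℕ.* (suc i ℕ.+ c) ℕ.+ (a ℕ.∸ i)
      powers = trans (cong (λ a → a ℕ.+ suc c ℕ.+ i ℕ.* (i ℕ.+ suc c)) (sym (ℕₚ.m+[n∸m]≡n i≤a)))
        (solveℕ 3 (λ i c d → (i ⊕ d) ⊕ (conℕ 1 ⊕ c) ⊕ i ⊗ (i ⊕ (conℕ 1 ⊕ c)) :≡ (conℕ 1 ⊕ i) ⊗ (conℕ 1 ⊕ i ⊕ c) ⊕ d) refl i c (a ℕ.∸ i))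
    -- Here a ∸ i truncates and the exponents disagree, but both sides vanish.
    ... | no i≰a = ≈-trans (*-cong ≈-refl vanish) (≈-trans
        (solve 3 (λ x y z → x :* con 0ℤ := y :* (z :* con 0ℤ)) ≈-refl (q^ (a ℕ.+ suc c) * q^ (i ℕ.* (i ℕ.+ suc c))) (q^ (suc i ℕ.* (suc i ℕ.+ c))) (q^ (a ℕ.∸ i)))
        (*-cong ≈-refl (*-cong ≈-refl (≈-sym vanish))))
      where
      vanish : binomial a i ≈ 0#
      vanish = binomial-zero a i (ℕₚ.≰⇒> i≰a)
    merge : ∀ i l → q^ (suc i ℕ.* (suc i ℕ.+ c)) * (binomial a (suc i) * binomial b l)
        + q^ (a ℕ.+ suc c) * (q^ (i ℕ.* (i ℕ.+ suc c)) * (binomial a i * binomial b l))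
      ≈ q^ (suc i ℕ.* (suc i ℕ.+ c)) * ((binomial a (suc i) + q^ (a ℕ.∸ i) * binomial a i) * binomial b l)
    merge i l = ≈-trans (+-cong ≈-refl (≈-trans
        (solve 4 (λ x y u v → x :* (y :* (u :* v)) := (x :* y :* u) :* v) ≈-refl _ _ (binomial a i) (binomial b l))
        (*-cong (same i) ≈-refl)))
      (solve 5 (λ x u v y w → x :* (u :* v) :+ x :* (y :* w) :* v := x :* ((u :+ y :* w) :* v)) ≈-refl
        _ (binomial a (suc i)) (binomial b l) (q^ (a ℕ.∸ i)) (binomial a i))

  -- Durfee rectangles: the partitions into at most k parts, each at most k + c.
  durfee : ∀ a k c → binomial (a ℕ.+ k ℕ.+ (k ℕ.+ c)) k
    ≈ antidiagonal (λ i l → q^ (i ℕ.* (i ℕ.+ c)) * (G i (a ℕ.+ l) * G (i ℕ.+ c) l)) k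
  durfee a k c = ≈-trans (vandermonde (a ℕ.+ k) k c (k ℕ.+ c) refl) (antidiagonal-cong k λ i l eq →
    *-cong ≈-refl (*-cong
      (≈-trans (≈-reflexive (cong (λ n → binomial n i) (trans (cong (a ℕ.+_) (sym eq))
          (solveℕ 3 (λ a i l → a ⊕ (i ⊕ l) :≡ a ⊕ l ⊕ i) refl a i l))))
        (≈-trans (binomial-G (a ℕ.+ l) i) (G-comm (a ℕ.+ l) i)))
      (≈-trans (≈-reflexive (cong (λ n → binomial n l) (trans (cong (ℕ._+ c) (sym eq))
          (solveℕ 3 (λ i l c → i ⊕ l ⊕ c :≡ i ⊕ c ⊕ l) refl i l c))))
        (binomial-G (i ℕ.+ c) l))))

  -- The partitions of rank at least c - 1, for c ≥ 1, sorted by their largest part k + c.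
  B : ℕ → Series
  B c = ∑ (λ k → q^ c * G (k ℕ.+ c) k)

  D-A-B : ∀ m → D m ≈ A m - B (suc (suc m))
  D-A-B m = ≈-trans
    (∑-cong λ i → solve 4 (λ x y q z → x :* (y :- q :* z) := x :* y :- x :* (q :* z)) ≈-refl (q^ e m i) (Q i * Q (suc (i ℕ.+ m))) q (rankTerm m i))
    (≈-trans (∑-sub _ _) (+-cong ≈-refl (-‿cong (≈-sym B-terms))))
    where
    exponent : ∀ i → suc (suc m) ℕ.+ i ℕ.* (i ℕ.+ suc m) ≡ e m i ℕ.+ 1
    exponent i = solveℕ 2 (λ i m → conℕ 2 ⊕ m ⊕ i ⊗ (i ⊕ (conℕ 1 ⊕ m)) :≡ (i ⊗ (i ⊕ m) ⊕ (conℕ 1 ⊕ (i ⊕ m))) ⊕ conℕ 1) refl i m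
    term : ℕ → ℕ → Series
    term i l = q^ e m i * (q * (G i (suc l) * G (suc (i ℕ.+ m)) l))
    B-terms : B (suc (suc m)) ≈ ∑ (λ i → q^ e m i * (q * rankTerm m i))
    B-terms = ≈-trans (∑-cong λ k → ≈-trans (*-cong ≈-refl (≈-trans (≈-sym (binomial-G (k ℕ.+ suc (suc m)) k))
          (≈-trans (≈-reflexive (cong (λ n → binomial n k) (solveℕ 2 (λ k m → k ⊕ (conℕ 2 ⊕ m) ⊕ k :≡ conℕ 1 ⊕ k ⊕ (k ⊕ (conℕ 1 ⊕ m))) refl k m)))
            -- The box is k by k + m + 2, the rectangles are i by i + m + 1: the difference of one
            -- is the first argument, and it produces the `suc l` in `rankTerm`.
            (durfee 1 k (suc m)))))
        (≈-trans (≈-sym (antidiagonal-* k _ _)) (antidiagonal-cong k λ i l _ → ≈-trans (≈-sym (*-assoc _ _ _))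
          (≈-trans (*-cong (≈-trans (≈-sym (q^-+ (suc (suc m)) _)) (≈-trans (q^-cong (exponent i)) (q^-+ (e m i) 1)))
            (*-cong ≈-refl (≈-reflexive (cong (λ n → G n l) (ℕₚ.+-suc i m)))))
          (solve 3 (λ x q g → x :* (q :* con 1ℤ) :* g := x :* (q :* g)) ≈-refl (q^ e m i) q _)))))
      (≈-trans (∑-antidiagonal term) (∑-cong λ i → ≈-trans (∑-* _ _) (*-cong ≈-refl (∑-* q _))))

  B≼A : ∀ m → B (suc (suc m)) ≼ A m
  B≼A m = nn-resp (≈-sym (D-A-B m)) (nn-D m)

  B-decreasing : ∀ c → B (suc c) ≼ B c
  B-decreasing c = ≼-resp
    (≈-trans (∑-cong λ k → ≈-trans (*-cong ≈-refl (≈-reflexive (cong (λ n → G n k) (ℕₚ.+-suc k c)))) (*-assoc q (q^ c) _)) (∑-* q _))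
    (∑-unfold _)
    (nn-resp (solve 4 (λ f q s t → f :+ q :* t :- q :* s := f :+ q :* (t :- s)) ≈-refl
        (q^ c * G c 0) q (∑ (λ k → q^ c * G (suc (k ℕ.+ c)) k)) (∑ (λ k → q^ c * G (suc (k ℕ.+ c)) (suc k))))
      (nn-+ (nn-* (nn-q^ c) (nn-G c 0)) (nn-* nn-q (≼-∑ λ k → ≼-*ˡ (nn-q^ c) (G-monoʳ (suc (k ℕ.+ c)) k)))))

  ∑-partial : ∀ (u h : ℕ → Series) → h 0 ≈ u 0 → (∀ k → h (suc k) ≈ h k + q^ suc k * u (suc k)) →
    ∀ k → ∑ u ≈ h k + q^ suc k * ∑ (λ l → u (suc k ℕ.+ l))
  ∑-partial u h base step zero = ≈-trans (∑-unfold u) (+-cong (≈-sym base) (*-cong (≈-sym (*-identityʳ q)) ≈-refl))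
  ∑-partial u h base step (suc k) = ≈-trans (∑-partial u h base step k)
    (≈-trans (+-cong ≈-refl (*-cong ≈-refl (≈-trans (∑-unfold _) (+-cong (≈-reflexive (cong u (ℕₚ.+-identityʳ (suc k))))
        (*-cong ≈-refl (∑-cong λ l → ≈-reflexive (cong u (ℕₚ.+-suc (suc k) l))))))))
    (≈-trans (solve 5 (λ q x h u s → h :+ x :* (u :+ q :* s) := (h :+ x :* u) :+ (q :* x) :* s) ≈-refl
        q (q^ suc k) (h k) (u (suc k)) (∑ (λ l → u (suc (suc k) ℕ.+ l))))
      (+-cong (≈-sym (step k)) ≈-refl)))

  +q^-below : ∀ k {f g h} → f ≈ g + q^ k * h → f ≈[ k ] g
  +q^-below k {f} {g} {h} p {n} n<k = trans (coeff p n) (trans (+-coeff g (q^ k * h) n)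
    (trans (cong (ℤ._+_ (g n)) (q^*-below k h n<k)) (ℤₚ.+-identityʳ (g n))))

  -- A partition of n ≤ L has at most L parts.
  G≈Q : ∀ k L → G k L ≈[ suc L ] Q k
  G≈Q zero    L n<L = refl
  G≈Q (suc k) L n<L = sym (+q^-below (suc L) (Q-overflow k L) n<L)

  -- N̄ c counts the partitions of rank at most c + 1, sorted by their number of parts k, and M̄ c those of crank at most c.
  N̄ M̄ : ℕ → Series
  N̄ c = ∑ (λ k → G (k ℕ.+ c) k)
  M̄ c = ∑ (λ j → q^ (j ℕ.* (j ℕ.+ c)) * (Q j * Q (j ℕ.+ c)))

  -- The partial sums of the combined series are single Gaussian binomials: the two Pascal rules,
  -- applied to the growing box k by k + c + 2, add one term of each summand.
  N̄-partial : ∀ c k → N̄ c + B (suc (suc (suc c))) ≈[ suc k ] G (k ℕ.+ suc (suc c)) k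
  N̄-partial c k n<k = trans (coeff collected _) (+q^-below (suc k) (∑-partial u h base step k) n<k)
    where
    u h : ℕ → Series
    u zero    = G c 0
    u (suc k) = G (suc k ℕ.+ c) (suc k) + q^ suc (suc c) * G (k ℕ.+ suc (suc (suc c))) k
    h k = G (k ℕ.+ suc (suc c)) k
    base : h 0 ≈ u 0
    base = ≈-sym (G-zeroʳ c)
    step : ∀ k → h (suc k) ≈ h k + q^ suc k * u (suc k)
    step k = ≈-trans (+-cong (≈-trans (≈-reflexive (cong (λ n → G n (suc k)) (ℕₚ.+-suc k (suc c)))) (G-suc (k ℕ.+ suc c) k)) ≈-refl)
      (≈-trans (+-cong (+-cong (*-cong ≈-refl (≈-reflexive (cong (λ n → G n (suc k)) (ℕₚ.+-suc k c))))
          (≈-reflexive (cong (λ n → G n k) (sym (ℕₚ.+-suc k (suc c))))))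
        (*-cong (q^-+ (suc k) (suc (suc c))) (≈-reflexive (cong (λ n → G n k) (sym (ℕₚ.+-suc k (suc (suc c))))))))
      (solve 5 (λ x y a b g → x :* a :+ b :+ x :* y :* g := b :+ x :* (a :+ y :* g)) ≈-refl
        (q^ suc k) (q^ suc (suc c)) (G (suc k ℕ.+ c) (suc k)) (G (k ℕ.+ suc (suc c)) k) (G (k ℕ.+ suc (suc (suc c))) k)))
    collected : N̄ c + B (suc (suc (suc c))) ≈ ∑ u
    collected = ≈-trans (+-cong ≈-refl (≈-trans (∑-cong λ k → *-assoc q _ _) (∑-* q _)))
      (≈-trans (+-cong (∑-unfold _) ≈-refl)
      (≈-trans (solve 4 (λ a q b c → (a :+ q :* b) :+ q :* c := a :+ q :* (b :+ c)) ≈-refl (G c 0) q _ _)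
      (≈-trans (+-cong ≈-refl (*-cong ≈-refl (≈-sym (∑-+ _ _)))) (≈-sym (∑-unfold u)))))

  private
    -- All partitions, sorted by their Durfee rectangle j by j + m + 1: with the q^j of `∑` the
    -- exponent is j (j + m + 1).
    Π : ℕ → Series
    Π m = ∑ (λ j → q^ (j ℕ.* (j ℕ.+ m)) * (Q j * Q (suc (j ℕ.+ m))))

  antidiagonal-row : ∀ n (t : ℕ → Series) → ∑ t ≈[ suc n ] antidiagonal (λ i _ → q^ i * t i) n
  antidiagonal-row = go
    where
    scaled : ∀ n (s : ℕ → Series) → antidiagonal (λ i _ → q^ suc i * s i) n ≈ q * antidiagonal (λ i _ → q^ i * s i) n
    scaled n s = ≈-trans (antidiagonal-cong n λ i l _ → *-assoc q (q^ i) (s i)) (antidiagonal-* n q _)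
    go : ∀ n (t : ℕ → Series) {k} → k ℕ.< suc n → ∑ t k ≡ antidiagonal (λ i _ → q^ i * t i) n k
    go zero    t {zero} _ = trans (coeff (∑-unfold t) 0) (trans (+-coeff _ _ 0) (trans (cong (ℤ._+_ (t 0 0)) (q*-zero _))
      (trans (ℤₚ.+-identityʳ _) (sym (coeff (*-identityˡ (t 0)) 0)))))
    go zero    t {suc k} (ℕ.s≤s ())
    go (suc n) t {k} k<n = trans (coeff (∑-unfold t) k) (trans (+-coeff _ _ k)
      (sym (trans (+-coeff _ _ k) (cong₂ ℤ._+_ (coeff (*-identityˡ (t 0)) k)
        (trans (coeff (scaled n (λ i → t (suc i))) k) (sym (tails k k<n)))))))
      where
      tails : ∀ k → k ℕ.< suc (suc n) → (q * ∑ (λ i → t (suc i))) k ≡ (q * antidiagonal (λ i _ → q^ i * t (suc i)) n) k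
      tails zero    _           = trans (q*-zero _) (sym (q*-zero _))
      tails (suc k) (ℕ.s≤s k<n) = trans (q*-suc _ k) (trans (go n (λ i → t (suc i)) k<n) (sym (q*-suc _ k)))

  antidiagonal-coeff : ∀ k n {f g} → (∀ i l → i ℕ.+ l ≡ n → f i l k ≡ g i l k) → antidiagonal f n k ≡ antidiagonal g n k
  antidiagonal-coeff k zero    p = p 0 0 refl
  antidiagonal-coeff k (suc n) p = trans (+-coeff _ _ k) (trans
    (cong₂ ℤ._+_ (p 0 (suc n) refl) (antidiagonal-coeff k n λ i l eq → p (suc i) l (cong suc eq)))
    (sym (+-coeff _ _ k)))

  antidiagonal-below : ∀ N n {f g} → (∀ i l → i ℕ.+ l ≡ n → f i l ≈[ N ] g i l) → antidiagonal f n ≈[ N ] antidiagonal g n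
  antidiagonal-below N n p {k} k<N = antidiagonal-coeff k n λ i l eq → p i l eq k<N

  -- Replacing `Q` by Gaussian binomials in the i-th term is exact below q^(l+1) only; the factor
  -- q^(i(i+m+1)) adds at least i to this, and i + l = k.
  Π-partial : ∀ m k → Π m ≈[ suc k ] G (k ℕ.+ suc m) k
  Π-partial m k n<k = trans (antidiagonal-row k _ n<k) (trans
    (antidiagonal-below (suc k) k term n<k)
    (coeff (≈-trans (≈-sym (durfee 0 k (suc m))) (≈-trans (≈-reflexive (cong (λ n → binomial n k) (ℕₚ.+-comm k (k ℕ.+ suc m)))) (binomial-G (k ℕ.+ suc m) k))) _))
    where
    term : ∀ i l → i ℕ.+ l ≡ k → q^ i * (q^ (i ℕ.* (i ℕ.+ m)) * (Q i * Q (suc (i ℕ.+ m))))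
      ≈[ suc k ] q^ (i ℕ.* (i ℕ.+ suc m)) * (G i l * G (i ℕ.+ suc m) l)
    term i l eq {n} n<k = trans (coeff rewritten n) (≈[]-q^* (i ℕ.* (i ℕ.+ suc m))
        (λ r → ≈[]-* {f = Q i} {g = Q (i ℕ.+ suc m)} (λ r → sym (G≈Q i l r)) (λ r → sym (G≈Q (i ℕ.+ suc m) l r)) r)
        (ℕₚ.≤-trans n<k (subst (ℕ._≤ i ℕ.* (i ℕ.+ suc m) ℕ.+ suc l) (trans (ℕₚ.+-suc i l) (cong suc eq))
          (ℕₚ.+-monoˡ-≤ (suc l) (subst (i ℕ.≤_) (cong (i ℕ.*_) (sym (ℕₚ.+-suc i m))) (ℕₚ.m≤m*n i (suc (i ℕ.+ m))))))))
      where
      rewritten : q^ i * (q^ (i ℕ.* (i ℕ.+ m)) * (Q i * Q (suc (i ℕ.+ m)))) ≈ q^ (i ℕ.* (i ℕ.+ suc m)) * (Q i * Q (i ℕ.+ suc m))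
      rewritten = ≈-trans (≈-sym (*-assoc _ _ _)) (*-cong
        (≈-trans (≈-sym (q^-+ i _)) (q^-cong (solveℕ 2 (λ i m → i ⊕ i ⊗ (i ⊕ m) :≡ i ⊗ (i ⊕ (conℕ 1 ⊕ m))) refl i m)))
        (*-cong ≈-refl (≈-reflexive (cong Q (sym (ℕₚ.+-suc i m))))))

  G-suc-below : ∀ k l → G k l ≈[ suc k ] G (suc k) l
  G-suc-below k zero    n<k = coeff (G-zeroʳ k) _
  G-suc-below k (suc l) n<k = sym (+q^-below (suc k) ≈-refl n<k)

  N̄-Π : ∀ m → N̄ (suc m) + B (suc (suc (suc (suc m)))) ≈ Π m
  N̄-Π m = pointwise λ n → trans (N̄-partial (suc m) n (ℕₚ.n<1+n n)) (trans (sym (two n)) (sym (Π-partial m n (ℕₚ.n<1+n n))))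
    where
    bound : ∀ n d → suc n ℕ.≤ suc (n ℕ.+ d)
    bound n d = ℕ.s≤s (ℕₚ.m≤m+n n d)
    -- The boxes differ by two in width, which coefficient n does not see once the width is at least
    -- n.
    two : ∀ n → G (n ℕ.+ suc m) n n ≡ G (n ℕ.+ suc (suc (suc m))) n n
    two n = trans (G-suc-below (n ℕ.+ suc m) n (bound n (suc m)))
      (trans (G-suc-below (suc (n ℕ.+ suc m)) n (ℕₚ.m≤n⇒m≤1+n (bound n (suc m))))
      (cong (λ k → G k n n) (trans (cong suc (sym (ℕₚ.+-suc n (suc m)))) (sym (ℕₚ.+-suc n (suc (suc m)))))))

  -- With `A` moved up by one index this holds termwise, by q^j `Q j` + `Q (j - 1)` = `Q j`.
  M̄-Π : ∀ m → M̄ (suc m) + A (suc m) ≈ Π m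
  M̄-Π m = ≈-trans (+-cong ≈-refl A-split) (≈-trans (≈-sym (∑-+ _ _)) (∑-cong merge))
    where
    top : ℕ → Series
    top zero    = 0#
    top (suc i) = q^ (suc i ℕ.* (suc i ℕ.+ m)) * (Q i * Q (suc (suc i ℕ.+ m)))
    A-split : A (suc m) ≈ ∑ top
    A-split = ≈-sym (≈-trans (∑-unfold top) (≈-trans (+-identityˡ _) (≈-trans (≈-sym (∑-* q _)) (∑-cong λ i →
      ≈-trans (≈-sym (*-assoc _ _ _)) (*-cong (q^-cong (solveℕ 2 (λ i m → conℕ 1 ⊕ (conℕ 1 ⊕ i) ⊗ (conℕ 1 ⊕ i ⊕ m)
          :≡ i ⊗ (i ⊕ (conℕ 1 ⊕ m)) ⊕ (conℕ 1 ⊕ (i ⊕ (conℕ 1 ⊕ m)))) refl i m))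
        (*-cong ≈-refl (≈-reflexive (cong (λ n → Q (suc n)) (sym (ℕₚ.+-suc i m))))))))))
    merge : ∀ j → q^ (j ℕ.* (j ℕ.+ suc m)) * (Q j * Q (j ℕ.+ suc m)) + top j ≈ q^ (j ℕ.* (j ℕ.+ m)) * (Q j * Q (suc (j ℕ.+ m)))
    merge zero    = +-identityʳ _
    merge (suc i) = ≈-trans (+-cong
        (*-cong (≈-trans (q^-cong (solveℕ 2 (λ i m → (conℕ 1 ⊕ i) ⊗ (conℕ 1 ⊕ i ⊕ (conℕ 1 ⊕ m)) :≡ (conℕ 1 ⊕ i) ⊕ (conℕ 1 ⊕ i) ⊗ (conℕ 1 ⊕ i ⊕ m)) refl i m)) (q^-+ (suc i) _))
          (*-cong ≈-refl (≈-reflexive (cong (λ n → Q (suc n)) (ℕₚ.+-suc i m)))))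
        (*-cong ≈-refl (*-cong (≈-sym (Q-step i)) ≈-refl)))
      (solve 4 (λ x y u v → x :* y :* (u :* v) :+ y :* (((con 1ℤ :- x) :* u) :* v) := y :* (u :* v)) ≈-refl
        (q^ suc i) (q^ (suc i ℕ.* (suc i ℕ.+ m))) (Q (suc i)) (Q (suc (suc i ℕ.+ m))))

  A-M̄ : ∀ m → A m ≈ q^ suc m * M̄ (suc m)
  A-M̄ m = ≈-trans (∑-cong λ i → ≈-trans (*-cong (≈-trans (q^-cong (solveℕ 2 (λ i m → i ⊗ (i ⊕ m) ⊕ (conℕ 1 ⊕ (i ⊕ m))
        :≡ (conℕ 1 ⊕ m) ⊕ i ⊗ (i ⊕ (conℕ 1 ⊕ m))) refl i m)) (q^-+ (suc m) _))
      (*-cong ≈-refl (≈-reflexive (cong Q (sym (ℕₚ.+-suc i m)))))) (*-assoc _ _ _)) (∑-* _ _)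

  A≼B : ∀ m → A m ≼ B (suc m)
  A≼B m = nn-resp (≈-trans (+-cong (∑-* (q^ suc m) _) (-‿cong (A-M̄ m)))
      (≈-trans (solve 5 (λ x n k b a → x :* n :- x :* k := x :* ((n :+ b) :- (k :+ a) :+ (a :- b))) ≈-refl
        (q^ suc m) (N̄ (suc m)) (M̄ (suc m)) (B (suc (suc (suc (suc m))))) (A (suc m)))
      (*-cong ≈-refl (≈-trans (+-cong (≈-trans (+-cong (N̄-Π m) (-‿cong (M̄-Π m))) (-‿inverseʳ _)) ≈-refl) (+-identityˡ _)))))
    (nn-* (nn-q^ (suc m)) (≼-trans (B-decreasing (suc (suc (suc m)))) (B≼A (suc m))))

-- Counting partitions, and the rank series

module Counting where
  open PowerSeries
  open GaussianBinomials
  open Comparison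
  open Solver using (solve; _:=_; _:+_; _:-_)

  indicator : Bool → ℤ
  indicator true  = 1ℤ
  indicator false = 0ℤ

  count : ∀ {A : Set} → (A → Bool) → List A → ℤ
  count P []       = 0ℤ
  count P (x ∷ xs) = indicator (P x) ℤ.+ count P xs

  count-++ : ∀ {A : Set} (P : A → Bool) xs ys → count P (xs ++ ys) ≡ count P xs ℤ.+ count P ys
  count-++ P []       ys = sym (ℤₚ.+-identityˡ _)
  count-++ P (x ∷ xs) ys = trans (cong (ℤ._+_ (indicator (P x))) (count-++ P xs ys)) (sym (ℤₚ.+-assoc (indicator (P x)) _ _))

  count-map : ∀ {A B : Set} (P : B → Bool) (f : A → B) xs → count P (map f xs) ≡ count (λ x → P (f x)) xs
  count-map P f []       = refl
  count-map P f (x ∷ xs) = cong (ℤ._+_ (indicator (P (f x)))) (count-map P f xs)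

  count-cong : ∀ {A : Set} {P P′ : A → Bool} {xs} → All (λ x → P x ≡ P′ x) xs → count P xs ≡ count P′ xs
  count-cong []       = refl
  count-cong (p ∷ ps) = cong₂ ℤ._+_ (cong indicator p) (count-cong ps)

  Predicate : Set
  Predicate = List ℕ → Bool

  bounded : ℕ → ℕ → List (List ℕ)
  bounded k n = partitionsBelow n k n

  private
    fuel-irrelevant : ∀ f f′ k n → n ℕ.≤ f → n ℕ.≤ f′ → partitionsBelow f k n ≡ partitionsBelow f′ k n
    fuel-irrelevant f       f′       k zero    _          _           = refl
    fuel-irrelevant (suc f) (suc f′) k (suc n) (s≤s n≤f) (s≤s n≤f′) =
      concatMap-cong (λ i → cong (map (suc i ∷_)) (fuel-irrelevant f f′ (suc i) (n ℕ.∸ i)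
        (ℕₚ.≤-trans (ℕₚ.m∸n≤m n i) n≤f) (ℕₚ.≤-trans (ℕₚ.m∸n≤m n i) n≤f′))) (upTo (k ℕ.⊓ suc n))

  bounded-stable : ∀ k n → n ℕ.≤ k → bounded (suc k) n ≡ bounded k n
  bounded-stable k zero    _   = refl
  bounded-stable k (suc n) n<k = cong (λ j → concatMap (λ i → map (suc i ∷_) (partitionsBelow n (suc i) (n ℕ.∸ i))) (upTo j))
    (trans (ℕₚ.m≥n⇒m⊓n≡n (ℕₚ.m≤n⇒m≤1+n n<k)) (sym (ℕₚ.m≥n⇒m⊓n≡n n<k)))

  bounded-suc : ∀ k d → bounded (suc k) (suc k ℕ.+ d) ≡ bounded k (suc k ℕ.+ d) ++ map (suc k ∷_) (bounded (suc k) d)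
  bounded-suc k d = trans
    (cong (concatMap pick) (trans (cong upTo (cong suc (ℕₚ.m≤n⇒m⊓n≡m (ℕₚ.m≤m+n k d)))) (sym (upTo-∷ʳ k))))
    (trans (concatMap-++ pick (upTo k) (k ∷ []))
    (cong₂ _++_
      (cong (λ j → concatMap pick (upTo j)) (sym (ℕₚ.m≤n⇒m⊓n≡m (ℕₚ.m≤n⇒m≤1+n (ℕₚ.m≤m+n k d)))))
      (trans (++-identityʳ _) (cong (map (suc k ∷_)) (trans (cong (partitionsBelow (k ℕ.+ d) (suc k)) (ℕₚ.m+n∸m≡n k d))
        (fuel-irrelevant (k ℕ.+ d) d (suc k) d (ℕₚ.m≤n+m d k) ℕₚ.≤-refl))))))
    where
    pick : ℕ → List (List ℕ)
    pick i = map (suc i ∷_) (partitionsBelow (k ℕ.+ d) (suc i) (k ℕ.+ d ℕ.∸ i))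

  bounded-partitions : ∀ d n → bounded (d ℕ.+ n) n ≡ partitions n
  bounded-partitions zero    n = refl
  bounded-partitions (suc d) n = trans (bounded-stable (d ℕ.+ n) n (ℕₚ.m≤n+m n d)) (bounded-partitions d n)

  -- The generating function of the partitions satisfying P with all parts at most k. The bound k
  -- makes `gf-suc` available as a recursion.
  gf : Predicate → ℕ → Series
  gf P k n = count P (bounded k n)

  below-≤ : ∀ fuel k n → All (All (ℕ._≤ k)) (partitionsBelow fuel k n)
  below-≤ zero       k zero    = [] ∷ []
  below-≤ (suc fuel) k zero    = [] ∷ []
  below-≤ zero       k (suc n) = []
  below-≤ (suc fuel) k (suc n) = Allₚ.concat⁺ (Allₚ.map⁺ (All.map block (Allₚ.all-upTo (k ℕ.⊓ suc n))))
    where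
    block : ∀ {i} → i ℕ.< k ℕ.⊓ suc n → All (All (ℕ._≤ k)) (map (suc i ∷_) (partitionsBelow fuel (suc i) (n ℕ.∸ i)))
    block {i} i< = Allₚ.map⁺ (All.map (λ ps≤i → i<k ∷ All.map (λ p≤i → ℕₚ.≤-trans p≤i i<k) ps≤i) (below-≤ fuel (suc i) (n ℕ.∸ i)))
      where
      i<k : suc i ℕ.≤ k
      i<k = ℕₚ.≤-trans i< (ℕₚ.m⊓n≤m k (suc n))

  gf-cong : ∀ {P P′} k → (∀ ps → All (ℕ._≤ k) ps → P ps ≡ P′ ps) → gf P k ≈ gf P′ k
  gf-cong k p = pointwise λ n → count-cong (All.map (p _) (below-≤ n k n))

  count-false : ∀ {A : Set} (xs : List A) → count (λ _ → false) xs ≡ 0ℤ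
  count-false []       = refl
  count-false (x ∷ xs) = trans (ℤₚ.+-identityˡ _) (count-false xs)

  gf-false : ∀ k → gf (λ _ → false) k ≈ 0#
  gf-false k = pointwise λ n → trans (count-false (bounded k n)) (sym (0#-coeff n))

  gf-zero : ∀ P → gf P 0 ≈ constant (indicator (P []))
  gf-zero P = pointwise λ
    { zero    → trans (ℤₚ.+-identityʳ _) (sym (constant-zero _))
    ; (suc n) → sym (constant-suc _ n)
    }

  gf-suc : ∀ P k → gf P (suc k) ≈ gf P k + q^ suc k * gf (λ ps → P (suc k ∷ ps)) (suc k)
  gf-suc P k = pointwise λ n → trans (split n) (sym (+-coeff (gf P k) (q^ suc k * f) n))
    where
    f : Series
    f = gf (λ ps → P (suc k ∷ ps)) (suc k)
    split : ∀ n → gf P (suc k) n ≡ gf P k n ℤ.+ (q^ suc k * f) n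
    split n with suc k ℕ.≤? n
    ... | no  k≮n = trans (cong (count P) (bounded-stable k n (ℕₚ.≤-pred (ℕₚ.≰⇒> k≮n))))
      (sym (trans (cong (ℤ._+_ (gf P k n)) (q^*-below (suc k) f (ℕₚ.≰⇒> k≮n))) (ℤₚ.+-identityʳ _)))
    ... | yes k<n = subst (λ n → gf P (suc k) n ≡ gf P k n ℤ.+ (q^ suc k * f) n) (ℕₚ.m+[n∸m]≡n k<n) (above (n ℕ.∸ suc k))
      where
      above : ∀ d → gf P (suc k) (suc k ℕ.+ d) ≡ gf P k (suc k ℕ.+ d) ℤ.+ (q^ suc k * f) (suc k ℕ.+ d)
      above d = trans (cong (count P) (bounded-suc k d)) (trans (count-++ P (bounded k (suc k ℕ.+ d)) _)
        (cong (ℤ._+_ (gf P k (suc k ℕ.+ d))) (trans (count-map P (suc k ∷_) (bounded (suc k) d)) (sym (q^*-above (suc k) f d)))))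

  gf-suc-false : ∀ {P} k → (∀ ps → All (ℕ._≤ suc k) ps → P (suc k ∷ ps) ≡ false) → gf P (suc k) ≈ gf P k
  gf-suc-false {P} k p = ≈-trans (gf-suc P k) (≈-trans
    (+-cong ≈-refl (≈-trans (*-cong ≈-refl (≈-trans (gf-cong (suc k) p) (gf-false (suc k)))) (zeroʳ _))) (+-identityʳ _))

  atMost : ℕ → Predicate
  atMost L ps = length ps ℕ.<ᵇ suc L

  gf-atMost : ∀ k L → gf (atMost L) k ≈ G k L
  gf-atMost zero    L       = gf-zero (atMost L)
  gf-atMost (suc k) zero    = ≈-trans (gf-suc-false k λ _ _ → refl) (≈-trans (gf-atMost k 0) (G-zeroʳ k))
  gf-atMost (suc k) (suc L) = ≈-trans (gf-suc (atMost (suc L)) k) (+-cong (gf-atMost k (suc L)) (*-cong ≈-refl (gf-atMost (suc k) L)))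

  largestPart-≤ : ∀ {k ps} → All (ℕ._≤ k) ps → largestPart ps ℕ.≤ k
  largestPart-≤ []           = z≤n
  largestPart-≤ (p≤k ∷ ps≤k) = ℕₚ.⊔-lub p≤k (largestPart-≤ ps≤k)

  largestPart-∷ : ∀ {k ps} → All (ℕ._≤ k) ps → largestPart (k ∷ ps) ≡ k
  largestPart-∷ ps≤k = ℕₚ.m≥n⇒m⊔n≡m (largestPart-≤ ps≤k)

  -- Rank greater than c - 2.
  rankAbove : ℕ → Predicate
  rankAbove c ps = c ℕ.+ length ps ℕ.<ᵇ suc (suc (largestPart ps))

  rankAbove-∷ : ∀ c k ps → All (ℕ._≤ suc k) ps → rankAbove c (suc k ∷ ps) ≡ (c ℕ.+ length ps ℕ.<ᵇ suc (suc k))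
  rankAbove-∷ c k ps ps≤k = cong₂ (λ a b → a ℕ.<ᵇ suc (suc b)) (ℕₚ.+-suc c (length ps)) (largestPart-∷ ps≤k)

  -- A nonempty partition with parts at most c has rank at most c - 1, so only the empty partition
  -- can be counted.
  gf-rankAbove-small : ∀ c k → k ℕ.≤ c → gf (rankAbove (suc c)) k ≈ constant (indicator (rankAbove (suc c) []))
  gf-rankAbove-small c zero    _   = gf-zero _
  gf-rankAbove-small c (suc k) k<c = ≈-trans
    (gf-suc-false k λ ps ps≤k → trans (rankAbove-∷ (suc c) k ps ps≤k)
      (dec-false (suc c ℕ.+ length ps ℕ.<? suc (suc k)) (ℕₚ.≤⇒≯ (s≤s (ℕₚ.≤-trans k<c (ℕₚ.m≤m+n c (length ps)))))))
    (gf-rankAbove-small c k (ℕₚ.<⇒≤ k<c))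

  gf-rankAbove-suc : ∀ c k → gf (rankAbove (suc c)) (k ℕ.+ suc c) ≈ gf (rankAbove (suc c)) (k ℕ.+ c) + q^ (k ℕ.+ suc c) * G (k ℕ.+ suc c) k
  gf-rankAbove-suc c k = subst (λ n → gf (rankAbove (suc c)) n ≈ gf (rankAbove (suc c)) (k ℕ.+ c) + q^ n * G n k) (sym (ℕₚ.+-suc k c))
    (≈-trans (gf-suc _ (k ℕ.+ c)) (+-cong ≈-refl (*-cong ≈-refl (≈-trans (gf-cong (suc (k ℕ.+ c)) λ ps ps≤k →
        trans (rankAbove-∷ (suc c) (k ℕ.+ c) ps ps≤k) (shift ps)) (gf-atMost (suc (k ℕ.+ c)) k)))))
    where
    shift : ∀ ps → (suc c ℕ.+ length ps ℕ.<ᵇ suc (suc (k ℕ.+ c))) ≡ (length ps ℕ.<ᵇ suc k)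
    shift ps = does-⇔ (mk⇔
      (λ p → s≤s (ℕₚ.+-cancelˡ-≤ c _ _ (subst (c ℕ.+ length ps ℕ.≤_) (ℕₚ.+-comm k c) (ℕₚ.≤-pred (ℕₚ.≤-pred p)))))
      (λ p → s≤s (s≤s (subst (c ℕ.+ length ps ℕ.≤_) (ℕₚ.+-comm c k) (ℕₚ.+-monoʳ-≤ c (ℕₚ.≤-pred p))))))
      (suc c ℕ.+ length ps ℕ.<? suc (suc (k ℕ.+ c))) (length ps ℕ.<? suc k)

  B-counts : ∀ c n → count (rankAbove (suc c)) (partitions (suc n)) ≡ B (suc c) (suc n)
  B-counts c n = trans (cong (count (rankAbove (suc c))) (sym (trans (cong (λ k → bounded k (suc n)) (ℕₚ.+-comm (suc n) (suc c))) (bounded-partitions (suc c) (suc n)))))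
    (sym (trans (+q^-below (suc (suc n)) (∑-partial u h base step (suc n)) ℕₚ.≤-refl)
      (trans (sub-coeff (gf R (suc n ℕ.+ suc c)) _ (suc n)) (trans (cong (λ z → gf R (suc n ℕ.+ suc c) (suc n) ℤ.- z) (constant-suc _ n))
        (ℤₚ.+-identityʳ _)))))
    where
    R : Predicate
    R = rankAbove (suc c)
    u h : ℕ → Series
    u k = q^ suc c * G (k ℕ.+ suc c) k
    -- The empty partition is taken out because `B` does not count it; the coefficients of positive
    -- index are not affected.
    h k = gf R (k ℕ.+ suc c) - constant (indicator (R []))
    base : h 0 ≈ u 0
    base = ≈-trans (+-cong (≈-trans (gf-rankAbove-suc c 0) (+-cong (gf-rankAbove-small c c ℕₚ.≤-refl) ≈-refl)) ≈-refl)
      (solve 2 (λ d f → d :+ f :- d := f) ≈-refl (constant (indicator (R []))) _)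
    step : ∀ k → h (suc k) ≈ h k + q^ suc k * u (suc k)
    step k = ≈-trans (+-cong (≈-trans (gf-rankAbove-suc c (suc k))
        (+-cong (≈-reflexive (cong (gf R) (sym (ℕₚ.+-suc k c)))) (≈-trans (*-cong (q^-+ (suc k) (suc c)) ≈-refl) (*-assoc _ _ _)))) ≈-refl)
      (solve 3 (λ g f d → g :+ f :- d := g :- d :+ f) ≈-refl (gf R (k ℕ.+ suc c)) _ _)

-- The crank series

module CrankCounting where
  open PowerSeries
  open GaussianBinomials
  open Decomposition
  open Comparison
  open Counting
  open Solver using (solve; _:=_; _:+_; _:*_; _:-_; con)
  open NatSolver.+-*-Solver using () renaming (solve to solveℕ; _:=_ to _:≡_; _:+_ to _⊕_; _:*_ to _⊗_; con to conℕ)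

  -- For t ≥ 1, (1 - q) q ^ ω X t κ L counts the partitions with ω ones, all parts at most
  -- κ + t and at least L parts larger than t.
  X : ℕ → ℕ → ℕ → Series
  X t κ       zero    = Q (κ ℕ.+ t)
  X t zero    (suc L) = 0#
  X t (suc κ) (suc L) = X t κ (suc L) + q^ suc (κ ℕ.+ t) * X t (suc κ) L

  X-one : ∀ t κ → X t κ 1 ≈ Q (κ ℕ.+ t) - Q t
  X-one t zero    = ≈-sym (-‿inverseʳ (Q t))
  X-one t (suc κ) = ≈-trans (+-cong (≈-trans (X-one t κ) (+-cong (≈-sym (Q-step (κ ℕ.+ t))) ≈-refl)) ≈-refl)
    (solve 3 (λ x s t → (con 1ℤ :- x) :* s :- t :+ x :* s := s :- t) ≈-refl (q^ suc (κ ℕ.+ t)) (Q (suc (κ ℕ.+ t))) (Q t))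

  X-zero : ∀ κ L → X 0 κ (suc L) ≈ Q κ - G κ L
  X-zero zero    L       = ≈-sym (-‿inverseʳ 1#)
  X-zero (suc κ) zero    = ≈-trans (X-one 0 (suc κ)) (+-cong (≈-reflexive (cong (λ k → Q (suc k)) (ℕₚ.+-identityʳ κ))) ≈-refl)
  X-zero (suc κ) (suc L) = ≈-trans
    (+-cong (≈-trans (X-zero κ (suc L)) (+-cong (≈-sym (Q-step κ)) ≈-refl))
      (*-cong (q^-cong (cong suc (ℕₚ.+-identityʳ κ))) (X-zero (suc κ) L)))
    (solve 4 (λ x s g h → (con 1ℤ :- x) :* s :- g :+ x :* (s :- h) := s :- (g :+ x :* h)) ≈-refl
      (q^ suc κ) (Q (suc κ)) (G κ (suc L)) (G (suc κ) L))

  -- Splitting off the parts equal to t + 1.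
  X-shift : ∀ t κ L → X t (suc κ) L ≈ q^ (L ℕ.* suc t) * (Q (suc t) * G κ L) + X (suc t) κ (suc L)
  X-shift t zero    zero    = solve 1 (λ s → s := con 1ℤ :* (s :* con 1ℤ) :+ con 0ℤ) ≈-refl (Q (suc t))
  X-shift t zero    (suc L) = ≈-trans (+-cong ≈-refl (*-cong ≈-refl (X-shift t zero L)))
    (≈-trans (solve 3 (λ x y s → con 0ℤ :+ x :* (y :* (s :* con 1ℤ) :+ con 0ℤ) := x :* y :* (s :* con 1ℤ) :+ con 0ℤ) ≈-refl
      (q^ suc t) (q^ (L ℕ.* suc t)) (Q (suc t)))
    (+-cong (*-cong (≈-sym (q^-+ (suc t) (L ℕ.* suc t))) ≈-refl) ≈-refl))
  X-shift t (suc κ) zero    = ≈-trans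
    (≈-trans (≈-reflexive (cong (λ k → Q (suc k)) (sym (ℕₚ.+-suc κ t))))
      (solve 2 (λ a b → a := con 1ℤ :* (b :* con 1ℤ) :+ (a :- b)) ≈-refl (Q (suc κ ℕ.+ suc t)) (Q (suc t))))
    (+-cong ≈-refl (≈-sym (X-one (suc t) (suc κ))))
  X-shift t (suc κ) (suc L) = ≈-trans (+-cong (X-shift t κ (suc L)) (*-cong power (X-shift t (suc κ) L)))
    (≈-trans (+-cong (+-cong (*-cong (q^-+ (suc t) (L ℕ.* suc t)) ≈-refl) ≈-refl) ≈-refl)
    (≈-trans (solve 8 (λ x y z s g h u v → (x :* y :* (s :* g) :+ u) :+ z :* x :* (y :* (s :* h) :+ v)
        := x :* y :* (s :* (g :+ z :* h)) :+ (u :+ (z :* x) :* v)) ≈-refl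
      (q^ suc t) (q^ (L ℕ.* suc t)) (q^ suc κ) (Q (suc t)) (G κ (suc L)) (G (suc κ) L) (X (suc t) κ (suc (suc L))) (X (suc t) (suc κ) (suc L)))
    (+-cong (*-cong (≈-sym (q^-+ (suc t) (L ℕ.* suc t))) ≈-refl) (+-cong ≈-refl (*-cong (≈-sym (q^-+ (suc κ) (suc t))) ≈-refl)))))
    where
    power : q^ suc (suc κ ℕ.+ t) ≈ q^ suc κ * q^ suc t
    power = ≈-trans (q^-cong (cong suc (sym (ℕₚ.+-suc κ t)))) (q^-+ (suc κ) (suc t))

  -- Abel summation.
  antidiagonal-abel : ∀ n x (v : ℕ → ℕ → Series) → (∀ i → v i 0 ≈ 0#) →
    antidiagonal (λ i l → (1# - x * q^ suc i) * (v i (suc l) - v (suc i) l)) n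
      ≈ (1# - x) * v 0 (suc n) + (1# - q) * (x * antidiagonal (λ i l → q^ i * v i (suc l)) n)
  antidiagonal-abel zero    x v v0 = ≈-trans (*-cong ≈-refl (+-cong ≈-refl (-‿cong (v0 1))))
    (solve 3 (λ x q v → (con 1ℤ :- x :* (q :* con 1ℤ)) :* (v :- con 0ℤ) := (con 1ℤ :- x) :* v :+ (con 1ℤ :- q) :* (x :* (con 1ℤ :* v)))
      ≈-refl x q (v 0 1))
  antidiagonal-abel (suc n) x v v0 = ≈-trans (+-cong ≈-refl (≈-trans
      (antidiagonal-cong n λ i l _ → *-cong (+-cong ≈-refl (-‿cong (≈-sym (*-assoc x q (q^ suc i))))) ≈-refl)
      (antidiagonal-abel n (x * q) (λ i → v (suc i)) (λ i → v0 (suc i)))))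
    (≈-trans (solve 5 (λ x q v w a → (con 1ℤ :- x :* (q :* con 1ℤ)) :* (v :- w) :+ ((con 1ℤ :- x :* q) :* w :+ (con 1ℤ :- q) :* (x :* q :* a))
        := (con 1ℤ :- x) :* v :+ (con 1ℤ :- q) :* (x :* (con 1ℤ :* v :+ q :* a)))
      ≈-refl x q (v 0 (suc (suc n))) (v 1 (suc n)) (antidiagonal (λ i l → q^ i * v (suc i) (suc l)) n))
    (+-cong ≈-refl (*-cong ≈-refl (*-cong ≈-refl (+-cong ≈-refl (≈-trans (≈-sym (antidiagonal-* n q _))
      (antidiagonal-cong n λ i l _ → ≈-sym (*-assoc q (q^ i) _))))))))

  -- The index i is the number of ones and i + l + 1 a common bound on the parts. By `Q-step` and
  -- `X-shift` the truncated i-th term of `A` is 1 - q^(i+1) times a difference of adjacent `X`. In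
  -- `antidiagonal-abel` with x = 1 the boundary term vanishes and the factor 1 - q comes out.
  A-antidiagonal : ∀ m n → A m ≈[ suc n ] (1# - q) * antidiagonal (λ i l → q^ i * X i (suc l) (suc (i ℕ.+ m))) n
  A-antidiagonal m n {k} k<n = trans (antidiagonal-row n _ k<n) (trans (antidiagonal-below (suc n) n term k<n) (coeff abel k))
    where
    v : ℕ → ℕ → Series
    v i l = X i l (suc (i ℕ.+ m))
    term : ∀ i l → i ℕ.+ l ≡ n → q^ i * (q^ e m i * (Q i * Q (suc (i ℕ.+ m))))
      ≈[ suc n ] q^ (suc (i ℕ.+ m) ℕ.* suc i) * (Q i * G l (suc (i ℕ.+ m)))
    term i l eq {k} k<n = trans (coeff (≈-trans (≈-sym (*-assoc _ _ _)) (*-cong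
        (≈-trans (≈-sym (q^-+ i (e m i))) (q^-cong (solveℕ 2 (λ i m → i ⊕ (i ⊗ (i ⊕ m) ⊕ (conℕ 1 ⊕ (i ⊕ m)))
          :≡ (conℕ 1 ⊕ (i ⊕ m)) ⊗ (conℕ 1 ⊕ i)) refl i m))) ≈-refl)) k)
      (≈[]-q^* (suc (i ℕ.+ m) ℕ.* suc i)
        (λ r → ≈[]-*ʳ (Q i) (λ {k} r → sym (trans (coeff (G-comm l (suc (i ℕ.+ m))) k) (G≈Q (suc (i ℕ.+ m)) l r))) r)
        (ℕₚ.≤-trans k<n (subst (ℕ._≤ suc (i ℕ.+ m) ℕ.* suc i ℕ.+ suc l) (trans (ℕₚ.+-suc i l) (cong suc eq))
          (ℕₚ.+-monoˡ-≤ (suc l) (ℕₚ.≤-trans (ℕₚ.n≤1+n i) (ℕₚ.m≤m+n (suc i) _))))))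
    abel : antidiagonal (λ i l → q^ (suc (i ℕ.+ m) ℕ.* suc i) * (Q i * G l (suc (i ℕ.+ m)))) n
      ≈ (1# - q) * antidiagonal (λ i l → q^ i * v i (suc l)) n
    abel = ≈-trans (antidiagonal-cong n λ i l _ → ≈-trans
        (≈-trans (*-cong ≈-refl (*-cong (≈-sym (Q-step i)) ≈-refl))
          (solve 5 (λ y x s g w → y :* (((con 1ℤ :- x) :* s) :* g) := (con 1ℤ :- con 1ℤ :* x) :* ((y :* (s :* g) :+ w) :- w)) ≈-refl
            (q^ (suc (i ℕ.+ m) ℕ.* suc i)) (q^ suc i) (Q (suc i)) (G l (suc (i ℕ.+ m))) (v (suc i) l)))
        (*-cong ≈-refl (+-cong (≈-sym (X-shift i l (suc (i ℕ.+ m)))) ≈-refl)))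
      (≈-trans (antidiagonal-abel n 1# v (λ _ → ≈-refl))
        (solve 3 (λ v q a → (con 1ℤ :- con 1ℤ) :* v :+ (con 1ℤ :- q) :* (con 1ℤ :* a) := (con 1ℤ :- q) :* a) ≈-refl (v 0 (suc n)) q _))

  hasOnes : ℕ → Predicate
  hasOnes ω ps = ones ps ℕ.≡ᵇ ω

  gf-hasOnes : ∀ ω k → gf (hasOnes ω) (suc k) ≈ q^ ω * ((1# - q) * Q (suc k))
  gf-hasOnes zero    zero = ≈-trans (gf-suc-false 0 λ _ _ → refl) (≈-trans (gf-zero (hasOnes 0))
    (≈-trans (≈-sym (Q-step 0)) (solve 2 (λ q s → (con 1ℤ :- q :* con 1ℤ) :* s := con 1ℤ :* ((con 1ℤ :- q) :* s)) ≈-refl q (Q 1))))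
  gf-hasOnes (suc ω) zero = ≈-trans (gf-suc (hasOnes (suc ω)) 0)
    (≈-trans (+-cong (gf-zero (hasOnes (suc ω))) (*-cong ≈-refl (gf-hasOnes ω 0)))
    (solve 3 (λ q x s → con 0ℤ :+ (q :* con 1ℤ) :* (x :* s) := (q :* x) :* s) ≈-refl q (q^ ω) ((1# - q) * Q 1)))
  -- Removing a largest part leaves the same series on both sides of the recursion; `cancel` solves
  -- it.
  gf-hasOnes ω (suc k) = cancel (suc k) (≈-trans
    (≈-trans (solve 2 (λ x f → (con 1ℤ :- x) :* f := f :- x :* f) ≈-refl (q^ suc (suc k)) (gf (hasOnes ω) (suc (suc k))))
      (+-cong (≈-trans (gf-suc (hasOnes ω) (suc k)) (+-cong (≈-trans (gf-hasOnes ω k) (*-cong ≈-refl (*-cong ≈-refl (≈-sym (Q-step (suc k)))))) ≈-refl)) ≈-refl))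
    (solve 5 (λ y o q s f → o :* ((con 1ℤ :- q) :* ((con 1ℤ :- y) :* s)) :+ y :* f :- y :* f := (con 1ℤ :- y) :* (o :* ((con 1ℤ :- q) :* s))) ≈-refl
      (q^ suc (suc k)) (q^ ω) q (Q (suc (suc k))) (gf (hasOnes ω) (suc (suc k)))))

  hasOnesAndLarger : ℕ → ℕ → ℕ → Predicate
  hasOnesAndLarger ω t L ps = hasOnes ω ps ∧ (L ℕ.<ᵇ suc (partsLargerThan t ps))

  partsLargerThan-bounded : ∀ {t ps} → All (ℕ._≤ t) ps → partsLargerThan t ps ≡ 0
  partsLargerThan-bounded {t} ps≤t = cong length (filter-none (t ℕ.<?_) (All.map ℕₚ.≤⇒≯ ps≤t))

  partsLargerThan-∷ : ∀ {t p} ps → t ℕ.< p → partsLargerThan t (p ∷ ps) ≡ suc (partsLargerThan t ps)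
  partsLargerThan-∷ {t} ps t<p = cong length (filter-accept (t ℕ.<?_) t<p)

  gf-hasOnesAndLarger : ∀ ω t κ L → gf (hasOnesAndLarger ω (suc t) L) (κ ℕ.+ suc t) ≈ q^ ω * ((1# - q) * X (suc t) κ L)
  gf-hasOnesAndLarger ω t κ zero = ≈-trans (gf-cong (κ ℕ.+ suc t) λ ps _ → ∧-identityʳ (hasOnes ω ps))
    (subst (λ k → gf (hasOnes ω) k ≈ q^ ω * ((1# - q) * Q k)) (sym (ℕₚ.+-suc κ t)) (gf-hasOnes ω (κ ℕ.+ t)))
  gf-hasOnesAndLarger ω t zero (suc L) = ≈-trans
    (gf-cong (suc t) λ ps ps≤t → trans (cong (λ x → hasOnes ω ps ∧ (suc L ℕ.<ᵇ suc x)) (partsLargerThan-bounded ps≤t)) (∧-zeroʳ _))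
    (≈-trans (gf-false (suc t)) (solve 2 (λ x y → con 0ℤ := x :* (y :* con 0ℤ)) ≈-refl (q^ ω) (1# - q)))
  gf-hasOnesAndLarger ω t (suc κ) (suc L) = ≈-trans (gf-suc _ (κ ℕ.+ suc t))
    (≈-trans (+-cong (gf-hasOnesAndLarger ω t κ (suc L)) (*-cong ≈-refl (≈-trans
        (gf-cong (suc (κ ℕ.+ suc t)) λ ps _ → cong₂ (λ x y → (x ℕ.≡ᵇ ω) ∧ (suc L ℕ.<ᵇ suc y))
          (ones-∷ ps) (partsLargerThan-∷ {p = suc (κ ℕ.+ suc t)} ps (s≤s (ℕₚ.m≤n+m (suc t) κ))))
        (gf-hasOnesAndLarger ω t (suc κ) L))))
    (solve 5 (λ o y z u v → o :* (y :* u) :+ z :* (o :* (y :* v)) := o :* (y :* (u :+ z :* v))) ≈-refl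
      (q^ ω) (1# - q) (q^ suc (κ ℕ.+ suc t)) (X (suc t) κ (suc L)) (X (suc t) (suc κ) L)))
    where
    ones-∷ : ∀ ps → ones (suc (κ ℕ.+ suc t) ∷ ps) ≡ ones ps
    ones-∷ ps rewrite ℕₚ.+-suc κ t = refl

  largerThan : ℕ → Predicate
  largerThan m ps = hasOnes 0 ps ∧ (m ℕ.<ᵇ largestPart ps)

  gf-largerThan : ∀ m κ → gf (largerThan m) (κ ℕ.+ m) ≈ gf (hasOnes 0) (κ ℕ.+ m) - gf (hasOnes 0) m
  gf-largerThan m zero    = ≈-trans (≈-trans (gf-cong m λ ps ps≤m → trans (cong (hasOnes 0 ps ∧_)
      (dec-false (m ℕ.<? largestPart ps) (ℕₚ.≤⇒≯ (largestPart-≤ ps≤m)))) (∧-zeroʳ _)) (gf-false m)) (≈-sym (-‿inverseʳ _))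
  gf-largerThan m (suc κ) = ≈-trans (gf-suc _ (κ ℕ.+ m))
    (≈-trans (+-cong (gf-largerThan m κ) (*-cong ≈-refl (gf-cong (suc (κ ℕ.+ m)) λ ps ps≤k →
      trans (cong (hasOnes 0 (suc (κ ℕ.+ m) ∷ ps) ∧_)
        (trans (cong (m ℕ.<ᵇ_) (largestPart-∷ ps≤k)) (dec-true (m ℕ.<? suc (κ ℕ.+ m)) (s≤s (ℕₚ.m≤n+m m κ))))) (∧-identityʳ _))))
    (≈-trans (solve 3 (λ a b c → a :- b :+ c := a :+ c :- b) ≈-refl (gf (hasOnes 0) (κ ℕ.+ m)) (gf (hasOnes 0) m) _)
      (+-cong (≈-sym (gf-suc (hasOnes 0) (κ ℕ.+ m))) ≈-refl)))

  sumTo : (ℕ → ℤ) → ℕ → ℤ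
  sumTo f zero    = f 0
  sumTo f (suc n) = f 0 ℤ.+ sumTo (λ i → f (suc i)) n

  sumTo-cong : ∀ {f g} → (∀ i → f i ≡ g i) → ∀ n → sumTo f n ≡ sumTo g n
  sumTo-cong p zero    = p 0
  sumTo-cong p (suc n) = cong₂ ℤ._+_ (p 0) (sumTo-cong (λ i → p (suc i)) n)

  sumTo-0 : ∀ n → sumTo (λ _ → 0ℤ) n ≡ 0ℤ
  sumTo-0 zero    = refl
  sumTo-0 (suc n) = trans (ℤₚ.+-identityˡ _) (sumTo-0 n)

  sumTo-+ : ∀ f g n → sumTo (λ i → f i ℤ.+ g i) n ≡ sumTo f n ℤ.+ sumTo g n
  sumTo-+ f g zero    = refl
  sumTo-+ f g (suc n) = trans (cong (ℤ._+_ (f 0 ℤ.+ g 0)) (sumTo-+ (λ i → f (suc i)) (λ i → g (suc i)) n))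
    (+-*-Solver.solve 4 (λ a b c d → (a +-*-Solver.:+ b) +-*-Solver.:+ (c +-*-Solver.:+ d)
      +-*-Solver.:= (a +-*-Solver.:+ c) +-*-Solver.:+ (b +-*-Solver.:+ d)) refl (f 0) (g 0) _ _)

  antidiagonal-sumTo : ∀ (f : ℕ → Series) n k → antidiagonal (λ i _ → f i) n k ≡ sumTo (λ i → f i k) n
  antidiagonal-sumTo f zero    k = refl
  antidiagonal-sumTo f (suc n) k = trans (+-coeff _ _ k) (cong (ℤ._+_ (f 0 k)) (antidiagonal-sumTo (λ i → f (suc i)) n k))

  sumTo-indicator : ∀ h n (c : ℕ → Bool) → h ℕ.≤ n → sumTo (λ i → indicator ((h ℕ.≡ᵇ i) ∧ c i)) n ≡ indicator (c h)
  sumTo-indicator zero    zero    c _         = refl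
  sumTo-indicator zero    (suc n) c _         = trans (cong (ℤ._+_ (indicator (c 0))) (sumTo-0 n)) (ℤₚ.+-identityʳ _)
  sumTo-indicator (suc h) (suc n) c (s≤s h≤n) = trans (ℤₚ.+-identityˡ _) (sumTo-indicator h n (λ i → c (suc i)) h≤n)

  sumTo-count : ∀ {A : Set} n (h : A → ℕ) (c : ℕ → A → Bool) {xs} → All (λ x → h x ℕ.≤ n) xs →
    sumTo (λ i → count (λ x → (h x ℕ.≡ᵇ i) ∧ c i x) xs) n ≡ count (λ x → c (h x) x) xs
  sumTo-count n h c []          = sumTo-0 n
  sumTo-count n h c (_∷_ {x} h≤n hs) = trans (sumTo-+ (λ i → indicator ((h x ℕ.≡ᵇ i) ∧ c i x)) _ n)
    (cong₂ ℤ._+_ (sumTo-indicator (h x) n (λ i → c i x) h≤n) (sumTo-count n h c hs))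

  -- The condition crank > m for a partition with ω ones.
  crankAbove : ℕ → ℕ → Predicate
  crankAbove m zero      ps = m ℕ.<ᵇ largestPart ps
  crankAbove m ω@(suc _) ps = suc (ω ℕ.+ m) ℕ.<ᵇ suc (partsLargerThan ω ps)

  difference-< : ∀ x y z w → does (+ x ℤ.- + y ℤ.<? + z ℤ.- + w) ≡ (x ℕ.+ w ℕ.<ᵇ y ℕ.+ z)
  difference-< x y z w = does-⇔ (mk⇔
      (λ p → ℤₚ.drop‿+<+ (subst₂ ℤ._<_ (up (+ x) (+ y) (+ w)) (up′ (+ y) (+ z) (+ w)) (ℤₚ.+-monoˡ-< (+ y ℤ.+ + w) p)))
      (λ p → subst₂ ℤ._<_ (down (+ x) (+ y) (+ w)) (down′ (+ y) (+ z) (+ w)) (ℤₚ.+-monoˡ-< (ℤ.- (+ y ℤ.+ + w)) (+<+ p))))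
    (+ x ℤ.- + y ℤ.<? + z ℤ.- + w) (x ℕ.+ w ℕ.<? y ℕ.+ z)
    where
    open +-*-Solver using () renaming (solve to solveℤ; _:=_ to _:≈_; _:+_ to _⊞_; _:-_ to _⊟_; :-_ to ⊟_)
    up : ∀ x y w → x ℤ.- y ℤ.+ (y ℤ.+ w) ≡ x ℤ.+ w
    up = solveℤ 3 (λ x y w → x ⊟ y ⊞ (y ⊞ w) :≈ x ⊞ w) refl
    up′ : ∀ y z w → z ℤ.- w ℤ.+ (y ℤ.+ w) ≡ y ℤ.+ z
    up′ = solveℤ 3 (λ y z w → z ⊟ w ⊞ (y ⊞ w) :≈ y ⊞ z) refl
    down : ∀ x y w → x ℤ.+ w ℤ.- (y ℤ.+ w) ≡ x ℤ.- y
    down = solveℤ 3 (λ x y w → x ⊞ w ⊟ (y ⊞ w) :≈ x ⊟ y) refl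
    down′ : ∀ y z w → y ℤ.+ z ℤ.- (y ℤ.+ w) ≡ z ℤ.- w
    down′ = solveℤ 3 (λ y z w → y ⊞ z ⊟ (y ⊞ w) :≈ z ⊟ w) refl

  difference-<₀ : ∀ x z w → does (+ x ℤ.<? + z ℤ.- + w) ≡ (x ℕ.+ w ℕ.<ᵇ z)
  difference-<₀ x z w = trans (cong (λ i → does (i ℤ.<? + z ℤ.- + w)) (sym (ℤₚ.+-identityʳ (+ x)))) (difference-< x 0 z w)

  crank-above : ∀ m ps → does (+ m ℤ.<? crank ps) ≡ crankAbove m (ones ps) ps
  crank-above m ps with ones ps
  ... | zero      = refl
  ... | ω@(suc _) = trans (difference-<₀ m (partsLargerThan ω ps) ω) (cong (ℕ._<ᵇ partsLargerThan ω ps) (ℕₚ.+-comm m ω))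

  ones-≤ : ∀ {n ps} → IsPartition n ps → ones ps ℕ.≤ n
  ones-≤ {n} {ps} isP = ℕₚ.≤-trans (length-filter (ℕ._≟ 1) ps) (subst (length ps ℕ.≤_) total (length≤sum positive))
    where
    open IsPartition isP
    length≤sum : ∀ {ps} → All (1 ℕ.≤_) ps → length ps ℕ.≤ sum ps
    length≤sum []       = z≤n
    length≤sum (p ∷ ps) = ℕₚ.+-mono-≤ p (length≤sum ps)

  private
    -- Below the truncation both sides are (1 - q) `Q m` when m > 0. For m = 0 they are 1 and 1 - q,
    -- which differ at q itself: this is the anomaly at n = 1.
    no-ones : ∀ m n k → suc n ℕ.≤ k → gf (hasOnes 0) m (suc (suc n)) ≡ ((1# - q) * G (suc k) m) (suc (suc n))
    no-ones zero n k _ = trans (coeff (gf-zero (hasOnes 0)) (suc (suc n))) (trans (constant-suc 1ℤ (suc n))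
      (sym (trans (coeff (solve 1 (λ q → (con 1ℤ :- q) :* con 1ℤ := con 1ℤ :+ q :* con -1ℤ) ≈-refl q) (suc (suc n)))
        (trans (+-coeff 1# (q * constant -1ℤ) (suc (suc n)))
          (cong₂ ℤ._+_ (constant-suc 1ℤ (suc n)) (trans (q*-suc (constant -1ℤ) (suc n)) (constant-suc -1ℤ n)))))))
    no-ones (suc m) n k n<k = trans (coeff (≈-trans (gf-hasOnes 0 m) (*-identityˡ _)) (suc (suc n)))
      (≈[]-*ʳ (1# - q) (λ {j} j<k → sym (trans (coeff (G-comm (suc k) (suc m)) j) (G≈Q (suc m) (suc k) j<k))) (s≤s (s≤s n<k)))

  -- The partitions are sorted by the number ω of ones. It runs to n + m and not only to n, so that
  -- the common bound n + m + 1 on the parts is at least m, as `gf-largerThan` requires.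
  A-counts : ∀ m n → count (λ ps → does (+ m ℤ.<? crank ps)) (partitions (suc (suc n))) ≡ A m (suc (suc n))
  A-counts m n′ = begin
    count (λ ps → does (+ m ℤ.<? crank ps)) (partitions n)
      ≡⟨ count-cong (All.universal (crank-above m) (partitions n)) ⟩
    count (λ ps → crankAbove m (ones ps) ps) (partitions n)
      ≡⟨ sumTo-count (n ℕ.+ m) ones (crankAbove m) (All.tabulate λ ps∈ → ℕₚ.≤-trans (ones-≤ (partitions-sound ps∈)) (ℕₚ.m≤m+n n m)) ⟨
    sumTo (λ ω → count (P ω) (partitions n)) (n ℕ.+ m)
      ≡⟨ sumTo-cong (λ ω → cong (count (P ω)) full) (n ℕ.+ m) ⟨
    sumTo (λ ω → gf (P ω) (suc (n ℕ.+ m)) n) (n ℕ.+ m)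
      ≡⟨ antidiagonal-sumTo (λ ω → gf (P ω) (suc (n ℕ.+ m))) (n ℕ.+ m) n ⟨
    antidiagonal (λ ω _ → gf (P ω) (suc (n ℕ.+ m))) (n ℕ.+ m) n
      ≡⟨ antidiagonal-coeff n (n ℕ.+ m) {λ ω _ → gf (P ω) (suc (n ℕ.+ m))} {λ ω l → (1# - q) * u ω l} term ⟩
    antidiagonal (λ ω l → (1# - q) * u ω l) (n ℕ.+ m) n
      ≡⟨ coeff (antidiagonal-* (n ℕ.+ m) (1# - q) u) n ⟩
    ((1# - q) * antidiagonal u (n ℕ.+ m)) n
      ≡⟨ A-antidiagonal m (n ℕ.+ m) (s≤s (ℕₚ.m≤m+n n m)) ⟨
    A m n ∎
    where
    open ≡-Reasoning
    n : ℕ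
    n = suc (suc n′)
    P : ℕ → Predicate
    P ω ps = hasOnes ω ps ∧ crankAbove m ω ps
    u : ℕ → ℕ → Series
    u ω l = q^ ω * X ω (suc l) (suc (ω ℕ.+ m))
    all : Series
    all = 1# * ((1# - q) * Q (suc (n ℕ.+ m)))
    full : bounded (suc (n ℕ.+ m)) n ≡ partitions n
    full = trans (cong (λ k → bounded (suc k) n) (ℕₚ.+-comm n m)) (bounded-partitions (suc m) n)
    term : ∀ ω l → ω ℕ.+ l ≡ n ℕ.+ m → gf (P ω) (suc (n ℕ.+ m)) n ≡ ((1# - q) * u ω l) n
    -- Without ones the crank is the largest part, whereas `X 0` is governed by the number of parts;
    -- `no-ones` passes between them by conjugation.
    term zero l refl = begin
      gf (largerThan m) (suc n ℕ.+ m) n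
        ≡⟨ coeff (≈-trans (gf-largerThan m (suc n)) (+-cong (gf-hasOnes 0 (n ℕ.+ m)) ≈-refl)) n ⟩
      (all - gf (hasOnes 0) m) n
        ≡⟨ sub-coeff all (gf (hasOnes 0) m) n ⟩
      all n ℤ.- gf (hasOnes 0) m n
        ≡⟨ cong (λ z → all n ℤ.- z) (no-ones m n′ (n ℕ.+ m) (ℕₚ.≤-trans (ℕₚ.n≤1+n _) (ℕₚ.m≤m+n n m))) ⟩
      all n ℤ.- ((1# - q) * G (suc (n ℕ.+ m)) m) n
        ≡⟨ sub-coeff all ((1# - q) * G (suc (n ℕ.+ m)) m) n ⟨
      (all - (1# - q) * G (suc (n ℕ.+ m)) m) n
        ≡⟨ coeff (≈-trans (solve 3 (λ y s g → con 1ℤ :* (y :* s) :- y :* g := y :* (con 1ℤ :* (s :- g))) ≈-refl (1# - q) _ _)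
             (*-cong ≈-refl (*-cong ≈-refl (≈-sym (X-zero (suc (n ℕ.+ m)) m))))) n ⟩
      ((1# - q) * (1# * X 0 (suc (n ℕ.+ m)) (suc m))) n ∎
    term (suc ω) l eq = coeff (≈-trans
      (subst (λ k → gf (P (suc ω)) (suc k) ≈ q^ suc ω * ((1# - q) * X (suc ω) (suc l) (suc (suc ω ℕ.+ m)))) (trans (ℕₚ.+-comm l (suc ω)) eq)
        (gf-hasOnesAndLarger (suc ω) ω (suc l) (suc (suc ω ℕ.+ m))))
      (solve 3 (λ o y u → o :* (y :* u) := y :* (o :* u)) ≈-refl (q^ suc ω) (1# - q) _)) n

-- From the series to the cumulative functions

module Cumulation where
  open PowerSeries
  open GaussianBinomials
  open Decomposition
  open Comparison
  open Counting
  open CrankCounting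
  open +-*-Solver using () renaming (solve to solveℤ; _:=_ to _:≈_; _:+_ to _⊞_; _:-_ to _⊟_; con to conℤ)

  sumDown-cong : ∀ {f g} → (∀ r → f r ≡ g r) → ∀ m k → sumDown f m k ≡ sumDown g m k
  sumDown-cong p m zero    = refl
  sumDown-cong p m (suc k) = cong₂ ℤ._+_ (sumDown-cong p m k) (p (m ℤ.- + k))

  sumDown-0 : ∀ m k → sumDown (λ _ → 0ℤ) m k ≡ 0ℤ
  sumDown-0 m zero    = refl
  sumDown-0 m (suc k) = trans (ℤₚ.+-identityʳ _) (sumDown-0 m k)

  sumDown-+ : ∀ f g m k → sumDown (λ r → f r ℤ.+ g r) m k ≡ sumDown f m k ℤ.+ sumDown g m k
  sumDown-+ f g m zero    = refl
  sumDown-+ f g m (suc k) = trans (cong (ℤ._+ (f (m ℤ.- + k) ℤ.+ g (m ℤ.- + k))) (sumDown-+ f g m k))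
    (solveℤ 4 (λ a b c d → (a ⊞ b) ⊞ (c ⊞ d) :≈ (a ⊞ c) ⊞ (b ⊞ d)) refl (sumDown f m k) (sumDown g m k) (f (m ℤ.- + k)) (g (m ℤ.- + k)))

  δ : ℤ → ℤ → ℤ
  δ s r = indicator (does (s ℤ.≟ r))

  sumDown-δ-above : ∀ {s m} → m ℤ.< s → ∀ k → sumDown (δ s) m k ≡ 0ℤ
  sumDown-δ-above         m<s zero    = refl
  sumDown-δ-above {s} {m} m<s (suc k) = cong₂ ℤ._+_ (sumDown-δ-above m<s k)
    (cong indicator (dec-false (s ℤ.≟ m ℤ.- + k) λ s≡ → ℤₚ.<⇒≢ (ℤₚ.≤-<-trans (ℤₚ.i≤j⇒i-k≤j (+ k) (ℤₚ.≤-refl {m})) m<s) (sym s≡)))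

  sumDown-δ-below : ∀ m d k → sumDown (δ (m ℤ.- + d)) m k ≡ indicator (d ℕ.<ᵇ k)
  sumDown-δ-below m d zero    = refl
  sumDown-δ-below m d (suc k) = trans (cong₂ ℤ._+_ (sumDown-δ-below m d k)
      (cong indicator (does-⇔ (mk⇔ (λ p → ℤₚ.+-injective (ℤₚ.neg-injective (∙-cancelˡ m _ _ p))) (cong (λ d → m ℤ.- + d)))
        (m ℤ.- + d ℤ.≟ m ℤ.- + k) (d ℕ.≟ k))))
    (split d k)
    where
    split : ∀ d k → indicator (d ℕ.<ᵇ k) ℤ.+ indicator (d ℕ.≡ᵇ k) ≡ indicator (d ℕ.<ᵇ suc k)
    split zero    zero    = refl
    split zero    (suc k) = refl
    split (suc d) zero    = refl
    split (suc d) (suc k) = split d k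

  -- The bound on s ensures that the summation range, which reaches down to -n, does not stop short
  -- of s.
  cumulative-δ : ∀ n m {s} → ℤ.- + n ℤ.≤ s → cumulative (δ s) n m ≡ 1ℤ ℤ.- indicator (does (m ℤ.<? s))
  cumulative-δ n m {s} -n≤s with m ℤ.<? s
  ... | yes m<s = sumDown-δ-above m<s (suc (∣ m ∣ ℕ.+ n))
  ... | no  m≮s = begin
    sumDown (δ s) m (suc (∣ m ∣ ℕ.+ n))              ≡⟨ cong (λ s → sumDown (δ s) m (suc (∣ m ∣ ℕ.+ n))) s≡ ⟩
    sumDown (δ (m ℤ.- + d)) m (suc (∣ m ∣ ℕ.+ n))    ≡⟨ sumDown-δ-below m d (suc (∣ m ∣ ℕ.+ n)) ⟩
    indicator (d ℕ.<ᵇ suc (∣ m ∣ ℕ.+ n))             ≡⟨ cong indicator (dec-true (d ℕ.<? suc (∣ m ∣ ℕ.+ n)) (s≤s d≤)) ⟩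
    1ℤ                                               ∎
    where
    open ≡-Reasoning
    d : ℕ
    d = ∣ m ℤ.- s ∣
    d≡ : + d ≡ m ℤ.- s
    d≡ = ℤₚ.0≤i⇒+∣i∣≡i (ℤₚ.i≤j⇒0≤j-i (ℤₚ.≮⇒≥ m≮s))
    s≡ : s ≡ m ℤ.- + d
    s≡ = trans (solveℤ 2 (λ m s → s :≈ m ⊟ (m ⊟ s)) refl m s) (cong (λ d → m ℤ.- d) (sym d≡))
    i≤∣i∣ : ∀ i → i ℤ.≤ + ∣ i ∣
    i≤∣i∣ (+ _)     = ℤₚ.≤-refl
    i≤∣i∣ -[1+ _ ] = ℤ.-≤+
    d≤ : d ℕ.≤ ∣ m ∣ ℕ.+ n
    d≤ = ℤₚ.drop‿+≤+ (subst (ℤ._≤ + (∣ m ∣ ℕ.+ n)) (sym d≡)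
      (ℤₚ.+-mono-≤ (i≤∣i∣ m) (subst (ℤ.- s ℤ.≤_) (ℤₚ.neg-involutive (+ n)) (ℤₚ.neg-mono-≤ -n≤s))))

  length-filter-count : ∀ {A : Set} {P : A → Set} (P? : Decidable P) xs → + length (filter P? xs) ≡ count (λ x → does (P? x)) xs
  length-filter-count P? []       = refl
  length-filter-count P? (x ∷ xs) with does (P? x)
  ... | true  = cong (ℤ._+_ 1ℤ) (length-filter-count P? xs)
  ... | false = trans (length-filter-count P? xs) (sym (ℤₚ.+-identityˡ _))

  cumulative-count : ∀ n m (stat : List ℕ → ℤ) {xs} → All (λ x → ℤ.- + n ℤ.≤ stat x) xs →
    cumulative (λ r → + length (filter (λ x → stat x ℤ.≟ r) xs)) n m ≡ + length xs ℤ.- count (λ x → does (m ℤ.<? stat x)) xs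
  cumulative-count n m stat {xs} stat≥ = trans (sumDown-cong (λ r → length-filter-count (λ x → stat x ℤ.≟ r) xs) m (suc (∣ m ∣ ℕ.+ n))) (go stat≥)
    where
    go : ∀ {xs} → All (λ x → ℤ.- + n ℤ.≤ stat x) xs →
      cumulative (λ r → count (λ x → does (stat x ℤ.≟ r)) xs) n m ≡ + length xs ℤ.- count (λ x → does (m ℤ.<? stat x)) xs
    go [] = sumDown-0 m (suc (∣ m ∣ ℕ.+ n))
    go (_∷_ {x} {xs} p ps) = trans (sumDown-+ (δ (stat x)) (λ r → count (λ x → does (stat x ℤ.≟ r)) xs) m (suc (∣ m ∣ ℕ.+ n))) (trans (cong₂ ℤ._+_ (cumulative-δ n m p) (go ps))
      (solveℤ 3 (λ i l c → (conℤ 1ℤ ⊟ i) ⊞ (l ⊟ c) :≈ (conℤ 1ℤ ⊞ l) ⊟ (i ⊞ c)) refl (indicator (does (m ℤ.<? stat x))) (+ length xs) _))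

  cumulative-partitions : ∀ n m (stat : List ℕ → ℤ) → (∀ {n ps} → IsPartition n ps → ℤ.- + n ℤ.≤ stat ps) →
    cumulative (λ r → + length (filter (λ x → stat x ℤ.≟ r) (partitions n))) n m
      ≡ + length (partitions n) ℤ.- count (λ ps → does (m ℤ.<? stat ps)) (partitions n)
  cumulative-partitions n m stat stat≥ = cumulative-count n m stat (All.tabulate λ ps∈ → stat≥ (partitions-sound ps∈))

  N≤-B : ∀ m n → N≤ (+ m) (suc n) ≡ + length (partitions (suc n)) ℤ.- B (suc (suc m)) (suc n)
  N≤-B m n = trans (cumulative-partitions (suc n) (+ m) rank rank-≥) (cong (λ c → + length (partitions (suc n)) ℤ.- c)
    (trans (count-cong (All.universal (λ ps → difference-<₀ m (largestPart ps) (length ps)) (partitions (suc n)))) (B-counts (suc m) n)))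

  N≤-B-pred : ∀ m n → N≤ (+ m ℤ.- 1ℤ) (suc n) ≡ + length (partitions (suc n)) ℤ.- B (suc m) (suc n)
  N≤-B-pred m n = trans (cumulative-partitions (suc n) (+ m ℤ.- 1ℤ) rank rank-≥) (cong (λ c → + length (partitions (suc n)) ℤ.- c)
    (trans (count-cong (All.universal (λ ps → difference-< m 1 (largestPart ps) (length ps)) (partitions (suc n)))) (B-counts m n)))

  -- By `A-M̄` the series `A m` is divisible by q^(m+1), and `M̄ 1` has constant term 1.
  A-one : ∀ m → A m 1 ≡ indicator (m ℕ.<ᵇ 1)
  A-one m = trans (coeff (A-M̄ m) 1) (value m)
    where
    value : ∀ m → (q^ suc m * M̄ (suc m)) 1 ≡ indicator (m ℕ.<ᵇ 1)
    value (suc m) = q^*-below (suc (suc m)) (M̄ (suc (suc m))) (s≤s (s≤s z≤n))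
    value zero    = trans (q^*-above 1 (M̄ 1) 0) (trans (leading _) (trans (coeff (≈-trans (*-identityˡ _) (*-identityˡ _)) 0)
      (trans (leading (G 0)) (constant-zero 1ℤ))))
      where
      leading : ∀ s → ∑ s 0 ≡ s 0 0
      leading s = trans (coeff (∑-unfold s) 0) (trans (+-coeff _ _ 0) (trans (cong (ℤ._+_ (s 0 0)) (q*-zero _)) (ℤₚ.+-identityʳ _)))

  M≤-A : ∀ m n → M≤ (+ m) (suc n) ≡ + length (partitions (suc n)) ℤ.- A m (suc n)
  M≤-A m (suc n) = trans (cumulative-partitions (suc (suc n)) (+ m) crank crank-≥)
    (cong (λ c → + length (partitions (suc (suc n))) ℤ.- c) (A-counts m n))
  M≤-A m zero = begin
    M≤ (+ m) 1                                                     ≡⟨ solveℤ 1 (λ x → x :≈ x ⊞ conℤ 1ℤ ⊟ conℤ 1ℤ) refl _ ⟩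
    M≤ (+ m) 1 ℤ.+ 1ℤ ℤ.- 1ℤ                                       ≡⟨ cong (ℤ._- 1ℤ) total ⟩
    1ℤ ℤ.+ (1ℤ ℤ.- indicator (m ℕ.<ᵇ 1)) ℤ.- 1ℤ                    ≡⟨ solveℤ 1 (λ x → conℤ 1ℤ ⊞ x ⊟ conℤ 1ℤ :≈ x) refl _ ⟩
    1ℤ ℤ.- indicator (m ℕ.<ᵇ 1)                                    ≡⟨ cong (λ c → 1ℤ ℤ.- c) (A-one m) ⟨
    1ℤ ℤ.- A m 1                                                   ∎
    where
    open ≡-Reasoning
    -- The convention consists of point masses 1 at -1 and at 1 and a mass -1 at 0; the last is
    -- moved to the left side.
    M₁-δ : ∀ r → M r 1 ℤ.+ δ 0ℤ r ≡ δ -1ℤ r ℤ.+ δ 1ℤ r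
    M₁-δ (+ 0)             = refl
    M₁-δ (+ 1)             = refl
    M₁-δ (+ suc (suc _))   = refl
    M₁-δ -[1+ 0 ]          = refl
    M₁-δ -[1+ suc _ ]      = refl
    total : M≤ (+ m) 1 ℤ.+ 1ℤ ≡ 1ℤ ℤ.+ (1ℤ ℤ.- indicator (m ℕ.<ᵇ 1))
    total = begin
      M≤ (+ m) 1 ℤ.+ 1ℤ                                              ≡⟨ cong (ℤ._+_ (M≤ (+ m) 1)) (cumulative-δ 1 (+ m) {0ℤ} ℤ.-≤+) ⟨
      M≤ (+ m) 1 ℤ.+ cumulative (δ 0ℤ) 1 (+ m)                       ≡⟨ sumDown-+ (λ r → M r 1) (δ 0ℤ) (+ m) (suc (m ℕ.+ 1)) ⟨
      cumulative (λ r → M r 1 ℤ.+ δ 0ℤ r) 1 (+ m)                    ≡⟨ sumDown-cong M₁-δ (+ m) (suc (m ℕ.+ 1)) ⟩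
      cumulative (λ r → δ -1ℤ r ℤ.+ δ 1ℤ r) 1 (+ m)                  ≡⟨ sumDown-+ (δ -1ℤ) (δ 1ℤ) (+ m) (suc (m ℕ.+ 1)) ⟩
      cumulative (δ -1ℤ) 1 (+ m) ℤ.+ cumulative (δ 1ℤ) 1 (+ m)
        ≡⟨ cong₂ ℤ._+_ (cumulative-δ 1 (+ m) { -1ℤ} ℤₚ.≤-refl) (cumulative-δ 1 (+ m) {1ℤ} ℤ.-≤+) ⟩
      1ℤ ℤ.+ (1ℤ ℤ.- indicator (m ℕ.<ᵇ 1))                           ∎

  ≼-coeff : ∀ {f g} → f ≼ g → ∀ n → f n ℤ.≤ g n
  ≼-coeff {f} {g} f≼g n = ℤₚ.0≤i-j⇒j≤i (subst (0ℤ ℤ.≤_) (sub-coeff g f n) (coeff≥0 f≼g n))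

  sub-antimono : ∀ l {a b} → a ℤ.≤ b → l ℤ.- b ℤ.≤ l ℤ.- a
  sub-antimono l a≤b = ℤₚ.+-monoʳ-≤ l (ℤₚ.neg-mono-≤ a≤b)

open Comparison using (B≼A; A≼B)
open Cumulation using (N≤-B; N≤-B-pred; M≤-A; ≼-coeff; sub-antimono)
open import Data.Integer using (_-_; _≥_)

theorem3p1 : (m : ℤ) (n : ℕ) → m ≥ 0ℤ → n ℕ.≥ 1 → (N≤ m n ≥ M≤ m n) × (M≤ m n ≥ N≤ (m - 1ℤ) n)
theorem3p1 (+ m) (suc n) _ _ =
    subst₂ ℤ._≤_ (sym (M≤-A m n)) (sym (N≤-B m n)) (sub-antimono (+ length (partitions (suc n))) (≼-coeff (B≼A m) (suc n)))
  , subst₂ ℤ._≤_ (sym (N≤-B-pred m n)) (sym (M≤-A m n)) (sub-antimono (+ length (partitions (suc n))) (≼-coeff (A≼B m) (suc n)))
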